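{- For every integer $v\geq 15$ with $v\equiv 0$ or $1 \pmod 5$, there exists a super-simple $(v,5,2)$DD with $d\geq \frac{1}{2}$, i.e. whose smallest defining sets contain at least half of its blocks.
   Context: A $(v,5,2)$ directed design ($(v,5,2)$DD) on a $v$-set $V$ is a collection $\mathcal B$ of blocks, each an ordered $5$-tuple of distinct elements of $V$, such that every ordered pair $(x,y)$ of distinct elements of $V$ is contained in exactly $2$ blocks, where a block $(b_1,\dots,b_5)$ contains the ordered pair $(b_i,b_j)$ whenever $i<j$. Forgetting the order in each block gives the underlying design (a $(v,5,4)$-BIBD). The $(v,5,2)$DD is super-simple if any two blocks of its underlying design intersect in at most two points. A defining set of a $(v,5,2)$DD $(V,\mathcal B)$ is a subset $S\subseteq \mathcal B$ such that $(V,\mathcal B)$ is the unique $(v,5,2)$DD on $V$ whose block collection contains $S$; a smallest defining set is a defining set of minimum cardinality. The quantity $d$ is the number of blocks in a smallest defining set divided by the total number of blocks of the design. -}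

module Defs where

open import Data.Nat using (ℕ; zero; suc; _+_; _*_; _≤_; _%_; _<ᵇ_)
open import Data.Bool using (Bool; true; false; _∧_; _∨_; if_then_else_)
open import Data.Fin using (Fin; toℕ) renaming (_≟_ to _≟ᶠ_)
open import Data.Fin.Properties using ()
open import Data.Vec using (Vec; lookup)
open import Data.List using (List; []; _∷_; _++_; length; map; foldr)
open import Data.List.Base using () renaming (lookup to lookupL)
open import Data.List.Relation.Binary.Permutation.Propositional using (_↭_)
open import Data.Product using (Σ; ∃; _×_; _,_)
open import Data.Sum using (_⊎_)
open import Function.Definitions using (Injective)
open import Relation.Binary.PropositionalEquality using (_≡_)
open import Relation.Nullary using (¬_)
open import Relation.Nullary.Decidable using (⌊_⌋)

sumFin : (n : ℕ) → (Fin n → ℕ) → ℕ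
sumFin zero    f = 0
sumFin (suc n) f = f Fin.zero + sumFin n (λ i → f (Fin.suc i))

anyFin : (n : ℕ) → (Fin n → Bool) → Bool
anyFin zero    p = false
anyFin (suc n) p = p Fin.zero ∨ anyFin n (λ i → p (Fin.suc i))

bool→ℕ : Bool → ℕ
bool→ℕ true  = 1
bool→ℕ false = 0

Block : ℕ → Set
Block v = Vec (Fin v) 5

DistinctBlock : ∀ {v} → Block v → Set
DistinctBlock b = Injective _≡_ _≡_ (lookup b)

containsPairᵇ : ∀ {v} → Block v → Fin v → Fin v → Bool
containsPairᵇ b x y =
  anyFin 5 (λ i → anyFin 5 (λ j →
    (toℕ i <ᵇ toℕ j) ∧ (⌊ lookup b i ≟ᶠ x ⌋ ∧ ⌊ lookup b j ≟ᶠ y ⌋)))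

pairCount : ∀ {v} → List (Block v) → Fin v → Fin v → ℕ
pairCount []       x y = 0
pairCount (b ∷ bs) x y = bool→ℕ (containsPairᵇ b x y) + pairCount bs x y

-- a (v,5,2) directed design on V = Fin v, blocks as a list (multiset)
IsDD : (v : ℕ) → List (Block v) → Set
IsDD v B =
  ((i : Fin (length B)) → DistinctBlock (lookupL B i)) ×
  ((x y : Fin v) → ¬ (x ≡ y) → pairCount B x y ≡ 2)

memᵇ : ∀ {v} → Fin v → Block v → Bool
memᵇ x b = anyFin 5 (λ i → ⌊ lookup b i ≟ᶠ x ⌋)

intersectionSize : ∀ {v} → Block v → Block v → ℕ
intersectionSize {v} b c = sumFin v (λ x → bool→ℕ (memᵇ x b ∧ memᵇ x c))

SuperSimple : ∀ {v} → List (Block v) → Set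
SuperSimple B = (i j : Fin (length B)) → ¬ (i ≡ j) →
  intersectionSize (lookupL B i) (lookupL B j) ≤ 2

_⊆ₘ_ : ∀ {v} → List (Block v) → List (Block v) → Set
S ⊆ₘ B = ∃ λ R → (S ++ R) ↭ B

IsDefiningSet : (v : ℕ) → List (Block v) → List (Block v) → Set
IsDefiningSet v B S =
  S ⊆ₘ B × ((B′ : List (Block v)) → IsDD v B′ → S ⊆ₘ B′ → B′ ↭ B)

-- d ≥ 1/2: every defining set (hence a smallest one) has at least half the blocks
SmallestDefiningRatioAtLeastHalf : (v : ℕ) → List (Block v) → Set
SmallestDefiningRatioAtLeastHalf v B =
  (S : List (Block v)) → IsDefiningSet v B S → length B ≤ 2 * length S

{-# OPTIONS --safe #-}

-- If x and y are adjacent in two blocks, as x y in the first and as y x in the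
-- second, then exchanging x and y in both blocks gives another design: the two
-- blocks form a trade.  By super-simplicity the new blocks do not occur in the
-- original design, so a defining set must contain a block of every trade.
-- Hence, if π is a permutation of the blocks such that b and π b always form a
-- trade, then every defining set contains at least half of the blocks.
--
-- Super-simple designs with such a permutation exist for v = 5 n and v = 5 n + 1
-- with n < 38: they are developed from base blocks over ℤ/(5 n - 1) ∪ {∞} and
-- ℤ/(5 n + 1), except for v = 15 and v = 16.  For larger n one takes a transversal
-- design with 7 groups of size m, truncates two of the groups to sizes a and b,
-- where n = 5 m + a + b, gives weight 5 to every point and fills in the groups
-- by induction.  Since two blocks of the transversal design share at most one
-- point, super-simplicity is inherited from the ingredients, which are group
-- divisible designs with 5, 6 and 7 groups of size 5.

module Submission where

-- The factor one half comes from an injection. If a defining set S has complement R, then b and π b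
-- cannot both lie in R, so π maps R injectively into S. Hence every construction has to carry π
-- along with the blocks. The small designs must be checkable by evaluation. Three common points of
-- two blocks produce a repeated numerical code of a triple, and a prescribed number of blocks on
-- each ordered pair is a prescribed multiplicity of each difference. Both conditions are decided by
-- sorting one list of numbers. In the recursion a truncated group of size 1 or 2 would have to be
-- filled with a design on 5, 6, 10 or 11 points, outside the range of the theorem. So a and b are 0
-- or at least 3, and n - 5 m is taken between 3 and 2 m. The least m used is 7, and 5 * 7 + 3 = 38
-- is where the recursion starts. The transversal designs consist of lines over ℤ/m with m prime to
-- 60, or over 𝔽₉; for large n, six consecutive candidates always contain such an m. The classes 5 n
-- and 5 n + 1 are treated together, as zero or one point at infinity that all filled groups share.

open import Defs
open import Data.Nat using (ℕ; zero; suc; _+_; _*_; _∸_; _≤_; _<_; _%_; _/_; _<ᵇ_; _≡ᵇ_; z≤n; s≤s; z<s; NonZero; >-nonZero)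
open import Data.Nat.Properties as ℕ using (_≟_; _<?_; _≤?_)
open import Data.Nat.DivMod hiding (_%_; _/_)
open import Data.Nat.Divisibility using (_∣_; divides; ∣-refl; n∣m⇒m%n≡0)
open import Data.Nat.Induction using (<-rec)
open import Data.Nat.ListAction using (sum)
open import Data.Nat.ListAction.Properties using (sum-++; sum-↭)
open import Data.Nat.Tactic.RingSolver using (solve-∀)
open import Algebra.Properties.CommutativeSemigroup ℕ.+-commutativeSemigroup using (x∙yz≈y∙xz) renaming (interchange to +-interchange)
open import Data.Bool using (Bool; true; false; if_then_else_; _∧_; T; T?)
open import Data.Bool.Properties using (T-∧)
open import Data.Fin as Fin using (Fin; toℕ)
import Data.Fin.Properties as Finₚ
open import Data.Vec as Vec using (Vec; []; _∷_; lookup; toList)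
import Data.Vec.Properties as Vecₚ
open import Data.List using (List; []; _∷_; _++_; _∷ʳ_; length; map; concat; concatMap; filter; replicate; reverse; upTo; applyUpTo)
open import Data.List.Base using () renaming (lookup to lookupL)
open import Data.List.Properties using (map-++; map-∘; map-cong; map-id; map-concatMap; concatMap-map; concatMap-++; concatMap-cong; concat-map-[_]; ++-identityʳ; ++-assoc; upTo-∷ʳ; map-applyUpTo; length-++; length-map; length-filter; length-upTo; filter-accept)
open import Data.List.Membership.Propositional using (_∈_; _∉_; find)
open import Data.List.Membership.Propositional.Properties using (∈-map⁺; ∈-map⁻; ∈-++⁺ˡ; ∈-++⁺ʳ; ∈-++⁻; ∈-concatMap⁺; ∈-concatMap⁻; ∈-upTo⁺; ∈-upTo⁻; ∈-applyUpTo⁺; ∈-filter⁺; ∈-filter⁻; ∈-∃++; ∈-lookup)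
import Data.List.Membership.DecPropositional as DecMembership
open import Data.List.Relation.Unary.Any as Any using (Any; here; there)
open import Data.List.Relation.Unary.All as All using (All; []; _∷_)
import Data.List.Relation.Unary.All.Properties as Allₚ
open import Data.List.Relation.Unary.AllPairs as AllPairs using (AllPairs; []; _∷_)
import Data.List.Relation.Unary.AllPairs.Properties as AllPairsₚ
open import Data.List.Relation.Binary.Permutation.Propositional using (_↭_; ↭-refl; ↭-sym; ↭-trans; ↭-reflexive; prep; ↭⇒↭ₛ)
import Data.List.Relation.Binary.Permutation.Propositional.Properties as ↭ₚ
import Data.List.Relation.Binary.Permutation.Setoid.Properties as ↭ₛₚ
open import Data.Product as Product using (Σ; ∃; ∃₂; _×_; _,_; proj₁; proj₂; uncurry; swap)
open import Data.Product.Properties using () renaming (≡-dec to ×-≡-dec)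
open import Data.Sum using (_⊎_; inj₁; inj₂)
open import Data.Unit using (tt)
open import Function using (_∘_; id; _on_; Equivalence)
open import Relation.Nullary using (¬_; Dec; yes; no; does; contradiction)
open import Relation.Nullary.Decidable using (_×-dec_; _⊎-dec_; ¬?; dec-true; dec-false; ⌊_⌋; toWitness; fromWitness)
open import Relation.Binary using (DecidableEquality; tri<; tri≈; tri>)
open import Relation.Binary.PropositionalEquality

-- Finite sums

private variable
  A C I I′ : Set

𝟙 : {P : Set} → Dec P → ℕ
𝟙 d = if does d then 1 else 0

𝟙-yes : {P : Set} (d : Dec P) → P → 𝟙 d ≡ 1
𝟙-yes (yes _) _ = refl
𝟙-yes (no ¬p) p = contradiction p ¬p

𝟙-no : {P : Set} (d : Dec P) → ¬ P → 𝟙 d ≡ 0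
𝟙-no (no _) _ = refl
𝟙-no (yes p) ¬p = contradiction p ¬p

𝟙-cong : {P Q : Set} (d : Dec P) (e : Dec Q) → (P → Q) → (Q → P) → 𝟙 d ≡ 𝟙 e
𝟙-cong (yes p) e f g = sym (𝟙-yes e (f p))
𝟙-cong (no ¬p) e f g = sym (𝟙-no e (¬p ∘ g))

fromDoes : {P : Set} (d : Dec P) → does d ≡ true → P
fromDoes (yes p) _ = p

-- Degrees mostly have the form `2 * 𝟙 d`, so the occurrence of a pair in a block can be turned into
-- evidence about its two points.
2𝟙-pos : {P : Set} (d : Dec P) → 1 ≤ 2 * 𝟙 d → P
2𝟙-pos (yes p) _ = p
2𝟙-pos (no _) ()

∑ : List I → (I → ℕ) → ℕ
∑ is f = sum (map f is)

∑-cong : {is : List I} {f g : I → ℕ} → (∀ {i} → i ∈ is → f i ≡ g i) → ∑ is f ≡ ∑ is g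
∑-cong {is = []} e = refl
∑-cong {is = i ∷ is} e = cong₂ _+_ (e (here refl)) (∑-cong (e ∘ there))

∑-zero : {is : List I} {f : I → ℕ} → (∀ {i} → i ∈ is → f i ≡ 0) → ∑ is f ≡ 0
∑-zero {is = []} e = refl
∑-zero {is = i ∷ is} e = cong₂ _+_ (e (here refl)) (∑-zero (e ∘ there))

∑-mono : {is : List I} {f g : I → ℕ} → (∀ {i} → i ∈ is → f i ≤ g i) → ∑ is f ≤ ∑ is g
∑-mono {is = []} e = z≤n
∑-mono {is = i ∷ is} e = ℕ.+-mono-≤ (e (here refl)) (∑-mono (e ∘ there))

∑-++ : (is js : List I) {f : I → ℕ} → ∑ (is ++ js) f ≡ ∑ is f + ∑ js f
∑-++ is js {f} = trans (cong sum (map-++ f is js)) (sum-++ (map f is) (map f js))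

∑-map : (h : I′ → I) (js : List I′) {f : I → ℕ} → ∑ (map h js) f ≡ ∑ js (f ∘ h)
∑-map h js = cong sum (sym (map-∘ js))

∑-concatMap : (h : I′ → List I) (js : List I′) {f : I → ℕ} →
  ∑ (concatMap h js) f ≡ ∑ js (λ j → ∑ (h j) f)
∑-concatMap h [] = refl
∑-concatMap h (j ∷ js) = trans (∑-++ (h j) (concatMap h js)) (cong (_ +_) (∑-concatMap h js))

∑-+ : (is : List I) (f g : I → ℕ) → ∑ is (λ i → f i + g i) ≡ ∑ is f + ∑ is g
∑-+ [] f g = refl
∑-+ (i ∷ is) f g =
  trans (cong (f i + g i +_) (∑-+ is f g)) (+-interchange (f i) (g i) (∑ is f) (∑ is g))

∑-swap : (is : List I) (js : List I′) (f : I → I′ → ℕ) →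
  ∑ is (λ i → ∑ js (f i)) ≡ ∑ js (λ j → ∑ is (λ i → f i j))
∑-swap [] js f = sym (∑-zero {is = js} (λ _ → refl))
∑-swap (i ∷ is) js f = trans (cong (∑ js (f i) +_) (∑-swap is js f)) (sym (∑-+ js (f i) _))

∑-*ˡ : (c : ℕ) (is : List I) (f : I → ℕ) → ∑ is (λ i → c * f i) ≡ c * ∑ is f
∑-*ˡ c [] f = sym (ℕ.*-zeroʳ c)
∑-*ˡ c (i ∷ is) f = trans (cong (c * f i +_) (∑-*ˡ c is f)) (sym (ℕ.*-distribˡ-+ c (f i) _))

∑-≥ : {is : List I} (f : I → ℕ) {i : I} → i ∈ is → f i ≤ ∑ is f
∑-≥ f (here refl) = ℕ.m≤m+n _ _
∑-≥ f (there i∈) = ℕ.≤-trans (∑-≥ f i∈) (ℕ.m≤n+m _ _)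

∑-unique : {is : List I} (f : I → ℕ) {i : I} → AllPairs _≢_ is → i ∈ is →
  (∀ {j} → j ∈ is → j ≢ i → f j ≡ 0) → ∑ is f ≡ f i
∑-unique f (i∉ ∷ u) (here refl) z =
  trans (cong (f _ +_) (∑-zero (λ j∈ → z (there j∈) (≢-sym (All.lookup i∉ j∈))))) (ℕ.+-identityʳ _)
∑-unique f (j∉ ∷ u) (there i∈) z =
  cong₂ _+_ (z (here refl) (All.lookup j∉ i∈)) (∑-unique f u i∈ (z ∘ there))

upTo-unique : ∀ n → AllPairs _≢_ (upTo n)
upTo-unique n = AllPairsₚ.applyUpTo⁺₁ id n (λ i<j _ → ℕ.<⇒≢ i<j)

∑-upTo : ∀ {n i} (f : ℕ → ℕ) → i < n → (∀ j → j < n → j ≢ i → f j ≡ 0) → ∑ (upTo n) f ≡ f i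
∑-upTo {n} f i<n z = ∑-unique f (upTo-unique n) (∈-upTo⁺ i<n) (λ j∈ → z _ (∈-upTo⁻ j∈))

AllPairs-∈ : ∀ {R : A → A → Set} {xs x y} → AllPairs R xs → x ∈ xs → y ∈ xs → x ≡ y ⊎ R x y ⊎ R y x
AllPairs-∈ (r ∷ rs) (here refl) (here refl) = inj₁ refl
AllPairs-∈ (r ∷ rs) (here refl) (there y∈) = inj₂ (inj₁ (All.lookup r y∈))
AllPairs-∈ (r ∷ rs) (there x∈) (here refl) = inj₂ (inj₂ (All.lookup r x∈))
AllPairs-∈ (r ∷ rs) (there x∈) (there y∈) = AllPairs-∈ rs x∈ y∈

-- Blocks and trades

pairs : List A → List (A × A)
pairs [] = []
pairs (a ∷ as) = map (a ,_) as ++ pairs as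

∈-pairs⁻ : {a c : A} {b : List A} → (a , c) ∈ pairs b → a ∈ b × c ∈ b
∈-pairs⁻ {b = d ∷ b} p with ∈-++⁻ (map (d ,_) b) p
... | inj₂ q = Product.map there there (∈-pairs⁻ q)
... | inj₁ q with ∈-map⁻ (d ,_) q
... | _ , c∈ , refl = here refl , there c∈

∈-pairs⁺ : {x y : A} {b : List A} → x ∈ b → y ∈ b → x ≢ y → (x , y) ∈ pairs b ⊎ (y , x) ∈ pairs b
∈-pairs⁺ (here refl) (here refl) ne = contradiction refl ne
∈-pairs⁺ (here refl) (there y∈) ne = inj₁ (∈-++⁺ˡ (∈-map⁺ _ y∈))
∈-pairs⁺ (there x∈) (here refl) ne = inj₂ (∈-++⁺ˡ (∈-map⁺ _ x∈))
∈-pairs⁺ {b = d ∷ b} (there x∈) (there y∈) ne with ∈-pairs⁺ x∈ y∈ ne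
... | inj₁ p = inj₁ (∈-++⁺ʳ (map (d ,_) b) p)
... | inj₂ p = inj₂ (∈-++⁺ʳ (map (d ,_) b) p)

pairs-map : (φ : A → C) (b : List A) → pairs (map φ b) ≡ map (Product.map φ φ) (pairs b)
pairs-map φ [] = refl
pairs-map φ (a ∷ b) = begin
  map (φ a ,_) (map φ b) ++ pairs (map φ b)
    ≡⟨ cong₂ _++_ (trans (sym (map-∘ b)) (map-∘ b)) (pairs-map φ b) ⟩
  map (Product.map φ φ) (map (a ,_) b) ++ map (Product.map φ φ) (pairs b)
    ≡⟨ map-++ (Product.map φ φ) (map (a ,_) b) (pairs b) ⟨
  map (Product.map φ φ) (pairs (a ∷ b)) ∎
  where open ≡-Reasoning

-- The bound of two on the intersection is expressed without counting, so that it passes along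
-- injective maps, and blocks sharing at most one point satisfy it at once.
Few : List A → List A → Set
Few b c = ∀ x y z → x ∈ b → x ∈ c → y ∈ b → y ∈ c → z ∈ b → z ∈ c → x ≡ y ⊎ x ≡ z ⊎ y ≡ z

Few-map : {S : A → Set} {φ : A → C} → (∀ {x y} → S x → S y → φ x ≡ φ y → x ≡ y) →
  ∀ {b c} → (∀ {x} → x ∈ b → S x) → (∀ {x} → x ∈ c → S x) → Few b c → Few (map φ b) (map φ c)
Few-map {φ = φ} inj {b} {c} Sb Sc few _ _ _ x∈b x∈c y∈b y∈c z∈b z∈c
  with pre x∈b x∈c | pre y∈b y∈c | pre z∈b z∈c
  where
  pre : ∀ {X} → X ∈ map φ b → X ∈ map φ c → ∃ λ x → x ∈ b × x ∈ c × φ x ≡ X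
  pre p q with ∈-map⁻ φ p | ∈-map⁻ φ q
  ... | x , x∈ , refl | y , y∈ , eq with inj (Sb x∈) (Sc y∈) eq
  ... | refl = x , x∈ , y∈ , refl
... | _ , a , a′ , refl | _ , b , b′ , refl | _ , c , c′ , refl with few _ _ _ a a′ b b′ c c′
... | inj₁ e = inj₁ (cong φ e)
... | inj₂ (inj₁ e) = inj₂ (inj₁ (cong φ e))
... | inj₂ (inj₂ e) = inj₂ (inj₂ (cong φ e))

data Adj (x y : A) : List A → Set where
  here  : ∀ {as} → Adj x y (x ∷ y ∷ as)
  there : ∀ {a as} → Adj x y as → Adj x y (a ∷ as)

Adj-map : (φ : A → C) {x y : A} {b : List A} → Adj x y b → Adj (φ x) (φ y) (map φ b)
Adj-map φ here = here
Adj-map φ (there p) = there (Adj-map φ p)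

Trade : List A → List A → Set
Trade b c = ∃₂ λ x y → Adj x y b × Adj y x c

Trade-map : (φ : A → C) {b c : List A} → Trade b c → Trade (map φ b) (map φ c)
Trade-map φ (x , y , p , q) = φ x , φ y , Adj-map φ p , Adj-map φ q

module Count {A : Set} (_≟_ : DecidableEquality A) where

  -- Counting with multiplicity, unlike the Boolean test `containsPairᵇ`, is additive in the list
  -- and compatible with relabelling.
  hits : List (A × A) → A → A → ℕ
  hits ps x y = ∑ ps (λ p → 𝟙 ((proj₁ p ≟ x) ×-dec (proj₂ p ≟ y)))

  hits-∈ : ∀ {ps x y} → (x , y) ∈ ps → 1 ≤ hits ps x y
  hits-∈ {ps} {x} {y} p =
    subst (_≤ hits ps x y) (𝟙-yes (x ≟ x ×-dec y ≟ y) (refl , refl)) (∑-≥ _ p)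

  hits-∉ : ∀ {ps x y} → ¬ ((x , y) ∈ ps) → hits ps x y ≡ 0
  hits-∉ {ps} {x} {y} ∉ = ∑-zero {is = ps} (λ { {a , c} p → 𝟙-no (a ≟ x ×-dec c ≟ y) (λ { (refl , refl) → ∉ p }) })

  -- The second component of each entry is a block that forms a trade with the
  -- first one; listing the second components merely permutes the blocks.
  record Design (R : A → A → ℕ) (ps : List (List A × List A)) : Set where
    field
      length5  : All (λ p → length (proj₁ p) ≡ 5) ps
      count    : ∀ x y → ∑ ps (λ p → hits (pairs (proj₁ p)) x y) ≡ R x y
      simple   : AllPairs (Few on proj₁) ps
      partners : map proj₂ ps ↭ map proj₁ ps
      trades   : All (uncurry Trade) ps

  open Design public

  module _ {R ps} (D : Design R ps) {p : List A × List A} (p∈ : p ∈ ps) where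

    count-∈ : ∀ {x y} → (x , y) ∈ pairs (proj₁ p) → 1 ≤ R x y
    count-∈ {x} {y} q = subst (1 ≤_) (count D x y) (ℕ.≤-trans (hits-∈ q) (∑-≥ _ p∈))

    together : ∀ {x y} → x ∈ proj₁ p → y ∈ proj₁ p → x ≢ y → 1 ≤ R x y ⊎ 1 ≤ R y x
    together x∈ y∈ ne with ∈-pairs⁺ x∈ y∈ ne
    ... | inj₁ q = inj₁ (count-∈ q)
    ... | inj₂ q = inj₂ (count-∈ q)

    -- A block of length 5 has a second entry, so each of its points occurs in some counted pair.
    -- The degree function `R` therefore determines where the points of a design can lie, and no
    -- point set is stored in `Design`.
    support : ∀ {x} → x ∈ proj₁ p → ∃ λ y → 1 ≤ R x y ⊎ 1 ≤ R y x
    support x∈ with proj₁ p in eq | All.lookup (length5 D) p∈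
    support (here refl) | a ∷ b ∷ _ | _ = b , inj₁ (count-∈ (subst (λ b → _ ∈ pairs b) (sym eq) (here refl)))
    support (there x∈) | a ∷ b ∷ _ | _ =
      a , inj₂ (count-∈ (subst (λ b → _ ∈ pairs b) (sym eq) (∈-++⁺ˡ (∈-map⁺ (a ,_) x∈))))

  Design-cong : ∀ {R R′ ps} → (∀ x y → R x y ≡ R′ x y) → Design R ps → Design R′ ps
  Design-cong e D = record
    { length5 = length5 D ; count = λ x y → trans (count D x y) (e x y) ; simple = simple D
    ; partners = partners D ; trades = trades D }

  Design-[] : Design (λ _ _ → 0) []
  Design-[] = record { length5 = [] ; count = λ _ _ → refl ; simple = [] ; partners = ↭-refl ; trades = [] }

  Design-++ : ∀ {R R′ ps qs} → Design R ps → Design R′ qs →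
    (∀ {p q} → p ∈ ps → q ∈ qs → Few (proj₁ p) (proj₁ q)) →
    Design (λ x y → R x y + R′ x y) (ps ++ qs)
  Design-++ {ps = ps} {qs} D E cross = record
    { length5 = Allₚ.++⁺ (length5 D) (length5 E)
    ; count = λ x y → trans (∑-++ ps qs) (cong₂ _+_ (count D x y) (count E x y))
    ; simple = AllPairsₚ.++⁺ (simple D) (simple E) (All.tabulate (λ p∈ → All.tabulate (cross p∈)))
    ; partners = subst₂ _↭_ (sym (map-++ proj₂ ps qs)) (sym (map-++ proj₁ ps qs)) (↭ₚ.++⁺ (partners D) (partners E))
    ; trades = Allₚ.++⁺ (trades D) (trades E) }

  Design-concat : {R : I → A → A → ℕ} {ps : I → List (List A × List A)} {is : List I} →
    (∀ {i} → i ∈ is → Design (R i) (ps i)) →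
    AllPairs (λ i j → ∀ {p q} → p ∈ ps i → q ∈ ps j → Few (proj₁ p) (proj₁ q)) is →
    Design (λ x y → ∑ is (λ i → R i x y)) (concatMap ps is)
  Design-concat D [] = Design-[]
  Design-concat {ps = ps} {i ∷ is} D (c ∷ cs) = Design-++ (D (here refl)) (Design-concat (D ∘ there) cs) cross
    where
    cross : ∀ {p q} → p ∈ ps i → q ∈ concatMap ps is → Few (proj₁ p) (proj₁ q)
    cross {p} {q} p∈ q∈ = go is c q∈
      where
      go : ∀ js → All (λ j → ∀ {p q} → p ∈ ps i → q ∈ ps j → Few (proj₁ p) (proj₁ q)) js →
        q ∈ concatMap ps js → Few (proj₁ p) (proj₁ q)
      go (j ∷ js) (f ∷ fs) q∈ with ∈-++⁻ (ps j) q∈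
      ... | inj₁ q∈j = f p∈ q∈j
      ... | inj₂ q∈js = go js fs q∈js

module _ {A B : Set} (_≟ᴬ_ : DecidableEquality A) (_≟ᴮ_ : DecidableEquality B) where
  private
    module CA = Count _≟ᴬ_
    module CB = Count _≟ᴮ_

  -- The relabelling has to be injective only on a set `S` that contains all points of the blocks.
  -- Labels outside its image meet no new block, so the new degree must vanish there.
  Design-map : (φ : A → B) (S : A → Set) → (∀ {x y} → S x → S y → φ x ≡ φ y → x ≡ y) →
    (∀ X → (∃ λ x → S x × φ x ≡ X) ⊎ (∀ {x} → S x → φ x ≢ X)) →
    ∀ {R ps} → CA.Design R ps → (∀ {p x} → p ∈ ps → x ∈ proj₁ p → S x) →
    ∀ {R′ : B → B → ℕ} → (∀ {x y} → S x → S y → R′ (φ x) (φ y) ≡ R x y) →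
    (∀ {X} Y → (∀ {x} → S x → φ x ≢ X) → R′ X Y ≡ 0) →
    (∀ X {Y} → (∀ {x} → S x → φ x ≢ Y) → R′ X Y ≡ 0) →
    CB.Design R′ (map (Product.map (map φ) (map φ)) ps)
  Design-map φ S inj image? {R} {ps} D S∈ {R′} R′≡R missˡ missʳ = record
    { length5 = Allₚ.map⁺ (All.map (λ {p} e → trans (length-map φ (proj₁ p)) e) (CA.length5 D))
    ; count = λ X Y → trans (∑-map _ ps) (total X Y)
    ; simple = AllPairsₚ.map⁺ (simple′ ps S∈ (CA.simple D))
    ; partners = subst₂ _↭_ (commute proj₂ (λ _ → refl)) (commute proj₁ (λ _ → refl)) (↭ₚ.map⁺ (map φ) (CA.partners D))
    ; trades = Allₚ.map⁺ (All.map (Trade-map φ) (CA.trades D)) }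
    where
    φ² = Product.map (map φ) (map φ)
    commute : (π : ∀ {C : Set} → List C × List C → List C) → (∀ p → map φ (π p) ≡ π (φ² p)) →
      map (map φ) (map π ps) ≡ map π (map φ² ps)
    commute π e = trans (sym (map-∘ ps)) (trans (map-cong e ps) (map-∘ ps))
    simple′ : ∀ ps → (∀ {p x} → p ∈ ps → x ∈ proj₁ p → S x) → AllPairs (Few on proj₁) ps →
      AllPairs (λ p q → Few (map φ (proj₁ p)) (map φ (proj₁ q))) ps
    simple′ [] S∈ [] = []
    simple′ (p ∷ ps) S∈ (f ∷ fs) =
      All.tabulate (λ q∈ → Few-map inj (S∈ (here refl)) (S∈ (there q∈)) (All.lookup f q∈))
      ∷ simple′ ps (S∈ ∘ there) fs
    hit : ∀ {X Y} p → CB.hits (pairs (proj₁ (φ² p))) X Y ≡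
      ∑ (pairs (proj₁ p)) (λ q → 𝟙 ((φ (proj₁ q) ≟ᴮ X) ×-dec (φ (proj₂ q) ≟ᴮ Y)))
    hit p = trans (cong (λ qs → CB.hits qs _ _) (pairs-map φ (proj₁ p))) (∑-map _ (pairs (proj₁ p)))
    total : ∀ X Y → ∑ ps (λ p → CB.hits (pairs (proj₁ (φ² p))) X Y) ≡ R′ X Y
    total X Y with image? X | image? Y
    ... | inj₂ ∉X | _ = trans (∑-zero {is = ps} (λ {p} p∈ → trans (hit p) (∑-zero {is = pairs (proj₁ p)} (λ { {a , c} q →
            𝟙-no (φ a ≟ᴮ X ×-dec φ c ≟ᴮ Y) (∉X (S∈ p∈ (proj₁ (∈-pairs⁻ q))) ∘ proj₁) }))))
          (sym (missˡ Y ∉X))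
    ... | _ | inj₂ ∉Y = trans (∑-zero {is = ps} (λ {p} p∈ → trans (hit p) (∑-zero {is = pairs (proj₁ p)} (λ { {a , c} q →
            𝟙-no (φ a ≟ᴮ X ×-dec φ c ≟ᴮ Y) (∉Y (S∈ p∈ (proj₂ (∈-pairs⁻ q))) ∘ proj₂) }))))
          (sym (missʳ X ∉Y))
    ... | inj₁ (x , Sx , refl) | inj₁ (y , Sy , refl) =
      trans (∑-cong {is = ps} (λ {p} p∈ → trans (hit p) (∑-cong {is = pairs (proj₁ p)} (λ { {a , c} q →
        𝟙-cong (φ a ≟ᴮ φ x ×-dec φ c ≟ᴮ φ y) (a ≟ᴬ x ×-dec c ≟ᴬ y)
          (Product.map (inj (S∈ p∈ (proj₁ (∈-pairs⁻ q))) Sx) (inj (S∈ p∈ (proj₂ (∈-pairs⁻ q))) Sy))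
          (Product.map (cong φ) (cong φ)) }))))
      (trans (CA.count D x y) (sym (R′≡R Sx Sy)))

-- Defining sets

anyFin⁻ : ∀ n (p : Fin n → Bool) → T (anyFin n p) → ∃ λ i → T (p i)
anyFin⁻ (suc n) p t with p Fin.zero in eq
... | true = Fin.zero , subst T (sym eq) tt
... | false = Product.map Fin.suc id (anyFin⁻ n (p ∘ Fin.suc) t)

anyFin⁺ : ∀ n (p : Fin n → Bool) i → T (p i) → T (anyFin n p)
anyFin⁺ (suc n) p Fin.zero t with true ← p Fin.zero = tt
anyFin⁺ (suc n) p (Fin.suc i) t with p Fin.zero
... | true = tt
... | false = anyFin⁺ n (p ∘ Fin.suc) i t

lookup∈ : ∀ {n} (b : Vec A n) i → lookup b i ∈ toList b
lookup∈ (a ∷ b) Fin.zero = here refl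
lookup∈ (a ∷ b) (Fin.suc i) = there (lookup∈ b i)

∈lookup : ∀ {n} (b : Vec A n) {x} → x ∈ toList b → ∃ λ i → lookup b i ≡ x
∈lookup (a ∷ b) (here refl) = Fin.zero , refl
∈lookup (a ∷ b) (there x∈) = Product.map Fin.suc id (∈lookup b x∈)

lookup-pairs : ∀ {n} (b : Vec A n) i j → toℕ i < toℕ j → (lookup b i , lookup b j) ∈ pairs (toList b)
lookup-pairs (a ∷ b) Fin.zero (Fin.suc j) _ = ∈-++⁺ˡ (∈-map⁺ _ (lookup∈ b j))
lookup-pairs (a ∷ b) (Fin.suc i) (Fin.suc j) (s≤s lt) = ∈-++⁺ʳ (map (a ,_) (toList b)) (lookup-pairs b i j lt)

pairs-lookup : ∀ {n} (b : Vec A n) {x y} → (x , y) ∈ pairs (toList b) →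
  ∃₂ λ i j → toℕ i < toℕ j × lookup b i ≡ x × lookup b j ≡ y
pairs-lookup (a ∷ b) p with ∈-++⁻ (map (a ,_) (toList b)) p
... | inj₂ q with i , j , lt , e , f ← pairs-lookup b q = Fin.suc i , Fin.suc j , s≤s lt , e , f
... | inj₁ q with ∈-map⁻ (a ,_) q
... | y , y∈ , refl with j , e ← ∈lookup b y∈ = Fin.zero , Fin.suc j , s≤s z≤n , refl , e

lookup-injective : ∀ {n} (b : Vec A n) → AllPairs _≢_ (toList b) → ∀ {i j} → lookup b i ≡ lookup b j → i ≡ j
lookup-injective (a ∷ b) (a∉ ∷ u) {Fin.zero} {Fin.zero} e = refl
lookup-injective (a ∷ b) (a∉ ∷ u) {Fin.zero} {Fin.suc j} e = contradiction e (All.lookup a∉ (lookup∈ b j))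
lookup-injective (a ∷ b) (a∉ ∷ u) {Fin.suc i} {Fin.zero} e = contradiction (sym e) (All.lookup a∉ (lookup∈ b i))
lookup-injective (a ∷ b) (a∉ ∷ u) {Fin.suc i} {Fin.suc j} e = cong Fin.suc (lookup-injective b u e)

-- A repeated entry x would create the pair `(x , x)`, which has degree 0 in the designs considered.
unique⁺ : {b : List A} → (∀ x → (x , x) ∉ pairs b) → AllPairs _≢_ b
unique⁺ {b = []} _ = []
unique⁺ {b = a ∷ b} ∉ =
  All.tabulate (λ { y∈ refl → ∉ a (∈-++⁺ˡ (∈-map⁺ _ y∈)) }) ∷ unique⁺ (λ x → ∉ x ∘ ∈-++⁺ʳ (map (a ,_) b))

-- The order of two points in a block without repetitions is determined. This tells a block apart
-- both from its trade partner and from its own swapped version.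
unique-antisym : {b : List A} → AllPairs _≢_ b → ∀ {x y} → (x , y) ∈ pairs b → (y , x) ∉ pairs b
unique-antisym {b = a ∷ b} (a∉ ∷ u) p q with ∈-++⁻ (map (a ,_) b) p | ∈-++⁻ (map (a ,_) b) q
... | inj₂ p′ | inj₂ q′ = unique-antisym u p′ q′
... | inj₁ p′ | inj₂ q′ with _ , _ , refl ← ∈-map⁻ _ p′ = All.lookup a∉ (proj₂ (∈-pairs⁻ q′)) refl
... | inj₂ p′ | inj₁ q′ with _ , _ , refl ← ∈-map⁻ _ q′ = All.lookup a∉ (proj₂ (∈-pairs⁻ p′)) refl
... | inj₁ p′ | inj₁ q′ with _ , y∈ , refl ← ∈-map⁻ _ p′ with _ , x∈ , refl ← ∈-map⁻ _ q′ = All.lookup a∉ x∈ refl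

pairs-unique : {b : List A} → AllPairs _≢_ b → AllPairs _≢_ (pairs b)
pairs-unique [] = []
pairs-unique {b = a ∷ b} (a∉ ∷ u) = AllPairsₚ.++⁺
  (AllPairsₚ.map⁺ (AllPairs.map (λ ne e → ne (cong proj₂ e)) u)) (pairs-unique u)
  (All.tabulate λ p → All.tabulate λ q → λ { refl → apart p q })
  where
  apart : ∀ {p} → p ∈ map (a ,_) b → p ∉ pairs b
  apart p q with _ , _ , refl ← ∈-map⁻ _ p = All.lookup a∉ (proj₁ (∈-pairs⁻ q)) refl

∑-↭ : {xs ys : List A} (f : A → ℕ) → xs ↭ ys → ∑ xs f ≡ ∑ ys f
∑-↭ f p = sum-↭ (↭ₚ.map⁺ f p)

∑-length : (xs : List A) → ∑ xs (λ _ → 1) ≡ length xs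
∑-length [] = refl
∑-length (x ∷ xs) = cong suc (∑-length xs)

swapped : ∀ {x y : A} {b} → Adj x y b → List A
swapped {x = x} {y} (here {as}) = y ∷ x ∷ as
swapped (there {a} p) = a ∷ swapped p

length-swapped : ∀ {x y : A} {b} (p : Adj x y b) → length (swapped p) ≡ length b
length-swapped here = refl
length-swapped (there p) = cong suc (length-swapped p)

swapped-↭ : ∀ {x y : A} {b} (p : Adj x y b) → swapped p ↭ b
swapped-↭ here = _↭_.swap _ _ ↭-refl
swapped-↭ (there p) = prep _ (swapped-↭ p)

swapped-unique : ∀ {x y : A} {b} (p : Adj x y b) → AllPairs _≢_ b → AllPairs _≢_ (swapped p)
swapped-unique p = ↭ₛₚ.Unique-resp-↭ (setoid _) (↭⇒↭ₛ (↭-sym (swapped-↭ p)))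

Adj-pairs : ∀ {x y : A} {b} → Adj x y b → (x , y) ∈ pairs b
Adj-pairs here = here refl
Adj-pairs {b = a ∷ b} (there p) = ∈-++⁺ʳ (map (a ,_) b) (Adj-pairs p)

swapped-pairs : ∀ {x y : A} {b} (p : Adj x y b) → (y , x) ∈ pairs (swapped p)
swapped-pairs here = here refl
swapped-pairs (there {a} p) = ∈-++⁺ʳ (map (a ,_) (swapped p)) (swapped-pairs p)

-- Exchanging adjacent entries reverses their own order and that of no other two entries. The lost
-- and the gained pair are added on opposite sides to avoid subtraction.
∑-swapped : ∀ {x y : A} {b} (p : Adj x y b) (f : A × A → ℕ) →
  ∑ (pairs (swapped p)) f + f (x , y) ≡ ∑ (pairs b) f + f (y , x)
∑-swapped {x = x} {y} (here {as}) f = begin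
  f (y , x) + ∑ (map (y ,_) as ++ map (x ,_) as ++ pairs as) f + f (x , y)
    ≡⟨ cong (λ s → f (y , x) + s + f (x , y)) (trans (split y x) (trans (x∙yz≈y∙xz (∑ (map (y ,_) as) f) (∑ (map (x ,_) as) f) (∑ (pairs as) f)) (sym (split x y)))) ⟩
  f (y , x) + s + f (x , y) ≡⟨ ℕ.+-comm (f (y , x) + s) _ ⟩
  f (x , y) + (f (y , x) + s) ≡⟨ cong (f (x , y) +_) (ℕ.+-comm (f (y , x)) s) ⟩
  f (x , y) + (s + f (y , x)) ≡⟨ ℕ.+-assoc (f (x , y)) s _ ⟨
  f (x , y) + s + f (y , x) ∎
  where
  open ≡-Reasoning
  s = ∑ (map (x ,_) as ++ map (y ,_) as ++ pairs as) f
  split : ∀ u v → ∑ (map (u ,_) as ++ map (v ,_) as ++ pairs as) f ≡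
    ∑ (map (u ,_) as) f + (∑ (map (v ,_) as) f + ∑ (pairs as) f)
  split u v = trans (∑-++ (map (u ,_) as) _) (cong (∑ (map (u ,_) as) f +_) (∑-++ (map (v ,_) as) _))
∑-swapped {x = x} {y} (there {a} {as} p) f = begin
  ∑ (map (a ,_) (swapped p) ++ pairs (swapped p)) f + f (x , y)
    ≡⟨ cong (_+ f (x , y)) (∑-++ (map (a ,_) (swapped p)) _) ⟩
  ∑ (map (a ,_) (swapped p)) f + ∑ (pairs (swapped p)) f + f (x , y)
    ≡⟨ ℕ.+-assoc (∑ (map (a ,_) (swapped p)) f) _ _ ⟩
  ∑ (map (a ,_) (swapped p)) f + (∑ (pairs (swapped p)) f + f (x , y))
    ≡⟨ cong₂ _+_ (∑-↭ f (↭ₚ.map⁺ (a ,_) (swapped-↭ p))) (∑-swapped p f) ⟩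
  ∑ (map (a ,_) as) f + (∑ (pairs as) f + f (y , x))
    ≡⟨ ℕ.+-assoc (∑ (map (a ,_) as) f) _ _ ⟨
  ∑ (map (a ,_) as) f + ∑ (pairs as) f + f (y , x)
    ≡⟨ cong (_+ f (y , x)) (∑-++ (map (a ,_) as) _) ⟨
  ∑ (map (a ,_) as ++ pairs as) f + f (y , x) ∎
  where open ≡-Reasoning

module _ {A : Set} (_≟_ : DecidableEquality A) where
  open Count _≟_

  -- Distinct entries make the list of pairs free of repetitions, so here the count agrees with the
  -- Boolean test of the definition.
  unique-hits : {b : List A} → AllPairs _≢_ b → ∀ {x y} → (x , y) ∈ pairs b → hits (pairs b) x y ≡ 1
  unique-hits {b} u {x} {y} p = trans
    (∑-unique (λ q → 𝟙 ((proj₁ q ≟ x) ×-dec (proj₂ q ≟ y))) (pairs-unique u) p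
      (λ { {a , c} _ ne → 𝟙-no (a ≟ x ×-dec c ≟ y) (λ { (refl , refl) → ne refl }) }))
    (𝟙-yes (x ≟ x ×-dec y ≟ y) (refl , refl))

sumFin-zero : ∀ n (p : Fin n → Bool) → (∀ i → ¬ T (p i)) → sumFin n (bool→ℕ ∘ p) ≡ 0
sumFin-zero zero p _ = refl
sumFin-zero (suc n) p none with p Fin.zero in eq
... | true = contradiction (subst T (sym eq) tt) (none Fin.zero)
... | false = sumFin-zero n (p ∘ Fin.suc) (none ∘ Fin.suc)

sumFin-one : ∀ n (p : Fin n → Bool) → (∀ i j → T (p i) → T (p j) → i ≡ j) → sumFin n (bool→ℕ ∘ p) ≤ 1
sumFin-one zero p _ = z≤n
sumFin-one (suc n) p one with p Fin.zero in eq
... | true = s≤s (ℕ.≤-reflexive (sumFin-zero n (p ∘ Fin.suc)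
        (λ i pi → Finₚ.0≢1+n (one Fin.zero (Fin.suc i) (subst T (sym eq) tt) pi))))
... | false = sumFin-one n (p ∘ Fin.suc) (λ i j pi pj → Finₚ.suc-injective (one _ _ pi pj))

sumFin-two : ∀ n (p : Fin n → Bool) →
  (∀ i j k → T (p i) → T (p j) → T (p k) → i ≡ j ⊎ i ≡ k ⊎ j ≡ k) → sumFin n (bool→ℕ ∘ p) ≤ 2
sumFin-two zero p _ = z≤n
sumFin-two (suc n) p two with p Fin.zero in eq
... | true = s≤s (sumFin-one n (p ∘ Fin.suc) one)
  where
  one : ∀ i j → T (p (Fin.suc i)) → T (p (Fin.suc j)) → i ≡ j
  one i j pi pj with two Fin.zero (Fin.suc i) (Fin.suc j) (subst T (sym eq) tt) pi pj
  ... | inj₂ (inj₂ e) = Finₚ.suc-injective e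
... | false = sumFin-two n (p ∘ Fin.suc) two′
  where
  two′ : ∀ i j k → T (p (Fin.suc i)) → T (p (Fin.suc j)) → T (p (Fin.suc k)) → i ≡ j ⊎ i ≡ k ⊎ j ≡ k
  two′ i j k pi pj pk with two _ _ _ pi pj pk
  ... | inj₁ e = inj₁ (Finₚ.suc-injective e)
  ... | inj₂ (inj₁ e) = inj₂ (inj₁ (Finₚ.suc-injective e))
  ... | inj₂ (inj₂ e) = inj₂ (inj₂ (Finₚ.suc-injective e))

lookup-AllPairs : ∀ {R : A → A → Set} {xs} → AllPairs R xs → (∀ {x y} → R x y → R y x) →
  ∀ i j → i ≢ j → R (lookupL xs i) (lookupL xs j)
lookup-AllPairs (r ∷ rs) s Fin.zero Fin.zero ne = contradiction refl ne
lookup-AllPairs (r ∷ rs) s Fin.zero (Fin.suc j) ne = All.lookup r (∈-lookup j)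
lookup-AllPairs (r ∷ rs) s (Fin.suc i) Fin.zero ne = s (All.lookup r (∈-lookup i))
lookup-AllPairs (r ∷ rs) s (Fin.suc i) (Fin.suc j) ne = lookup-AllPairs rs s i j (ne ∘ cong Fin.suc)

Few-sym : {b c : List A} → Few b c → Few c b
Few-sym few x y z x∈c x∈b y∈c y∈b z∈c z∈b = few x y z x∈b x∈c y∈b y∈c z∈b z∈c

-- The first three entries of `b` are already three distinct common points.
Few-refl⁻ : ∀ {b c : List A} → AllPairs _≢_ b → length b ≡ 5 → (∀ {x} → x ∈ b → x ∈ c) → ¬ Few b c
Few-refl⁻ {b = _ ∷ _ ∷ _ ∷ _ ∷ _ ∷ []} ((xy ∷ xz ∷ _) ∷ (yz ∷ _) ∷ _) refl ⊆ few
  with few _ _ _ (here refl) (⊆ (here refl)) (there (here refl)) (⊆ (there (here refl)))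
           (there (there (here refl))) (⊆ (there (there (here refl))))
... | inj₁ e = xy e
... | inj₂ (inj₁ e) = xz e
... | inj₂ (inj₂ e) = yz e

-- Designs on Fin v

module _ {v : ℕ} where
  open Count (Fin._≟_ {v})

  private
    _≟ᵇ_ : DecidableEquality (Block v)
    _≟ᵇ_ = Vecₚ.≡-dec Fin._≟_
    open DecMembership _≟ᵇ_ using (_∈?_)

    hitsᵇ : Fin v → Fin v → Block v → ℕ
    hitsᵇ x y b = hits (pairs (toList b)) x y

  private
    cell : Block v → Fin v → Fin v → Fin 5 → Fin 5 → Bool
    cell b x y i j = (toℕ i <ᵇ toℕ j) ∧ (⌊ lookup b i Fin.≟ x ⌋ ∧ ⌊ lookup b j Fin.≟ y ⌋)

  containsPair⁻ : ∀ (b : Block v) x y → T (containsPairᵇ b x y) → (x , y) ∈ pairs (toList b)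
  containsPair⁻ b x y t
    with i , ti ← anyFin⁻ 5 (λ i → anyFin 5 (cell b x y i)) t
    with j , tj ← anyFin⁻ 5 (cell b x y i) ti
    with lt , tj′ ← Equivalence.to (T-∧ {toℕ i <ᵇ toℕ j}) tj
    with ex , ey ← Equivalence.to (T-∧ {⌊ lookup b i Fin.≟ x ⌋}) tj′
    = subst₂ (λ x y → (x , y) ∈ pairs (toList b)) (toWitness {a? = lookup b i Fin.≟ x} ex)
        (toWitness {a? = lookup b j Fin.≟ y} ey) (lookup-pairs b i j (ℕ.<ᵇ⇒< (toℕ i) (toℕ j) lt))

  containsPair⁺ : ∀ (b : Block v) x y → (x , y) ∈ pairs (toList b) → T (containsPairᵇ b x y)
  containsPair⁺ b x y p with i , j , lt , ex , ey ← pairs-lookup b p =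
    anyFin⁺ 5 (λ i → anyFin 5 (cell b x y i)) i (anyFin⁺ 5 (cell b x y i) j
      (Equivalence.from (T-∧ {toℕ i <ᵇ toℕ j}) (ℕ.<⇒<ᵇ lt ,
        Equivalence.from (T-∧ {⌊ lookup b i Fin.≟ x ⌋}) (fromWitness ex , fromWitness ey))))

  containsPair-hits : ∀ (b : Block v) → AllPairs _≢_ (toList b) → ∀ x y →
    bool→ℕ (containsPairᵇ b x y) ≡ hitsᵇ x y b
  containsPair-hits b u x y with containsPairᵇ b x y in eq
  ... | true = sym (unique-hits Fin._≟_ u (containsPair⁻ b x y (subst T (sym eq) tt)))
  ... | false = sym (hits-∉ (λ p → subst T eq (containsPair⁺ b x y p)))

  pairCount-hits : ∀ B → All (AllPairs _≢_ ∘ toList) B → ∀ x y → pairCount B x y ≡ ∑ B (hitsᵇ x y)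
  pairCount-hits [] [] x y = refl
  pairCount-hits (b ∷ B) (u ∷ us) x y = cong₂ _+_ (containsPair-hits b u x y) (pairCount-hits B us x y)

  mem⁻ : ∀ (b : Block v) x → T (memᵇ x b) → x ∈ toList b
  mem⁻ b x t with i , ti ← anyFin⁻ 5 _ t = subst (_∈ toList b) (toWitness {a? = lookup b i Fin.≟ x} ti) (lookup∈ b i)

  intersection≤2 : ∀ (b c : Block v) → Few (toList b) (toList c) → intersectionSize b c ≤ 2
  intersection≤2 b c few = sumFin-two v _ λ x y z tx ty tz →
    few x y z (mem⁻ b x (l x tx)) (mem⁻ c x (r x tx)) (mem⁻ b y (l y ty)) (mem⁻ c y (r y ty))
        (mem⁻ b z (l z tz)) (mem⁻ c z (r z tz))
    where
    l : ∀ x → T (memᵇ x b ∧ memᵇ x c) → T (memᵇ x b)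
    l x = proj₁ ∘ Equivalence.to (T-∧ {memᵇ x b})
    r : ∀ x → T (memᵇ x b ∧ memᵇ x c) → T (memᵇ x c)
    r x = proj₂ ∘ Equivalence.to (T-∧ {memᵇ x b})

  -- Lists of another length are sent to a constant block to make this total, hence the argument of
  -- type `Fin v`. On lists of length five it is inverse to `toList`.
  vec5 : Fin v → List (Fin v) → Block v
  vec5 _ (a ∷ b ∷ c ∷ d ∷ e ∷ []) = a ∷ b ∷ c ∷ d ∷ e ∷ []
  vec5 z _ = Vec.replicate 5 z

  toList-vec5 : ∀ z l → length l ≡ 5 → toList (vec5 z l) ≡ l
  toList-vec5 z (a ∷ b ∷ c ∷ d ∷ e ∷ []) refl = refl

  length-toList : ∀ (b : Block v) → length (toList b) ≡ 5
  length-toList (a ∷ b ∷ c ∷ d ∷ e ∷ []) = refl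

  point : Block v → Fin v
  point b = lookup b Fin.zero

  module _ (qs : List (Block v × Block v))
    (unique : All (AllPairs _≢_ ∘ toList) (map proj₁ qs))
    (total : ∀ x y → x ≢ y → ∑ (map proj₁ qs) (hitsᵇ x y) ≡ 2)
    (few : AllPairs (Few on toList) (map proj₁ qs))
    (partner : map proj₂ qs ↭ map proj₁ qs)
    (trade : All (λ q → Trade (toList (proj₁ q)) (toList (proj₂ q))) qs) where

    private
      B : List (Block v)
      B = map proj₁ qs

    isDD : IsDD v B
    isDD = (λ i → lookup-injective _ (All.lookup unique (∈-lookup i)))
         , (λ x y ne → trans (pairCount-hits B unique x y) (total x y ne))

    superSimple : SuperSimple B
    superSimple i j ne = intersection≤2 (lookupL B i) (lookupL B j)
      (lookup-AllPairs few Few-sym i j ne)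

    -- Two blocks on the same five points meet in more than two points, so super-simplicity makes
    -- them the same block.
    same-points : ∀ {b c} → b ∈ B → c ∈ B → toList b ↭ toList c → b ≡ c
    same-points {b} {c} b∈ c∈ p with AllPairs-∈ few b∈ c∈
    ... | inj₁ e = e
    ... | inj₂ (inj₁ f) = contradiction f
            (Few-refl⁻ (All.lookup unique b∈) (length-toList b) (↭ₚ.∈-resp-↭ p))
    ... | inj₂ (inj₂ f) = contradiction f
            (Few-refl⁻ (All.lookup unique c∈) (length-toList c) (↭ₚ.∈-resp-↭ (↭-sym p)))

    B-unique : AllPairs _≢_ B
    B-unique = go unique few
      where
      go : ∀ {B} → All (AllPairs _≢_ ∘ toList) B → AllPairs (Few on toList) B → AllPairs _≢_ B
      go [] [] = []
      go {b ∷ B} (u ∷ us) (f ∷ fs) =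
        All.map (λ { {c} g refl → Few-refl⁻ u (length-toList c) id g }) f ∷ go us fs

    module _ {S R : List (Block v)} (S++R↭B : (S ++ R) ↭ B)
      (defining : (B′ : List (Block v)) → IsDD v B′ → S ⊆ₘ B′ → B′ ↭ B) where

      ∈R⇒∈B : ∀ {b} → b ∈ R → b ∈ B
      ∈R⇒∈B b∈ = ↭ₚ.∈-resp-↭ S++R↭B (∈-++⁺ʳ S b∈)

      -- If both blocks of a trade were outside S, the traded design would be another completion.
      trade-hits : ∀ {b c} → (b , c) ∈ qs → b ∈ R → c ∉ R
      trade-hits {b} {c} q∈ b∈ c∈ with x , y , p , q ← All.lookup trade q∈ = b≢b′ b≡b′
        where
        b-unique = All.lookup unique (∈R⇒∈B b∈)
        c-unique = All.lookup unique (∈R⇒∈B c∈)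
        b≢c : b ≢ c
        b≢c refl = unique-antisym b-unique (Adj-pairs p) (Adj-pairs q)
        b′ = vec5 (point b) (swapped p)
        c′ = vec5 (point c) (swapped q)
        b′-list : toList b′ ≡ swapped p
        b′-list = toList-vec5 _ _ (trans (length-swapped p) (length-toList b))
        c′-list : toList c′ ≡ swapped q
        c′-list = toList-vec5 _ _ (trans (length-swapped q) (length-toList c))
        b′-unique : AllPairs _≢_ (toList b′)
        b′-unique = subst (AllPairs _≢_) (sym b′-list) (swapped-unique p b-unique)
        c′-unique : AllPairs _≢_ (toList c′)
        c′-unique = subst (AllPairs _≢_) (sym c′-list) (swapped-unique q c-unique)
        rest : ∃ λ R′ → R ↭ (b ∷ c ∷ R′)
        rest with ∈-∃++ b∈
        ... | R₁ , R₂ , refl with ↭ₚ.∈-resp-↭ (↭ₚ.shift b R₁ R₂) c∈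
        ... | here e = contradiction (sym e) b≢c
        ... | there c∈′ with ∈-∃++ c∈′
        ... | R₃ , R₄ , e = R₃ ++ R₄ , ↭-trans (↭ₚ.shift b R₁ R₂) (prep b (subst (_↭ (c ∷ R₃ ++ R₄)) (sym e) (↭ₚ.shift c R₃ R₄)))
        R′ = proj₁ rest
        B↭ : B ↭ (S ++ b ∷ c ∷ R′)
        B↭ = ↭-trans (↭-sym S++R↭B) (↭ₚ.++⁺ˡ S (proj₂ rest))
        B′ = S ++ b′ ∷ c′ ∷ R′
        unique-S++ : All (AllPairs _≢_ ∘ toList) (S ++ b ∷ c ∷ R′)
        unique-S++ = ↭ₚ.All-resp-↭ B↭ unique
        B′-unique : All (AllPairs _≢_ ∘ toList) B′
        B′-unique with _ ∷ _ ∷ uR′ ← Allₚ.++⁻ʳ S unique-S++ = Allₚ.++⁺ (Allₚ.++⁻ˡ S unique-S++) (b′-unique ∷ c′-unique ∷ uR′)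
        -- In `b` the pair `(x , y)` turns into `(y , x)`, in `c` the other way round. Adding the
        -- counts of both pairs to each side lets the two instances of `∑-swapped` be combined and
        -- the surplus cancelled.
        hits-b′c′ : ∀ u w → hitsᵇ u w b′ + hitsᵇ u w c′ ≡ hitsᵇ u w b + hitsᵇ u w c
        hits-b′c′ u w = subst₂ (λ l m → hits (pairs l) u w + hits (pairs m) u w ≡ hitsᵇ u w b + hitsᵇ u w c)
          (sym b′-list) (sym c′-list) (ℕ.+-cancelʳ-≡ (f (x , y) + f (y , x)) _ _ (begin
          P + Q + (f (x , y) + f (y , x)) ≡⟨ +-interchange P Q (f (x , y)) (f (y , x)) ⟩
          (P + f (x , y)) + (Q + f (y , x)) ≡⟨ cong₂ _+_ (∑-swapped p f) (∑-swapped q f) ⟩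
          (hitsᵇ u w b + f (y , x)) + (hitsᵇ u w c + f (x , y)) ≡⟨ +-interchange (hitsᵇ u w b) _ _ _ ⟩
          hitsᵇ u w b + hitsᵇ u w c + (f (y , x) + f (x , y)) ≡⟨ cong (hitsᵇ u w b + hitsᵇ u w c +_) (ℕ.+-comm (f (y , x)) _) ⟩
          hitsᵇ u w b + hitsᵇ u w c + (f (x , y) + f (y , x)) ∎))
          where
          open ≡-Reasoning
          f : Fin v × Fin v → ℕ
          f r = 𝟙 ((proj₁ r Fin.≟ u) ×-dec (proj₂ r Fin.≟ w))
          P = hits (pairs (swapped p)) u w
          Q = hits (pairs (swapped q)) u w
        B′-total : ∀ u w → ∑ B′ (hitsᵇ u w) ≡ ∑ B (hitsᵇ u w)
        B′-total u w = trans (∑-++ S _) (trans (cong (∑ S (hitsᵇ u w) +_)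
          (trans (sym (ℕ.+-assoc (hitsᵇ u w b′) _ _)) (trans (cong (_+ ∑ R′ (hitsᵇ u w)) (hits-b′c′ u w)) (ℕ.+-assoc (hitsᵇ u w b) _ _))))
          (trans (sym (∑-++ S _)) (∑-↭ (hitsᵇ u w) (↭-sym B↭))))
        B′-isDD : IsDD v B′
        B′-isDD = (λ i → lookup-injective _ (All.lookup B′-unique (∈-lookup i)))
          , (λ u w ne → trans (pairCount-hits B′ B′-unique u w) (trans (B′-total u w) (total u w ne)))
        -- Since `S` is defining, `B′` is a rearrangement of `B`. Then `b′`, which has the points of
        -- `b`, must be `b` itself, although it contains x and y in the opposite order.
        b′∈B : b′ ∈ B
        b′∈B = ↭ₚ.∈-resp-↭ (defining B′ B′-isDD (_ , ↭-refl)) (∈-++⁺ʳ S (here refl))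
        b≡b′ : b ≡ b′
        b≡b′ = same-points (∈R⇒∈B b∈) b′∈B (subst (toList b ↭_) (sym b′-list) (↭-sym (swapped-↭ p)))
        b≢b′ : b ≢ b′
        b≢b′ e = unique-antisym b-unique (Adj-pairs p)
          (subst (λ l → (y , x) ∈ pairs l) (trans (sym b′-list) (cong toList (sym e))) (swapped-pairs p))

      -- The partner of a block of `R` lies in `S`. In terms of indicators, `χR` of a block is at
      -- most `χS` of its partner; summing over `qs` compares the two sizes, because the partners
      -- are again all of `B`.
      complement≤ : length R ≤ length S
      complement≤ = begin
        length R                    ≡⟨ ∑-length R ⟨
        ∑ R (λ _ → 1)               ≡⟨ ∑-cong (λ {b} b∈ → sym (𝟙-yes (b ∈? R) b∈)) ⟩
        ∑ R χR                      ≤⟨ ℕ.m≤n+m _ _ ⟩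
        ∑ S χR + ∑ R χR             ≡⟨ ∑-++ S R ⟨
        ∑ (S ++ R) χR               ≡⟨ ∑-↭ χR S++R↭B ⟩
        ∑ B χR                      ≡⟨ ∑-map proj₁ qs ⟩
        ∑ qs (χR ∘ proj₁)           ≤⟨ ∑-mono {is = qs} pairwise ⟩
        ∑ qs (χS ∘ proj₂)           ≡⟨ ∑-map proj₂ qs ⟨
        ∑ (map proj₂ qs) χS         ≡⟨ ∑-↭ χS (↭-trans partner (↭-sym S++R↭B)) ⟩
        ∑ (S ++ R) χS               ≡⟨ ∑-++ S R ⟩
        ∑ S χS + ∑ R χS             ≡⟨ cong₂ _+_ (∑-cong {is = S} (λ {b} b∈ → 𝟙-yes (b ∈? S) b∈))
                                         (∑-zero {is = R} (λ {b} b∈ → 𝟙-no (b ∈? S) (disjoint b∈))) ⟩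
        ∑ S (λ _ → 1) + 0           ≡⟨ ℕ.+-identityʳ _ ⟩
        ∑ S (λ _ → 1)               ≡⟨ ∑-length S ⟩
        length S                    ∎
        where
        open ℕ.≤-Reasoning
        χR χS : Block v → ℕ
        χR b = 𝟙 (b ∈? R)
        χS b = 𝟙 (b ∈? S)
        SR-unique : AllPairs _≢_ (S ++ R)
        SR-unique = ↭ₛₚ.Unique-resp-↭ (setoid (Block v)) (↭⇒↭ₛ (↭-sym S++R↭B)) B-unique
        disjoint : ∀ {b} → b ∈ R → b ∉ S
        disjoint b∈R b∈S = go S SR-unique b∈S
          where
          go : ∀ S → AllPairs _≢_ (S ++ R) → _ ∉ S
          go (s ∷ S) (s∉ ∷ u) (here refl) = All.lookup s∉ (∈-++⁺ʳ S b∈R) refl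
          go (s ∷ S) (s∉ ∷ u) (there b∈) = go S u b∈
        pairwise : ∀ {q} → q ∈ qs → χR (proj₁ q) ≤ χS (proj₂ q)
        pairwise {b , c} q∈ with b ∈? R
        ... | no _ = z≤n
        ... | yes b∈ with ∈-++⁻ S (↭ₚ.∈-resp-↭ (↭-trans partner (↭-sym S++R↭B)) (∈-map⁺ proj₂ q∈))
        ... | inj₁ c∈S = ℕ.≤-reflexive (sym (𝟙-yes (c ∈? S) c∈S))
        ... | inj₂ c∈R = contradiction c∈R (trade-hits q∈ b∈)

    atLeastHalf : SmallestDefiningRatioAtLeastHalf v B
    atLeastHalf S ((R , p) , defining) = begin
      length B              ≡⟨ ↭ₚ.↭-length p ⟨
      length (S ++ R)       ≡⟨ length-++ S ⟩
      length S + length R   ≤⟨ ℕ.+-monoʳ-≤ (length S) (complement≤ p defining) ⟩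
      length S + length S   ≡⟨ cong (length S +_) (ℕ.+-identityʳ _) ⟨
      2 * length S          ∎
      where open ℕ.≤-Reasoning

-- From designs on natural numbers to the statement on `Fin v`

Distinct : ℕ → ℕ → ℕ → Set
Distinct v x y = x < v × y < v × x ≢ y

distinct? : ∀ v x y → Dec (Distinct v x y)
distinct? v x y = (x ℕ.<? v) ×-dec (y ℕ.<? v) ×-dec ¬? (x ℕ.≟ y)

open Count _≟_

DD : ℕ → Set
DD v = ∃ (Design λ x y → 2 * 𝟙 (distinct? v x y))

module _ {w : ℕ} where
  private
    v = suc w
    module F = Count (Fin._≟_ {v})

  -- Reduction modulo `v` is a bijection from the numbers below `v` onto `Fin v`, and a positive
  -- degree forces every point of a block to be below `v`.
  Design-Fin : ∀ {ps} → Design (λ x y → 2 * 𝟙 (distinct? v x y)) ps →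
    F.Design (λ x y → 2 * 𝟙 (¬? (x Fin.≟ y))) (map (Product.map (map (_mod v)) (map (_mod v))) ps)
  Design-Fin {ps} D = Design-map ℕ._≟_ Fin._≟_ (_mod v) (_< v) inj
    (λ X → inj₁ (toℕ X , Finₚ.toℕ<n X , image X)) D below
    (λ {x} {y} x<v y<v → cong (2 *_) (𝟙-cong (¬? ((x mod v) Fin.≟ (y mod v))) (distinct? v x y)
      (λ ne → x<v , y<v , ne ∘ cong (_mod v)) (λ { (_ , _ , ne) → ne ∘ inj x<v y<v })))
    (λ {X} _ ∉ → contradiction (image X) (∉ (Finₚ.toℕ<n X)))
    (λ _ {Y} ∉ → contradiction (image Y) (∉ (Finₚ.toℕ<n Y)))
    where
    toℕ-mod : ∀ {x} → x < v → toℕ (x mod v) ≡ x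
    toℕ-mod {x} x<v = trans (Finₚ.toℕ-fromℕ< (m%n<n x v)) (m<n⇒m%n≡m x<v)
    inj : ∀ {x y} → x < v → y < v → x mod v ≡ y mod v → x ≡ y
    inj x<v y<v e = trans (sym (toℕ-mod x<v)) (trans (cong toℕ e) (toℕ-mod y<v))
    image : ∀ X → toℕ X mod v ≡ X
    image X = Finₚ.toℕ-injective (toℕ-mod (Finₚ.toℕ<n X))
    below : ∀ {p x} → p ∈ ps → x ∈ proj₁ p → x < v
    below {x = x} p∈ x∈ with support D p∈ x∈
    ... | y , inj₁ le = proj₁ (2𝟙-pos (distinct? v x y) le)
    ... | y , inj₂ le = proj₁ (proj₂ (2𝟙-pos (distinct? v y x) le))

DD⇒theorem : ∀ {v} → 1 ≤ v → DD v →
  Σ (List (Block v)) (λ B → IsDD v B × SuperSimple B × SmallestDefiningRatioAtLeastHalf v B)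
DD⇒theorem {suc w} _ (ps , D) = map proj₁ qs , isDD qs uniq total few partner trade
    , superSimple qs uniq total few partner trade , atLeastHalf qs uniq total few partner trade
  where
  v = suc w
  module F = Count (Fin._≟_ {v})
  rs = map (Product.map (map (_mod v)) (map (_mod v))) ps
  E : F.Design (λ x y → 2 * 𝟙 (¬? (x Fin.≟ y))) rs
  E = Design-Fin D
  z : Fin v
  z = Fin.zero
  qs = map (Product.map (vec5 z) (vec5 z)) rs
  len₁ : ∀ {r} → r ∈ rs → toList (vec5 z (proj₁ r)) ≡ proj₁ r
  len₁ r∈ = toList-vec5 z _ (All.lookup (F.length5 E) r∈)
  -- A second component is some other first component, because `partners` is a permutation; that is
  -- where its length comes from.
  len₂ : ∀ {r} → r ∈ rs → toList (vec5 z (proj₂ r)) ≡ proj₂ r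
  len₂ r∈ with _ , r′∈ , e ← ∈-map⁻ proj₁ (↭ₚ.∈-resp-↭ (F.partners E) (∈-map⁺ proj₂ r∈)) =
    toList-vec5 z _ (trans (cong length e) (All.lookup (F.length5 E) r′∈))
  proj₁-qs : map proj₁ qs ≡ map (vec5 z ∘ proj₁) rs
  proj₁-qs = sym (map-∘ rs)
  uniq : All (AllPairs _≢_ ∘ toList) (map proj₁ qs)
  uniq = subst (All _) (sym proj₁-qs) (Allₚ.map⁺ (All.tabulate λ {r} r∈ → subst (AllPairs _≢_) (sym (len₁ r∈))
    (unique⁺ (λ x p → contradiction (subst (1 ≤_) (diagonal x) (F.count-∈ E r∈ p)) λ ()))))
    where
    diagonal : ∀ x → 2 * 𝟙 (¬? (x Fin.≟ x)) ≡ 0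
    diagonal x = cong (2 *_) (𝟙-no (¬? (x Fin.≟ x)) (λ ne → ne refl))
  total : ∀ x y → x ≢ y → ∑ (map proj₁ qs) (λ b → F.hits (pairs (toList b)) x y) ≡ 2
  total x y ne = begin
    ∑ (map proj₁ qs) (λ b → F.hits (pairs (toList b)) x y) ≡⟨ cong (λ B → ∑ B (λ b → F.hits (pairs (toList b)) x y)) proj₁-qs ⟩
    ∑ (map (vec5 z ∘ proj₁) rs) (λ b → F.hits (pairs (toList b)) x y) ≡⟨ ∑-map (vec5 z ∘ proj₁) rs ⟩
    ∑ rs (λ r → F.hits (pairs (toList (vec5 z (proj₁ r)))) x y) ≡⟨ ∑-cong {is = rs} (λ r∈ → cong (λ l → F.hits (pairs l) x y) (len₁ r∈)) ⟩
    ∑ rs (λ r → F.hits (pairs (proj₁ r)) x y) ≡⟨ F.count E x y ⟩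
    2 * 𝟙 (¬? (x Fin.≟ y)) ≡⟨ cong (2 *_) (𝟙-yes (¬? (x Fin.≟ y)) ne) ⟩
    2 ∎
    where open ≡-Reasoning
  few : AllPairs (Few on toList) (map proj₁ qs)
  few = subst (AllPairs _) (sym proj₁-qs) (AllPairsₚ.map⁺ (go rs len₁ (F.simple E)))
    where
    go : ∀ rs → (∀ {r} → r ∈ rs → toList (vec5 z (proj₁ r)) ≡ proj₁ r) → AllPairs (Few on proj₁) rs →
      AllPairs (λ r s → Few (toList (vec5 z (proj₁ r))) (toList (vec5 z (proj₁ s)))) rs
    go [] len [] = []
    go (r ∷ rs) len (f ∷ fs) =
      All.tabulate (λ s∈ → subst₂ Few (sym (len (here refl))) (sym (len (there s∈))) (All.lookup f s∈)) ∷ go rs (len ∘ there) fs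
  partner : map proj₂ qs ↭ map proj₁ qs
  partner = subst₂ _↭_ (trans (sym (map-∘ rs)) (map-∘ rs)) (trans (sym (map-∘ rs)) (map-∘ rs)) (↭ₚ.map⁺ (vec5 z) (F.partners E))
  trade : All (λ q → Trade (toList (proj₁ q)) (toList (proj₂ q))) qs
  trade = Allₚ.map⁺ (All.tabulate λ r∈ → subst₂ Trade (sym (len₁ r∈)) (sym (len₂ r∈)) (All.lookup (F.trades E) r∈))

-- Difference families

0%n≡0 : ∀ n .{{_ : NonZero n}} → 0 % n ≡ 0
0%n≡0 n = m*n%n≡0 0 n

module Mod (N : ℕ) .{{_ : NonZero N}} where

  infix 4 _≈_
  _≈_ : ℕ → ℕ → Set
  a ≈ b = a % N ≡ b % N

  %-≈ : ∀ a → a % N ≈ a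
  %-≈ a = m%n%n≡m%n a N

  ≈-+ : ∀ {a b c d} → a ≈ b → c ≈ d → a + c ≈ b + d
  ≈-+ {a} {b} {c} {d} e f = trans (%-distribˡ-+ a c N) (trans (cong₂ (λ x y → (x + y) % N) e f) (sym (%-distribˡ-+ b d N)))

  ≈-* : ∀ k {a b} → a ≈ b → k * a ≈ k * b
  ≈-* zero e = refl
  ≈-* (suc k) {a} {b} e = ≈-+ {a} {b} e (≈-* k e)

  +N : ∀ a → a + N ≈ a
  +N a = [m+n]%n≡m%n a N

  +kN : ∀ a k → a + k * N ≈ a
  +kN a k = [m+kn]%n≡m%n a k N

  -- Adding `c * (N ∸ 1)` completes `c` to a multiple of `N`, which replaces the additive inverse
  -- missing from ℕ.
  ≈-cancelʳ : ∀ {a b} c → a + c ≈ b + c → a ≈ b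
  ≈-cancelʳ {a} {b} c e = trans (sym (absorb a)) (trans (≈-+ {a + c} {b + c} e refl) (absorb b))
    where
    absorb : ∀ a → a + c + c * (N ∸ 1) ≈ a
    absorb a = trans (cong (_% N) (trans (ℕ.+-assoc a c _) (cong (a +_) (c+c*[N-1]≡c*N N)))) (+kN a c)
      where
      c+c*[N-1]≡c*N : ∀ N .{{_ : NonZero N}} → c + c * (N ∸ 1) ≡ c * N
      c+c*[N-1]≡c*N (suc n) = sym (ℕ.*-suc c n)

  ≈⇒≡ : ∀ {a b} → a < N → b < N → a ≈ b → a ≡ b
  ≈⇒≡ a< b< e = trans (sym (m<n⇒m%n≡m a<)) (trans e (m<n⇒m%n≡m b<))

  -- For `a ≤ N` the truncated difference `N ∸ a` is a genuine representative of -a.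
  neg : ∀ {a} b → a ≤ N → a + (b + (N ∸ a)) ≈ b
  neg {a} b a≤N = trans (cong (_% N) (trans (a+[b+c]≡b+[a+c] a b (N ∸ a)) (cong (b +_) (ℕ.m+[n∸m]≡n a≤N)))) (+N b)
    where
    a+[b+c]≡b+[a+c] : ∀ a b c → a + (b + c) ≡ b + (a + c)
    a+[b+c]≡b+[a+c] = solve-∀

-- Certificates by sorting: distinctness and multiplicities

merge : List ℕ → List ℕ → List ℕ
merge [] ys = ys
merge (x ∷ xs) = go
  where
  go : List ℕ → List ℕ
  go [] = x ∷ xs
  go (y ∷ ys) = if x <ᵇ y then x ∷ merge xs (y ∷ ys) else y ∷ go ys

merge-↭ : ∀ xs ys → merge xs ys ↭ (xs ++ ys)
merge-↭ [] ys = ↭-refl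
merge-↭ (x ∷ xs) = go
  where
  go : ∀ ys → merge (x ∷ xs) ys ↭ (x ∷ xs ++ ys)
  go [] = ↭-reflexive (sym (++-identityʳ (x ∷ xs)))
  go (y ∷ ys) with x <ᵇ y
  ... | true = prep x (merge-↭ xs (y ∷ ys))
  ... | false = ↭-trans (prep y (go ys)) (↭-sym (↭ₚ.shift y (x ∷ xs) ys))

mergePairs : List (List ℕ) → List (List ℕ)
mergePairs (xs ∷ ys ∷ xss) = merge xs ys ∷ mergePairs xss
mergePairs xss = xss

mergePairs-↭ : ∀ xss → concat (mergePairs xss) ↭ concat xss
mergePairs-↭ [] = ↭-refl
mergePairs-↭ (xs ∷ []) = ↭-refl
mergePairs-↭ (xs ∷ ys ∷ xss) = ↭-trans (↭ₚ.++⁺ (merge-↭ xs ys) (mergePairs-↭ xss)) (↭-reflexive (++-assoc xs ys (concat xss)))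

passes : ℕ → List (List ℕ) → List (List ℕ)
passes zero xss = xss
passes (suc k) xss = passes k (mergePairs xss)

passes-↭ : ∀ k xss → concat (passes k xss) ↭ concat xss
passes-↭ zero xss = ↭-refl
passes-↭ (suc k) xss = ↭-trans (passes-↭ k (mergePairs xss)) (mergePairs-↭ xss)

-- Sorts lists of length at most 2¹³.  Only the permutation property is ever
-- used; the outcome is checked to be sorted.
sort : List ℕ → List ℕ
sort xs = concat (passes 13 (map (_∷ []) xs))

sort-↭ : ∀ xs → sort xs ↭ xs
sort-↭ xs = ↭-trans (passes-↭ 13 (map (_∷ []) xs)) (↭-reflexive (concat-map-[_] xs))

increasing : List ℕ → Bool
increasing (x ∷ y ∷ xs) = (x <ᵇ y) ∧ increasing (y ∷ xs)
increasing _ = true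

increasing⇒unique : ∀ xs → T (increasing xs) → AllPairs _≢_ xs
increasing⇒unique xs t = AllPairs.map ℕ.<⇒≢ (go xs t)
  where
  below : ∀ {w} xs → T (increasing (w ∷ xs)) → All (w <_) xs
  below [] _ = []
  below {w} (x ∷ xs) t with w<x , t′ ← Equivalence.to (T-∧ {w <ᵇ x}) t =
    ℕ.<ᵇ⇒< w x w<x ∷ All.map (ℕ.<-trans (ℕ.<ᵇ⇒< w x w<x)) (below xs t′)
  go : ∀ xs → T (increasing xs) → AllPairs _<_ xs
  go [] _ = []
  go (x ∷ []) _ = [] ∷ []
  go (x ∷ y ∷ xs) t = below (y ∷ xs) t ∷ go (y ∷ xs) (proj₂ (Equivalence.to (T-∧ {x <ᵇ y}) t))

unique : List ℕ → Bool
unique xs = increasing (sort xs)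

unique-sound : ∀ {xs} → T (unique xs) → AllPairs _≢_ xs
unique-sound {xs} t = ↭ₛₚ.Unique-resp-↭ (setoid ℕ) (↭⇒↭ₛ (sort-↭ xs)) (increasing⇒unique (sort xs) t)

equal : List ℕ → List ℕ → Bool
equal [] [] = true
equal (x ∷ xs) (y ∷ ys) = (x ≡ᵇ y) ∧ equal xs ys
equal _ _ = false

equal-sound : ∀ xs ys → T (equal xs ys) → xs ≡ ys
equal-sound [] [] _ = refl
equal-sound (x ∷ xs) (y ∷ ys) t with e , t′ ← Equivalence.to (T-∧ {x ≡ᵇ y}) t =
  cong₂ _∷_ (ℕ.≡ᵇ⇒≡ x y e) (equal-sound xs ys t′)

-- Listing every `κ` below `M` as often as `f` prescribes gives the sorted form of the wanted
-- multiset. One comparison fixes all multiplicities at once and excludes entries from `M` on.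
occursBelow : ℕ → (ℕ → ℕ) → List ℕ → Bool
occursBelow M f xs = equal (sort xs) (concatMap (λ κ → replicate (f κ) κ) (upTo M))

occursBelow-sound : ∀ {M f xs} → T (occursBelow M f xs) → ∀ {κ} → κ < M → ∑ xs (λ x → 𝟙 (x ≟ κ)) ≡ f κ
occursBelow-sound {M} {f} {xs} t {κ} κ< = begin
  ∑ xs χ ≡⟨ sum-↭ (↭ₚ.map⁺ χ (sort-↭ xs)) ⟨
  ∑ (sort xs) χ ≡⟨ cong (λ l → ∑ l χ) (equal-sound (sort xs) _ t) ⟩
  ∑ (concatMap (λ κ → replicate (f κ) κ) (upTo M)) χ ≡⟨ ∑-concatMap (λ κ → replicate (f κ) κ) (upTo M) ⟩
  ∑ (upTo M) (λ λ′ → ∑ (replicate (f λ′) λ′) χ) ≡⟨ ∑-upTo (λ λ′ → ∑ (replicate (f λ′) λ′) χ) κ< (λ j _ ne →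
    trans (∑-replicate (f j) j) (trans (cong (f j *_) (𝟙-no (j ≟ κ) ne)) (ℕ.*-zeroʳ (f j)))) ⟩
  ∑ (replicate (f κ) κ) χ ≡⟨ ∑-replicate (f κ) κ ⟩
  f κ * 𝟙 (κ ≟ κ) ≡⟨ cong (f κ *_) (𝟙-yes (κ ≟ κ) refl) ⟩
  f κ * 1 ≡⟨ ℕ.*-identityʳ (f κ) ⟩
  f κ ∎
  where
  open ≡-Reasoning
  χ : ℕ → ℕ
  χ x = 𝟙 (x ≟ κ)
  ∑-replicate : ∀ n x → ∑ (replicate n x) χ ≡ n * χ x
  ∑-replicate zero x = refl
  ∑-replicate (suc n) x = cong (χ x +_) (∑-replicate n x)

unique-++⁻ : ∀ (xs {ys} : List ℕ) → AllPairs _≢_ (xs ++ ys) →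
  AllPairs _≢_ xs × AllPairs _≢_ ys × (∀ {x} → x ∈ xs → x ∉ ys)
unique-++⁻ [] u = [] , u , λ ()
unique-++⁻ (x ∷ xs) (x∉ ∷ u) with u₁ , u₂ , d ← unique-++⁻ xs u =
  Allₚ.++⁻ˡ xs x∉ ∷ u₁ , u₂ , λ { (here refl) y∈ → All.lookup (Allₚ.++⁻ʳ xs x∉) y∈ refl ; (there z∈) → d z∈ }

unique-map⁻ : {f : A → ℕ} {xs : List A} → AllPairs _≢_ (map f xs) → ∀ {x y} → x ∈ xs → y ∈ xs → f x ≡ f y → x ≡ y
unique-map⁻ {f = f} u x∈ y∈ e with AllPairs-∈ (AllPairsₚ.map⁻ u) x∈ y∈
... | inj₁ x≡y = x≡y
... | inj₂ (inj₁ ne) = contradiction e ne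
... | inj₂ (inj₂ ne) = contradiction (sym e) ne

-- Development of base blocks over a cyclic group

Triple : Set
Triple = ℕ × ℕ × ℕ

DistinctTriple : ℕ → Triple → Set
DistinctTriple N (x , y , z) = x ≢ y × x ≢ z × y ≢ z × x < N × y < N

distinctTriple? : ∀ N τ → Dec (DistinctTriple N τ)
distinctTriple? N (x , y , z) = ¬? (x ≟ y) ×-dec ¬? (x ≟ z) ×-dec ¬? (y ≟ z) ×-dec (x <? N) ×-dec (y <? N)

-- The first two points are required to be finite, so that a triple has a difference.
triples : ℕ → List ℕ → List Triple
triples N b = filter (distinctTriple? N) (concatMap (λ x → concatMap (λ y → map (λ z → x , y , z) b) b) b)

∈-triples : ∀ {N b x y z} → x ∈ b → y ∈ b → z ∈ b → DistinctTriple N (x , y , z) → (x , y , z) ∈ triples N b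
∈-triples {N} {b} {x} {y} {z} x∈ y∈ z∈ = ∈-filter⁺ (distinctTriple? N)
  (∈-concatMap⁺ (λ x → concatMap (λ y → map (λ z → x , y , z) b) b) (Any.map (λ { refl →
    ∈-concatMap⁺ (λ y → map (λ z → x , y , z) b) (Any.map (λ { refl → ∈-map⁺ (λ z → x , y , z) z∈ }) y∈) }) x∈))

adjs : List ℕ → List (ℕ × ℕ)
adjs (x ∷ y ∷ as) = (x , y) ∷ adjs (y ∷ as)
adjs _ = []

adjs⇒Adj : ∀ {x y} b → (x , y) ∈ adjs b → Adj x y b
adjs⇒Adj (x ∷ y ∷ as) (here refl) = here
adjs⇒Adj (x ∷ y ∷ as) (there p) = there (adjs⇒Adj (y ∷ as) p)

open DecMembership (×-≡-dec _≟_ _≟_) using () renaming (_∈?_ to _∈²?_)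

SwapAdj : List ℕ → List ℕ → Set
SwapAdj b c = Any (λ p → swap p ∈ adjs c) (adjs b)

swapAdj? : ∀ b c → Dec (SwapAdj b c)
swapAdj? b c = Any.any? (λ p → swap p ∈²? adjs c) (adjs b)

SwapAdj⇒Trade : ∀ {b c} → SwapAdj b c → Trade b c
SwapAdj⇒Trade {b} {c} t with (x , y) , p , q ← find t = x , y , adjs⇒Adj b p , adjs⇒Adj c q

Separated : (k N : ℕ) .{{_ : NonZero k}} → ℕ → ℕ → Set
Separated k N x y = x < N × y < N × x % k ≢ y % k

separated? : ∀ k N .{{_ : NonZero k}} x y → Dec (Separated k N x y)
separated? k N x y = (x <? N) ×-dec (y <? N) ×-dec ¬? (x % k ≟ y % k)

module Cyclic (N : ℕ) .{{_ : NonZero N}} where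
  open Mod N

  -- The point N plays the role of ∞.
  sh : ℕ → ℕ → ℕ
  sh s a = if does (a <? N) then (a + s) % N else a

  sh-finite : ∀ {s a} → a < N → sh s a ≡ (a + s) % N
  sh-finite {s} {a} a< rewrite dec-true (a <? N) a< = refl

  sh-fixed : ∀ {s a} → ¬ a < N → sh s a ≡ a
  sh-fixed {s} {a} ≮ rewrite dec-false (a <? N) ≮ = refl

  sh-< : ∀ {s a} → a < N → sh s a < N
  sh-< {s} {a} a< = subst (_< N) (sym (sh-finite a<)) (m%n<n (a + s) N)

  sh-<⁻ : ∀ {s a} → sh s a < N → a < N
  sh-<⁻ {s} {a} sh< with a <? N
  ... | yes a< = a<
  ... | no a≮ = subst (_< N) (sh-fixed a≮) sh<

  sh-sh : ∀ s δ a → sh s (sh δ a) ≡ sh ((s + δ) % N) a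
  sh-sh s δ a with a <? N
  ... | no ≮ = trans (cong (sh s) (sh-fixed ≮)) (trans (sh-fixed ≮) (sym (sh-fixed ≮)))
  ... | yes a< = trans (trans (cong (sh s) (sh-finite a<)) (sh-finite (m%n<n (a + δ) N)))
        (trans (≈-+ {(a + δ) % N} {a + δ} {s} {s} (%-≈ (a + δ)) refl)
        (trans (cong (_% N) (lemma a δ s)) (trans (sym (≈-+ {a} {a} {(s + δ) % N} {s + δ} refl (%-≈ (s + δ)))) (sym (sh-finite a<)))))
    where
    lemma : ∀ a δ s → a + δ + s ≡ a + (s + δ)
    lemma = solve-∀

  diff : ℕ → ℕ → ℕ
  diff a b = (b + (N ∸ a)) % N

  -- Two ordered pairs, not both equal to (∞ , ∞), are translates of each other
  -- if and only if their keys agree.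
  key : ℕ → ℕ → ℕ
  key a b = if does (a <? N)
    then (if does (b <? N) then diff a b else 1 + N)
    else (if does (b <? N) then N else 2 + N)

  diff< : ∀ a b → diff a b < N
  diff< a b = m%n<n (b + (N ∸ a)) N

  -- Translation is simply transitive on the finite points, so only the shift x - a can contribute.
  ∑-shift : ∀ {a x} → a < N → x < N → (F : ℕ → ℕ) → (∀ {s} → (a + s) % N ≢ x → F s ≡ 0) →
    ∑ (upTo N) F ≡ F ((x + (N ∸ a)) % N)
  ∑-shift {a} {x} a< x< F z = ∑-upTo F (m%n<n (x + (N ∸ a)) N) (λ j j< ne → z λ e → ne
    (≈⇒≡ j< (m%n<n (x + (N ∸ a)) N) (≈-cancelʳ a (begin
      (j + a) % N ≡⟨ cong (_% N) (ℕ.+-comm j a) ⟩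
      (a + j) % N ≡⟨ m%n%n≡m%n (a + j) N ⟨
      (a + j) % N % N ≡⟨ cong (_% N) e ⟩
      x % N ≡⟨ neg x (ℕ.<⇒≤ a<) ⟨
      (a + (x + (N ∸ a))) % N ≡⟨ cong (_% N) (ℕ.+-comm a _) ⟩
      (x + (N ∸ a) + a) % N ≡⟨ ≈-+ (%-≈ (x + (N ∸ a))) refl ⟨
      ((x + (N ∸ a)) % N + a) % N ∎))))
    where open ≡-Reasoning

  shift-hit : ∀ {a x} → a < N → x < N → (a + (x + (N ∸ a)) % N) % N ≡ x
  shift-hit {a} {x} a< x< = trans (≈-+ {a} {a} refl (%-≈ (x + (N ∸ a)))) (trans (neg x (ℕ.<⇒≤ a<)) (m<n⇒m%n≡m x<))

  key-ff : ∀ {a b} → a < N → b < N → key a b ≡ diff a b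
  key-ff {a} {b} a< b< rewrite dec-true (a <? N) a< | dec-true (b <? N) b< = refl

  key-f∞ : ∀ {a b} → a < N → ¬ b < N → key a b ≡ 1 + N
  key-f∞ {a} {b} a< b≮ rewrite dec-true (a <? N) a< | dec-false (b <? N) b≮ = refl

  key-∞f : ∀ {a b} → ¬ a < N → b < N → key a b ≡ N
  key-∞f {a} {b} a≮ b< rewrite dec-false (a <? N) a≮ | dec-true (b <? N) b< = refl

  key-∞∞ : ∀ {a b} → ¬ a < N → ¬ b < N → key a b ≡ 2 + N
  key-∞∞ {a} {b} a≮ b≮ rewrite dec-false (a <? N) a≮ | dec-false (b <? N) b≮ = refl

  private
    SameKind : ℕ → ℕ → Set
    SameKind a x = (a < N → x < N) × (x < N → a < N)

    n<k+n : ∀ k → N < suc k + N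
    n<k+n k = s≤s (ℕ.m≤n+m N k)

    -- The four kinds of pairs have keys in disjoint ranges: below `N` when both entries are finite,
    -- and `N`, `1 + N`, `2 + N` when the first, the second or both are infinite.
    key-kind : ∀ {a b x y} → key a b ≡ key x y → SameKind a x × SameKind b y
    key-kind {a} {b} {x} {y} e with a <? N | b <? N | x <? N | y <? N
    ... | yes a< | yes b< | yes x< | yes y< = ((λ _ → x<) , (λ _ → a<)) , ((λ _ → y<) , (λ _ → b<))
    ... | yes a< | yes b< | yes x< | no y≮ = contradiction (trans (sym (key-ff a< b<)) (trans e (key-f∞ x< y≮))) (ℕ.<⇒≢ (ℕ.<-trans (diff< a b) (n<k+n 0)))
    ... | yes a< | yes b< | no x≮ | yes y< = contradiction (trans (sym (key-ff a< b<)) (trans e (key-∞f x≮ y<))) (ℕ.<⇒≢ (diff< a b))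
    ... | yes a< | yes b< | no x≮ | no y≮ = contradiction (trans (sym (key-ff a< b<)) (trans e (key-∞∞ x≮ y≮))) (ℕ.<⇒≢ (ℕ.<-trans (diff< a b) (n<k+n 1)))
    ... | yes a< | no b≮ | yes x< | yes y< = contradiction (sym (trans (sym (key-f∞ a< b≮)) (trans e (key-ff x< y<)))) (ℕ.<⇒≢ (ℕ.<-trans (diff< x y) (n<k+n 0)))
    ... | yes a< | no b≮ | yes x< | no y≮ = ((λ _ → x<) , (λ _ → a<)) , ((λ b< → contradiction b< b≮) , (λ y< → contradiction y< y≮))
    ... | yes a< | no b≮ | no x≮ | yes y< = contradiction (sym (trans (sym (key-f∞ a< b≮)) (trans e (key-∞f x≮ y<)))) (ℕ.<⇒≢ (n<k+n 0))
    ... | yes a< | no b≮ | no x≮ | no y≮ = contradiction (trans (sym (key-f∞ a< b≮)) (trans e (key-∞∞ x≮ y≮))) (ℕ.<⇒≢ (ℕ.n<1+n (1 + N)))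
    ... | no a≮ | yes b< | yes x< | yes y< = contradiction (sym (trans (sym (key-∞f a≮ b<)) (trans e (key-ff x< y<)))) (ℕ.<⇒≢ (diff< x y))
    ... | no a≮ | yes b< | yes x< | no y≮ = contradiction (trans (sym (key-∞f a≮ b<)) (trans e (key-f∞ x< y≮))) (ℕ.<⇒≢ (n<k+n 0))
    ... | no a≮ | yes b< | no x≮ | yes y< = ((λ a< → contradiction a< a≮) , (λ x< → contradiction x< x≮)) , ((λ _ → y<) , (λ _ → b<))
    ... | no a≮ | yes b< | no x≮ | no y≮ = contradiction (trans (sym (key-∞f a≮ b<)) (trans e (key-∞∞ x≮ y≮))) (ℕ.<⇒≢ (n<k+n 1))
    ... | no a≮ | no b≮ | yes x< | yes y< = contradiction (sym (trans (sym (key-∞∞ a≮ b≮)) (trans e (key-ff x< y<)))) (ℕ.<⇒≢ (ℕ.<-trans (diff< x y) (n<k+n 1)))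
    ... | no a≮ | no b≮ | yes x< | no y≮ = contradiction (sym (trans (sym (key-∞∞ a≮ b≮)) (trans e (key-f∞ x< y≮)))) (ℕ.<⇒≢ (ℕ.n<1+n (1 + N)))
    ... | no a≮ | no b≮ | no x≮ | yes y< = contradiction (sym (trans (sym (key-∞∞ a≮ b≮)) (trans e (key-∞f x≮ y<)))) (ℕ.<⇒≢ (n<k+n 1))
    ... | no a≮ | no b≮ | no x≮ | no y≮ = ((λ a< → contradiction a< a≮) , (λ x< → contradiction x< x≮)) , ((λ b< → contradiction b< b≮) , (λ y< → contradiction y< y≮))

    sh-kind : ∀ {s a x} → sh s a ≡ x → SameKind a x
    sh-kind refl = sh-< , sh-<⁻

    mismatch : ∀ {a b x y} → ¬ (SameKind a x × SameKind b y) →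
      ∑ (upTo N) (λ s → 𝟙 ((sh s a ≟ x) ×-dec (sh s b ≟ y))) ≡ 𝟙 (key a b ≟ key x y)
    mismatch {a} {b} {x} {y} ¬same = trans
      (∑-zero {is = upTo N} (λ {s} _ → 𝟙-no (sh s a ≟ x ×-dec sh s b ≟ y) (¬same ∘ Product.map sh-kind sh-kind)))
      (sym (𝟙-no (key a b ≟ key x y) (¬same ∘ key-kind)))

    fixed-point : ∀ {a} → a ≤ N → ¬ a < N → a ≡ N
    fixed-point a≤ a≮ = ℕ.≤-antisym a≤ (ℕ.≮⇒≥ a≮)

  -- A finite entry is aligned by exactly one shift, and equality of the keys says whether the other
  -- entry follows. The pair of two infinite points is excluded because every shift fixes it.
  orbit-count : ∀ {a b x y} → a ≤ N → b ≤ N → x ≤ N → y ≤ N → ¬ (x ≡ N × y ≡ N) →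
    ∑ (upTo N) (λ s → 𝟙 ((sh s a ≟ x) ×-dec (sh s b ≟ y))) ≡ 𝟙 (key a b ≟ key x y)
  orbit-count {a} {b} {x} {y} a≤ b≤ x≤ y≤ ¬∞∞ = go (a <? N) (x <? N) (b <? N) (y <? N)
    where
    F : ℕ → ℕ
    F s = 𝟙 ((sh s a ≟ x) ×-dec (sh s b ≟ y))
    back : ∀ {x y} → x < N → y < N → (y + (N ∸ x) + x) % N ≡ y
    back {x} {y} x< y< = trans (cong (_% N) (ℕ.+-comm (y + (N ∸ x)) x)) (trans (neg y (ℕ.<⇒≤ x<)) (m<n⇒m%n≡m y<))
    go : Dec (a < N) → Dec (x < N) → Dec (b < N) → Dec (y < N) → ∑ (upTo N) F ≡ 𝟙 (key a b ≟ key x y)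
    go (yes a<) (no x≮) _ _ = mismatch λ k → x≮ (proj₁ (proj₁ k) a<)
    go (no a≮) (yes x<) _ _ = mismatch λ k → a≮ (proj₂ (proj₁ k) x<)
    go _ _ (yes b<) (no y≮) = mismatch λ k → y≮ (proj₁ (proj₂ k) b<)
    go _ _ (no b≮) (yes y<) = mismatch λ k → b≮ (proj₂ (proj₂ k) y<)
    go (no _) (no x≮) (no _) (no y≮) = contradiction (fixed-point x≤ x≮ , fixed-point y≤ y≮) ¬∞∞
    go (yes a<) (yes x<) (yes b<) (yes y<) = trans
      (∑-shift a< x< F (λ {s} ne → 𝟙-no (sh s a ≟ x ×-dec sh s b ≟ y) (ne ∘ trans (sym (sh-finite a<)) ∘ proj₁)))
      (𝟙-cong (sh s₀ a ≟ x ×-dec sh s₀ b ≟ y) (key a b ≟ key x y)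
        (λ (_ , e) → trans (key-ff a< b<) (trans (≈-cancelʳ x (trans (sym bs₀) (trans (sym (sh-finite b<)) (trans e (sym (back x< y<)))))) (sym (key-ff x< y<))))
        (λ e → trans (sh-finite a<) (shift-hit a< x<) , trans (sh-finite b<) (trans bs₀ (trans
          (≈-+ {b + (N ∸ a)} {y + (N ∸ x)} {x} {x} (trans (sym (key-ff a< b<)) (trans e (key-ff x< y<))) refl) (back x< y<)))))
      where
      s₀ = (x + (N ∸ a)) % N
      bs₀ : b + s₀ ≈ b + (N ∸ a) + x
      bs₀ = trans (≈-+ {b} {b} refl (%-≈ (x + (N ∸ a)))) (cong (_% N) (lemma b x (N ∸ a)))
        where
        lemma : ∀ b x c → b + (x + c) ≡ b + c + x
        lemma = solve-∀
    go (yes a<) (yes x<) (no b≮) (no y≮) = trans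
      (∑-shift a< x< F (λ {s} ne → 𝟙-no (sh s a ≟ x ×-dec sh s b ≟ y) (ne ∘ trans (sym (sh-finite a<)) ∘ proj₁)))
      (𝟙-cong (sh s₀ a ≟ x ×-dec sh s₀ b ≟ y) (key a b ≟ key x y)
        (λ _ → trans (key-f∞ a< b≮) (sym (key-f∞ x< y≮)))
        (λ _ → trans (sh-finite a<) (shift-hit a< x<) , trans (sh-fixed b≮) (trans (fixed-point b≤ b≮) (sym (fixed-point y≤ y≮)))))
      where s₀ = (x + (N ∸ a)) % N
    go (no a≮) (no x≮) (yes b<) (yes y<) = trans
      (∑-shift b< y< F (λ {s} ne → 𝟙-no (sh s a ≟ x ×-dec sh s b ≟ y) (ne ∘ trans (sym (sh-finite b<)) ∘ proj₂)))
      (𝟙-cong (sh s₀ a ≟ x ×-dec sh s₀ b ≟ y) (key a b ≟ key x y)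
        (λ _ → trans (key-∞f a≮ b<) (sym (key-∞f x≮ y<)))
        (λ _ → trans (sh-fixed a≮) (trans (fixed-point a≤ a≮) (sym (fixed-point x≤ x≮))) , trans (sh-finite b<) (shift-hit b< y<)))
      where s₀ = (y + (N ∸ b)) % N

  translates : List ℕ × List ℕ → List (List ℕ × List ℕ)
  translates (b , c) = map (λ s → map (sh s) b , map (sh s) c) (upTo N)

  develop : List (List ℕ × List ℕ) → List (List ℕ × List ℕ)
  develop = concatMap translates

  relative : ℕ → ℕ → ℕ
  relative x z = if does (z <? N) then diff x z else N

  -- This is invariant under translation, so two translates of base blocks that
  -- share three points give rise to a repeated code.
  code : Triple → ℕ
  code (x , y , z) = diff x y * suc N + relative x z

  diff-sh : ∀ s {a b} → a < N → b < N → diff (sh s a) (sh s b) ≡ diff a b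
  diff-sh s {a} {b} a< b< = trans (cong₂ diff (sh-finite a<) (sh-finite b<))
    (≈⇒≡ (diff< a′ b′) (diff< a b) (≈-cancelʳ a′ (begin
      (diff a′ b′ + a′) % N ≡⟨ ≈-+ {diff a′ b′} {b′ + (N ∸ a′)} {a′} (%-≈ _) refl ⟩
      (b′ + (N ∸ a′) + a′) % N ≡⟨ cong (_% N) (ℕ.+-comm (b′ + (N ∸ a′)) a′) ⟩
      (a′ + (b′ + (N ∸ a′))) % N ≡⟨ neg b′ (ℕ.<⇒≤ (m%n<n (a + s) N)) ⟩
      b′ % N ≡⟨ %-≈ (b + s) ⟩
      (b + s) % N ≡⟨ ≈-+ {b} {a + (b + (N ∸ a))} {s} (sym (neg b (ℕ.<⇒≤ a<))) refl ⟩
      (a + (b + (N ∸ a)) + s) % N ≡⟨ cong (_% N) (lemma a b (N ∸ a) s) ⟩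
      (b + (N ∸ a) + (a + s)) % N ≡⟨ ≈-+ {diff a b} {b + (N ∸ a)} {a′} {a + s} (%-≈ _) (%-≈ (a + s)) ⟨
      (diff a b + a′) % N ∎)))
    where
    open ≡-Reasoning
    a′ b′ : ℕ
    a′ = (a + s) % N
    b′ = (b + s) % N
    lemma : ∀ a b c s → a + (b + c) + s ≡ b + c + (a + s)
    lemma = solve-∀

  relative-f : ∀ {x z} → z < N → relative x z ≡ diff x z
  relative-f {x} {z} z< rewrite dec-true (z <? N) z< = refl

  relative-∞ : ∀ {x z} → ¬ z < N → relative x z ≡ N
  relative-∞ {x} {z} z≮ rewrite dec-false (z <? N) z≮ = refl

  relative-sh : ∀ s {x} z → x < N → relative (sh s x) (sh s z) ≡ relative x z
  relative-sh s {x} z x< with z <? N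
  ... | yes z< = trans (relative-f {sh s x} (sh-< z<)) (trans (diff-sh s x< z<) (sym (relative-f {x} z<)))
  ... | no z≮ = trans (relative-∞ {sh s x} (z≮ ∘ sh-<⁻)) (sym (relative-∞ {x} z≮))

  code-sh : ∀ s {x y} z → x < N → y < N → code (sh s x , sh s y , sh s z) ≡ code (x , y , z)
  code-sh s z x< y< = cong₂ (λ d r → d * suc N + r) (diff-sh s x< y<) (relative-sh s z x<)

  -- Evidence extracted from three common points of two translates. Its last component is for
  -- translates of one block: coincidence of the base triples themselves is possible only when the
  -- shifts agree.
  Shared : List ℕ → List ℕ → ℕ → ℕ → Set
  Shared b c s t = ∃₂ λ τ τ′ → τ ∈ triples N b × τ′ ∈ triples N c × code τ ≡ code τ′ × (τ ≡ τ′ → s ≈ t)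

  shared-finite : ∀ {b c s t X Y Z} → X < N → Y < N → X ≢ Y → X ≢ Z → Y ≢ Z →
    X ∈ map (sh s) b → Y ∈ map (sh s) b → Z ∈ map (sh s) b →
    X ∈ map (sh t) c → Y ∈ map (sh t) c → Z ∈ map (sh t) c → Shared b c s t
  shared-finite {s = s} {t} X< Y< X≢Y X≢Z Y≢Z X∈b Y∈b Z∈b X∈c Y∈c Z∈c
    with x , x∈ , refl ← ∈-map⁻ (sh s) X∈b with y , y∈ , refl ← ∈-map⁻ (sh s) Y∈b with z , z∈ , refl ← ∈-map⁻ (sh s) Z∈b
    with x′ , x′∈ , ex ← ∈-map⁻ (sh t) X∈c with y′ , y′∈ , ey ← ∈-map⁻ (sh t) Y∈c with z′ , z′∈ , ez ← ∈-map⁻ (sh t) Z∈c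
    = (x , y , z) , (x′ , y′ , z′)
    , ∈-triples x∈ y∈ z∈ (X≢Y ∘ cong (sh s) , X≢Z ∘ cong (sh s) , Y≢Z ∘ cong (sh s) , sh-<⁻ X< , sh-<⁻ Y<)
    , ∈-triples x′∈ y′∈ z′∈ ((λ e → X≢Y (trans ex (trans (cong (sh t) e) (sym ey)))) ,
        (λ e → X≢Z (trans ex (trans (cong (sh t) e) (sym ez)))) , (λ e → Y≢Z (trans ey (trans (cong (sh t) e) (sym ez)))) , x′< , y′<)
    , trans (sym (code-sh s z (sh-<⁻ X<) (sh-<⁻ Y<))) (trans (cong code (cong₂ _,_ ex (cong₂ _,_ ey ez))) (code-sh t z′ x′< y′<))
    , λ e → aligned (cong proj₁ e)
    where
    x′< : x′ < N
    x′< = sh-<⁻ (subst (_< N) ex X<)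
    y′< : y′ < N
    y′< = sh-<⁻ (subst (_< N) ey Y<)
    aligned : x ≡ x′ → s ≈ t
    aligned refl = ≈-cancelʳ x (begin
      (s + x) % N ≡⟨ cong (_% N) (ℕ.+-comm s x) ⟩
      (x + s) % N ≡⟨ sh-finite x′< ⟨
      sh s x ≡⟨ ex ⟩
      sh t x ≡⟨ sh-finite x′< ⟩
      (x + t) % N ≡⟨ cong (_% N) (ℕ.+-comm x t) ⟩
      (t + x) % N ∎)
      where open ≡-Reasoning

  -- At most one of three distinct common points is ∞, so two finite ones can be moved to the front,
  -- as `triples` requires.
  few-shifts : ∀ {b c s t} → All (_≤ N) b → ¬ Shared b c s t → Few (map (sh s) b) (map (sh t) c)
  few-shifts {b} {c} {s} {t} b≤ none X Y Z Xb Xc Yb Yc Zb Zc with X ≟ Y | X ≟ Z | Y ≟ Z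
  ... | yes e | _ | _ = inj₁ e
  ... | _ | yes e | _ = inj₂ (inj₁ e)
  ... | _ | _ | yes e = inj₂ (inj₂ e)
  ... | no X≢Y | no X≢Z | no Y≢Z = contradiction (go (X <? N) (Y <? N) (Z <? N)) none
    where
    infinite : ∀ {W} → W ∈ map (sh s) b → ¬ W < N → W ≡ N
    infinite p W≮ with a , a∈ , refl ← ∈-map⁻ (sh s) p =
      trans (sh-fixed (W≮ ∘ sh-<)) (fixed-point (All.lookup b≤ a∈) (W≮ ∘ sh-<))
    go : Dec (X < N) → Dec (Y < N) → Dec (Z < N) → Shared b c s t
    go (yes X<) (yes Y<) _ = shared-finite X< Y< X≢Y X≢Z Y≢Z Xb Yb Zb Xc Yc Zc
    go (yes X<) (no _) (yes Z<) = shared-finite X< Z< X≢Z X≢Y (≢-sym Y≢Z) Xb Zb Yb Xc Zc Yc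
    go (no _) (yes Y<) (yes Z<) = shared-finite Y< Z< Y≢Z (≢-sym X≢Y) (≢-sym X≢Z) Yb Zb Xb Yc Zc Xc
    go (no X≮) (no Y≮) _ = contradiction (trans (infinite Xb X≮) (sym (infinite Yb Y≮))) X≢Y
    go (no X≮) _ (no Z≮) = contradiction (trans (infinite Xb X≮) (sym (infinite Zb Z≮))) X≢Z
    go _ (no Y≮) (no Z≮) = contradiction (trans (infinite Yb Y≮) (sym (infinite Zb Z≮))) Y≢Z

  codes : List ℕ → List ℕ
  codes b = map code (triples N b)

  orbits-few : ∀ {b c} → All (_≤ N) b → (∀ {κ} → κ ∈ codes b → κ ∉ codes c) → ∀ s t → Few (map (sh s) b) (map (sh t) c)
  orbits-few {b} {c} b≤ disjoint s t = few-shifts b≤ λ (_ , _ , τ∈ , τ′∈ , e , _) →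
    disjoint (∈-map⁺ code τ∈) (subst (_∈ codes c) (sym e) (∈-map⁺ code τ′∈))

  -- When the codes of a block are distinct, a common code belongs to a single base triple, and this
  -- forces the two shifts to coincide.
  orbit-few : ∀ {b} → All (_≤ N) b → AllPairs _≢_ (codes b) → ∀ {s t} → s < N → t < N → s ≢ t →
    Few (map (sh s) b) (map (sh t) b)
  orbit-few b≤ u s< t< s≢t = few-shifts b≤ λ (_ , _ , τ∈ , τ′∈ , e , f) →
    s≢t (≈⇒≡ s< t< (f (unique-map⁻ u τ∈ τ′∈ e)))

  private
    map-cong-∈ : ∀ xs {f g : ℕ → ℕ} → (∀ {x} → x ∈ xs → f x ≡ g x) → map f xs ≡ map g xs
    map-cong-∈ [] e = refl
    map-cong-∈ (x ∷ xs) e = cong₂ _∷_ (e (here refl)) (map-cong-∈ xs (e ∘ there))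

  -- By induction it suffices to rotate by one step, and that only moves 0 from the front of the
  -- list to its end.
  rotation : ∀ δ → map (λ s → (s + δ) % N) (upTo N) ↭ upTo N
  rotation zero = ↭-reflexive (trans (map-cong-∈ (upTo N) (λ s∈ →
    trans (cong (_% N) (ℕ.+-identityʳ _)) (m<n⇒m%n≡m (∈-upTo⁻ s∈)))) (map-id (upTo N)))
  rotation (suc δ) = ↭-trans (↭-reflexive (trans (map-cong split (upTo N)) (map-∘ (upTo N))))
    (↭-trans (↭ₚ.map⁺ (λ s → suc s % N) (rotation δ)) (one N))
    where
    split : ∀ s → (s + suc δ) % N ≡ suc ((s + δ) % N) % N
    split s = trans (cong (_% N) (ℕ.+-suc s δ)) (sym (≈-+ {1} {1} refl (%-≈ (s + δ))))
    one : ∀ N .{{_ : NonZero N}} → map (λ s → suc s % N) (upTo N) ↭ upTo N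
    one (suc n) = ↭-trans (↭-reflexive (begin
      map f (upTo (suc n))             ≡⟨ cong (map f) (upTo-∷ʳ n) ⟨
      map f (upTo n ∷ʳ n)              ≡⟨ map-++ f (upTo n) (n ∷ []) ⟩
      map f (upTo n) ∷ʳ f n            ≡⟨ cong₂ _∷ʳ_ (map-cong-∈ (upTo n) (λ s∈ → m<n⇒m%n≡m (s≤s (∈-upTo⁻ s∈)))) (n%n≡0 (suc n)) ⟩
      map suc (upTo n) ∷ʳ 0            ≡⟨ cong (_∷ʳ 0) (map-applyUpTo id suc n) ⟩
      applyUpTo suc n ∷ʳ 0             ∎)) (↭-sym (↭ₚ.∷↭∷ʳ 0 (applyUpTo suc n)))
      where
      open ≡-Reasoning
      f : ℕ → ℕ
      f s = suc s % suc n

  orbits : List (List ℕ) → List (List ℕ)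
  orbits = concatMap (λ b → map (λ s → map (sh s) b) (upTo N))

  -- This is what allows a block to be partnered with one of its own translates: the partners run
  -- through the same orbit, rotated.
  orbit-shift : ∀ δ b → map (λ s → map (sh s) (map (sh δ) b)) (upTo N) ↭ map (λ s → map (sh s) b) (upTo N)
  orbit-shift δ b = ↭-trans
    (↭-reflexive (trans (map-cong (λ s → trans (sym (map-∘ b)) (map-cong (sh-sh s δ) b)) (upTo N)) (map-∘ (upTo N))))
    (↭ₚ.map⁺ (λ s → map (sh s) b) (rotation δ))

  selfLink : ℕ × List ℕ → List ℕ × List ℕ
  selfLink (δ , b) = b , map (sh δ) b

  -- A pair of base blocks enters in both orders, so that each block is the partner of the other and
  -- the second components again list every orbit.
  links : List (ℕ × List ℕ) → List (List ℕ × List ℕ) → List (List ℕ × List ℕ)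
  links ss qs = map selfLink ss ++ qs ++ map swap qs

  orbits-++ : ∀ bs cs → orbits (bs ++ cs) ≡ orbits bs ++ orbits cs
  orbits-++ = concatMap-++ _

  links-partners : ∀ ss qs → orbits (map proj₂ (links ss qs)) ↭ orbits (map proj₁ (links ss qs))
  links-partners [] qs = subst₂ _↭_ (expand proj₂ proj₁ (λ _ → refl)) (expand proj₁ proj₂ (λ _ → refl))
    (↭ₚ.++-comm (orbits (map proj₂ qs)) (orbits (map proj₁ qs)))
    where
    expand : (π π′ : List ℕ × List ℕ → List ℕ) → (∀ q → π′ q ≡ π (swap q)) →
      orbits (map π qs) ++ orbits (map π′ qs) ≡ orbits (map π (qs ++ map swap qs))
    expand π π′ e = trans (sym (orbits-++ (map π qs) _)) (cong orbits (sym (trans (map-++ π qs (map swap qs))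
      (cong (map π qs ++_) (trans (sym (map-∘ qs)) (sym (map-cong e qs)))))))
  links-partners ((δ , b) ∷ ss) qs = ↭ₚ.++⁺ (orbit-shift δ b) (links-partners ss qs)

  map-develop : (π : ∀ {A : Set} → A × A → A) → (∀ {f : List ℕ → List ℕ} p → π (Product.map f f p) ≡ f (π p)) →
    ∀ ps → map π (develop ps) ≡ orbits (map π ps)
  map-develop π nat ps = trans (map-concatMap π translates ps) (trans
    (concatMap-cong (λ p → trans (sym (map-∘ (upTo N))) (map-cong (λ s → nat {map (sh s)} p) (upTo N))) ps)
    (sym (concatMap-map _ π ps)))

  keys : List (List ℕ × List ℕ) → List ℕ
  keys = concatMap (λ p → map (uncurry key) (pairs (proj₁ p)))

  module _ (k i : ℕ) .{{_ : NonZero k}} where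

    -- The multiplicity demanded of each key. Differences not divisible by `k` join two groups and
    -- must occur twice, multiples of `k` never. The keys `N` and `1 + N` of pairs with one infinite
    -- entry occur `i` times, and `2 + N` not at all.
    target : ℕ → ℕ
    target κ = if does (κ <? N) then 2 * 𝟙 (¬? (κ % k ≟ 0)) else i * 𝟙 (κ <? 2 + N)

    Good : List (List ℕ × List ℕ) → Set
    Good ps =
      All (λ p → length (proj₁ p) ≡ 5 × All (_≤ N) (proj₁ p) × SwapAdj (proj₁ p) (proj₂ p)) ps ×
      T (unique (concatMap (codes ∘ proj₁) ps)) ×
      T (occursBelow (3 + N) target (keys ps))

    good? : ∀ ps → Dec (Good ps)
    good? ps =
      All.all? (λ p → (length (proj₁ p) ≟ 5) ×-dec All.all? (_≤? N) (proj₁ p) ×-dec swapAdj? (proj₁ p) (proj₂ p)) ps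
      ×-dec T? (unique (concatMap (codes ∘ proj₁) ps))
      ×-dec T? (occursBelow (3 + N) target (keys ps))

    pairDegree : ℕ → ℕ → ℕ
    pairDegree x y =
      2 * 𝟙 (separated? k N x y) +
      (i * 𝟙 ((x <? N) ×-dec (y ≟ N)) + i * 𝟙 ((x ≟ N) ×-dec (y <? N)))

    pairDegree-0 : ∀ {x y} → ¬ (x < N × y < N) → ¬ (x < N × y ≡ N) → ¬ (x ≡ N × y < N) → pairDegree x y ≡ 0
    pairDegree-0 {x} {y} p q r = cong₂ _+_
      (cong (2 *_) (𝟙-no (separated? k N x y) λ (x< , y< , _) → p (x< , y<)))
      (cong₂ _+_ (vanish ((x <? N) ×-dec (y ≟ N)) q) (vanish ((x ≟ N) ×-dec (y <? N)) r))
      where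
      vanish : {P : Set} (d : Dec P) → ¬ P → i * 𝟙 d ≡ 0
      vanish d ¬p = trans (cong (i *_) (𝟙-no d ¬p)) (ℕ.*-zeroʳ i)

    develop-∈ : ∀ ps {q} → q ∈ develop ps →
      ∃ λ p → ∃ λ s → p ∈ ps × s < N × q ≡ (map (sh s) (proj₁ p) , map (sh s) (proj₂ p))
    develop-∈ (p ∷ ps) q∈ with ∈-++⁻ (translates p) q∈
    ... | inj₁ q∈p with s , s∈ , e ← ∈-map⁻ (λ s → map (sh s) (proj₁ p) , map (sh s) (proj₂ p)) q∈p = p , s , here refl , ∈-upTo⁻ s∈ , e
    ... | inj₂ q∈ps with p′ , s , p′∈ , s< , e ← develop-∈ ps q∈ps = p′ , s , there p′∈ , s< , e

    develop-few : ∀ ps → All (λ p → All (_≤ N) (proj₁ p)) ps → AllPairs _≢_ (concatMap (codes ∘ proj₁) ps) →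
      AllPairs (Few on proj₁) (develop ps)
    develop-few [] _ _ = []
    develop-few (p ∷ ps) (p≤ ∷ ps≤) u with u₁ , u₂ , disjoint ← unique-++⁻ (codes (proj₁ p)) u = AllPairsₚ.++⁺
      (AllPairsₚ.map⁺ (AllPairsₚ.applyUpTo⁺₁ id N λ i<j j<N → orbit-few p≤ u₁ (ℕ.<-trans i<j j<N) j<N (ℕ.<⇒≢ i<j)))
      (develop-few ps ps≤ u₂)
      (All.tabulate λ q∈ → All.tabulate λ r∈ → cross q∈ r∈)
      where
      cross : ∀ {q r} → q ∈ translates p → r ∈ develop ps → Few (proj₁ q) (proj₁ r)
      cross q∈ r∈ with s , _ , refl ← ∈-map⁻ _ q∈ with p′ , t , p′∈ , _ , refl ← develop-∈ ps r∈ =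
        orbits-few p≤ (λ κ∈ κ∈′ → disjoint κ∈ (∈-concatMap⁺ (codes ∘ proj₁) (Any.map (λ { refl → κ∈′ }) p′∈))) s t

    module _ (k∣N : k ∣ N) (ss : List (ℕ × List ℕ)) (qs : List (List ℕ × List ℕ)) (good : Good (links ss qs)) where

      private
        ps : List (List ℕ × List ℕ)
        ps = links ss qs

        bounded : All (λ p → All (_≤ N) (proj₁ p)) ps
        bounded = All.map (proj₁ ∘ proj₂) (proj₁ good)

        ∈-keys : ∀ {p a b} → p ∈ ps → (a , b) ∈ pairs (proj₁ p) → key a b ∈ keys ps
        ∈-keys {p} p∈ ab∈ = ∈-concatMap⁺ (λ p → map (uncurry key) (pairs (proj₁ p))) (Any.map (λ { refl → ∈-map⁺ (uncurry key) ab∈ }) p∈)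

        keys-count : ∀ {κ} → κ < 3 + N → ∑ (keys ps) (λ l → 𝟙 (l ≟ κ)) ≡ target κ
        keys-count = occursBelow-sound {3 + N} {target} {keys ps} (proj₂ (proj₂ good))

        -- Such a pair would have the key `2 + N`, whose prescribed multiplicity is 0.
        not-both-fixed : ∀ {p a b} → p ∈ ps → (a , b) ∈ pairs (proj₁ p) → ¬ (¬ a < N × ¬ b < N)
        not-both-fixed {p} {a} {b} p∈ ab∈ (a≮ , b≮) = contradiction
          (subst₂ _≤_ (𝟙-yes (2 + N ≟ 2 + N) refl) (trans (keys-count (ℕ.n<1+n (2 + N))) none)
            (∑-≥ (λ l → 𝟙 (l ≟ 2 + N)) (subst (_∈ keys ps) (key-∞∞ a≮ b≮) (∈-keys p∈ ab∈)))) λ ()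
          where
          none : target (2 + N) ≡ 0
          none rewrite dec-false (2 + N <? N) (λ lt → ℕ.<-irrefl refl (ℕ.<-trans lt (ℕ.<-trans (ℕ.n<1+n N) (ℕ.n<1+n (1 + N)))))
            = trans (cong (i *_) (𝟙-no (2 + N <? 2 + N) (ℕ.<-irrefl refl))) (ℕ.*-zeroʳ i)

        translate-hits : ∀ x y p → ∑ (translates p) (λ q → hits (pairs (proj₁ q)) x y) ≡
          ∑ (pairs (proj₁ p)) (λ (a , b) → ∑ (upTo N) (λ s → 𝟙 ((sh s a ≟ x) ×-dec (sh s b ≟ y))))
        translate-hits x y (b , c) = trans (∑-map (λ s → map (sh s) b , map (sh s) c) (upTo N)) (trans
          (∑-cong {is = upTo N} (λ {s} _ → trans (cong (λ qs → hits qs x y) (pairs-map (sh s) b)) (∑-map _ (pairs b))))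
          (∑-swap (upTo N) (pairs b) (λ s (a , b) → 𝟙 ((sh s a ≟ x) ×-dec (sh s b ≟ y)))))

        sh-≤ : ∀ {s a} → a ≤ N → sh s a ≤ N
        sh-≤ {s} {a} a≤ with a <? N
        ... | yes a< = ℕ.<⇒≤ (sh-< a<)
        ... | no a≮ = subst (_≤ N) (sym (sh-fixed a≮)) a≤

        bounded-pair : ∀ {p a b} → p ∈ ps → (a , b) ∈ pairs (proj₁ p) → a ≤ N × b ≤ N
        bounded-pair p∈ ab∈ = Product.map (All.lookup (All.lookup bounded p∈)) (All.lookup (All.lookup bounded p∈)) (∈-pairs⁻ ab∈)

        count-inside : ∀ {x y} → x ≤ N → y ≤ N → ¬ (x ≡ N × y ≡ N) →
          ∑ (develop ps) (λ q → hits (pairs (proj₁ q)) x y) ≡ ∑ (keys ps) (λ l → 𝟙 (l ≟ key x y))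
        count-inside {x} {y} x≤ y≤ ¬∞∞ = begin
          ∑ (develop ps) (λ q → hits (pairs (proj₁ q)) x y) ≡⟨ ∑-concatMap translates ps ⟩
          ∑ ps (λ p → ∑ (translates p) (λ q → hits (pairs (proj₁ q)) x y))
            ≡⟨ ∑-cong {is = ps} (λ {p} p∈ → trans (translate-hits x y p) (trans
                (∑-cong {is = pairs (proj₁ p)} (λ ab∈ → orbit-count (proj₁ (bounded-pair p∈ ab∈)) (proj₂ (bounded-pair p∈ ab∈)) x≤ y≤ ¬∞∞))
                (sym (∑-map (uncurry key) (pairs (proj₁ p)))))) ⟩
          ∑ ps (λ p → ∑ (map (uncurry key) (pairs (proj₁ p))) (λ l → 𝟙 (l ≟ key x y)))
            ≡⟨ ∑-concatMap (λ p → map (uncurry key) (pairs (proj₁ p))) ps ⟨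
          ∑ (keys ps) (λ l → 𝟙 (l ≟ key x y)) ∎
          where open ≡-Reasoning

        count-outside : ∀ {x y} → ¬ (x ≤ N × y ≤ N × ¬ (x ≡ N × y ≡ N)) →
          ∑ (develop ps) (λ q → hits (pairs (proj₁ q)) x y) ≡ 0
        count-outside {x} {y} out = trans (∑-concatMap translates ps) (∑-zero {is = ps} λ {p} p∈ →
          trans (translate-hits x y p) (∑-zero {is = pairs (proj₁ p)} λ { {a , b} ab∈ → ∑-zero {is = upTo N} λ {s} _ →
            𝟙-no (sh s a ≟ x ×-dec sh s b ≟ y) (missed p∈ ab∈) }))
          where
          missed : ∀ {p a b s} → p ∈ ps → (a , b) ∈ pairs (proj₁ p) → ¬ (sh s a ≡ x × sh s b ≡ y)
          missed p∈ ab∈ (refl , refl) = out (sh-≤ (proj₁ (bounded-pair p∈ ab∈)) , sh-≤ (proj₂ (bounded-pair p∈ ab∈)) ,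
            λ (e , f) → not-both-fixed p∈ ab∈ ((λ a< → ℕ.<⇒≢ (sh-< a<) e) , (λ b< → ℕ.<⇒≢ (sh-< b<) f)))

        -- As `k` divides `N`, reducing a difference modulo `N` keeps its residue modulo `k`; so
        -- whether two points lie in one group depends only on their difference.
        diff-residue : ∀ {x y} → x < N → (diff x y % k ≡ 0 → x % k ≡ y % k) × (x % k ≡ y % k → diff x y % k ≡ 0)
        diff-residue {x} {y} x< = to , from
          where
          module K = Mod k
          d = y + (N ∸ x)
          reduce : diff x y % k ≡ d % k
          reduce = m∣n⇒o%n%m≡o%m k N d k∣N
          x+d : x + d K.≈ y
          x+d = trans (cong (_% k) (lemma x y (N ∸ x))) (trans
            (K.≈-+ {y} {y} refl (trans (cong (_% k) (ℕ.m+[n∸m]≡n (ℕ.<⇒≤ x<))) (trans (n∣m⇒m%n≡0 N k k∣N) (sym (0%n≡0 k)))))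
            (cong (_% k) (ℕ.+-identityʳ y)))
            where
            lemma : ∀ x y c → x + (y + c) ≡ y + (x + c)
            lemma = solve-∀
          to : diff x y % k ≡ 0 → x % k ≡ y % k
          to e = trans (sym (trans (K.≈-+ {x} {x} refl (trans (sym reduce) (trans e (sym (0%n≡0 k))))) (cong (_% k) (ℕ.+-identityʳ x)))) x+d
          from : x % k ≡ y % k → diff x y % k ≡ 0
          from e = trans reduce (trans (K.≈-cancelʳ {d} {0} x (trans (cong (_% k) (ℕ.+-comm d x)) (trans x+d (sym e)))) (0%n≡0 k))

        target-degree : ∀ {x y} → x ≤ N → y ≤ N → ¬ (x ≡ N × y ≡ N) → target (key x y) ≡ pairDegree x y
        target-degree {x} {y} x≤ y≤ ¬∞∞ = go (x <? N) (y <? N)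
          where
          i*1 : {P : Set} (d : Dec P) → P → i * 𝟙 d ≡ i
          i*1 d p = trans (cong (i *_) (𝟙-yes d p)) (ℕ.*-identityʳ i)
          i*0 : {P : Set} (d : Dec P) → ¬ P → i * 𝟙 d ≡ 0
          i*0 d ¬p = trans (cong (i *_) (𝟙-no d ¬p)) (ℕ.*-zeroʳ i)
          target-≥ : ∀ {κ} → N ≤ κ → κ < 2 + N → target κ ≡ i
          target-≥ {κ} N≤ κ< rewrite dec-false (κ <? N) (ℕ.≤⇒≯ N≤) = i*1 (κ <? 2 + N) κ<
          target-< : ∀ {κ} → κ < N → target κ ≡ 2 * 𝟙 (¬? (κ % k ≟ 0))
          target-< {κ} κ< rewrite dec-true (κ <? N) κ< = refl
          go : Dec (x < N) → Dec (y < N) → target (key x y) ≡ pairDegree x y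
          go (yes x<) (yes y<) = trans (cong target (key-ff x< y<)) (trans (target-< (diff< x y))
            (sym (trans (cong₂ _+_ (cong (2 *_) (𝟙-cong (separated? k N x y) (¬? (diff x y % k ≟ 0))
                (λ (_ , _ , ne) → ne ∘ proj₁ (diff-residue x<)) (λ ne → x< , y< , ne ∘ proj₂ (diff-residue x<))))
              (cong₂ _+_ (i*0 ((x <? N) ×-dec (y ≟ N)) (λ (_ , e) → ℕ.<⇒≢ y< e)) (i*0 ((x ≟ N) ×-dec (y <? N)) (λ (e , _) → ℕ.<⇒≢ x< e))))
              (ℕ.+-identityʳ _))))
          go (yes x<) (no y≮) = trans (cong target (key-f∞ x< y≮)) (trans (target-≥ (ℕ.n≤1+n N) (ℕ.n<1+n (1 + N)))
            (sym (trans (cong₂ _+_ (cong (2 *_) (𝟙-no (separated? k N x y) (λ (_ , y< , _) → y≮ y<)))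
              (cong₂ _+_ (i*1 ((x <? N) ×-dec (y ≟ N)) (x< , fixed-point y≤ y≮)) (i*0 ((x ≟ N) ×-dec (y <? N)) (λ (_ , y<) → y≮ y<))))
              (ℕ.+-identityʳ i))))
          go (no x≮) (yes y<) = trans (cong target (key-∞f x≮ y<)) (trans (target-≥ ℕ.≤-refl (s≤s (ℕ.n≤1+n N)))
            (sym (cong₂ _+_ (cong (2 *_) (𝟙-no (separated? k N x y) (λ (x< , _) → x≮ x<)))
              (cong₂ _+_ (i*0 ((x <? N) ×-dec (y ≟ N)) (λ (x< , _) → x≮ x<)) (i*1 ((x ≟ N) ×-dec (y <? N)) (fixed-point x≤ x≮ , y<))))))
          go (no x≮) (no y≮) = contradiction (fixed-point x≤ x≮ , fixed-point y≤ y≮) ¬∞∞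

        key<3+N : ∀ x y → key x y < 3 + N
        key<3+N x y = go (x <? N) (y <? N)
          where
          go : Dec (x < N) → Dec (y < N) → key x y < 3 + N
          go (yes x<) (yes y<) = subst (_< 3 + N) (sym (key-ff x< y<)) (ℕ.<-≤-trans (diff< x y) (ℕ.m≤n+m N 3))
          go (yes x<) (no y≮) = subst (_< 3 + N) (sym (key-f∞ x< y≮)) (s≤s (s≤s (ℕ.n≤1+n N)))
          go (no x≮) (yes y<) = subst (_< 3 + N) (sym (key-∞f x≮ y<)) (n<k+n 2)
          go (no x≮) (no y≮) = subst (_< 3 + N) (sym (key-∞∞ x≮ y≮)) (ℕ.n<1+n (2 + N))

      cyclic-design : Design pairDegree (develop (links ss qs))
      cyclic-design = record
        { length5 = All.tabulate λ q∈ → length-q q∈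
        ; count = λ x y → total x y ((x ≤? N) ×-dec (y ≤? N) ×-dec ¬? ((x ≟ N) ×-dec (y ≟ N)))
        ; simple = develop-few ps bounded (unique-sound (proj₁ (proj₂ good)))
        ; partners = subst₂ _↭_ (sym (map-develop proj₂ (λ _ → refl) ps)) (sym (map-develop proj₁ (λ _ → refl) ps)) (links-partners ss qs)
        ; trades = All.tabulate λ q∈ → trade-q q∈ }
        where
        length-q : ∀ {q} → q ∈ develop ps → length (proj₁ q) ≡ 5
        length-q q∈ with p , s , p∈ , _ , refl ← develop-∈ ps q∈ =
          trans (length-map (sh s) (proj₁ p)) (proj₁ (All.lookup (proj₁ good) p∈))
        trade-q : ∀ {q} → q ∈ develop ps → Trade (proj₁ q) (proj₂ q)
        trade-q q∈ with p , s , p∈ , _ , refl ← develop-∈ ps q∈ =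
          Trade-map (sh s) (SwapAdj⇒Trade (proj₂ (proj₂ (All.lookup (proj₁ good) p∈))))
        total : ∀ x y → Dec (x ≤ N × y ≤ N × ¬ (x ≡ N × y ≡ N)) →
          ∑ (develop ps) (λ q → hits (pairs (proj₁ q)) x y) ≡ pairDegree x y
        total x y (yes (x≤ , y≤ , ¬∞∞)) = trans (count-inside x≤ y≤ ¬∞∞) (trans (keys-count (key<3+N x y)) (target-degree x≤ y≤ ¬∞∞))
        total x y (no out) = trans (count-outside out) (sym (pairDegree-0
          (λ (x< , y<) → out (ℕ.<⇒≤ x< , ℕ.<⇒≤ y< , λ (e , _) → ℕ.<⇒≢ x< e))
          (λ (x< , e) → out (ℕ.<⇒≤ x< , ℕ.≤-reflexive e , λ (e′ , _) → ℕ.<⇒≢ x< e′))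
          (λ (e , y<) → out (ℕ.≤-reflexive e , ℕ.<⇒≤ y< , λ (_ , e′) → ℕ.<⇒≢ y< e′))))

-- Group divisible designs from cyclic ones

degree : (k N : ℕ) .{{_ : NonZero k}} → ℕ → ℕ → ℕ
degree k N x y = 2 * 𝟙 (separated? k N x y)

-- The groups are the residue classes modulo k of the points 0 , … , N - 1.
GDD : (k N : ℕ) .{{_ : NonZero k}} → Set
GDD k N = ∃ (Design (degree k N))

GDD⇒DD : ∀ {v} .{{_ : NonZero v}} → GDD v v → DD v
GDD⇒DD {v} (ps , D) = ps , Design-cong (λ x y → cong (2 *_)
  (𝟙-cong (separated? v v x y) (distinct? v x y)
    (λ (x< , y< , ne) → x< , y< , ne ∘ cong (_% v)) (λ (x< , y< , ne) → x< , y< , ne ∘ Mod.≈⇒≡ v x< y<))) D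

module _ (N : ℕ) .{{_ : NonZero N}} where
  open Cyclic N

  cyclic-GDD : ∀ k .{{_ : NonZero k}} → k ∣ N → ∀ ss qs → does (good? k 0 (links ss qs)) ≡ true → GDD k N
  cyclic-GDD k k∣N ss qs ok = _ , Design-cong (λ x y → ℕ.+-identityʳ _) (cyclic-design k 0 k∣N ss qs (fromDoes (good? k 0 _) ok))

  -- For `k = N` all groups are single points, so separated points are just distinct points.
  cyclic-DD : ∀ ss qs → does (good? N 0 (links ss qs)) ≡ true → DD N
  cyclic-DD ss qs ok = GDD⇒DD (cyclic-GDD N ∣-refl ss qs ok)

  -- The value `i = 2` puts each ordered pair of ∞ and a finite point into two blocks, so `N` is an
  -- ordinary point of the result.
  cyclic-DD∞ : ∀ ss qs → does (good? N 2 (links ss qs)) ≡ true → DD (1 + N)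
  cyclic-DD∞ ss qs ok = _ , Design-cong (λ x y → go x y (x <? N) (y <? N)) (cyclic-design N 2 ∣-refl ss qs (fromDoes (good? N 2 _) ok))
    where
    2*0 : {P : Set} (d : Dec P) → ¬ P → 2 * 𝟙 d ≡ 0
    2*0 d ¬p = cong (2 *_) (𝟙-no d ¬p)
    top : ∀ {x} → ¬ x < N → x < suc N → x ≡ N
    top x≮ (s≤s x≤) = ℕ.≤-antisym x≤ (ℕ.≮⇒≥ x≮)
    go : ∀ x y → Dec (x < N) → Dec (y < N) → pairDegree N 2 x y ≡ 2 * 𝟙 (distinct? (suc N) x y)
    go x y (yes x<) (yes y<) = trans (cong₂ _+_
      (cong (2 *_) (𝟙-cong (separated? N N x y) (distinct? (suc N) x y)
        (λ (_ , _ , ne) → ℕ.m<n⇒m<1+n x< , ℕ.m<n⇒m<1+n y< , ne ∘ cong (_% N)) (λ (_ , _ , ne) → x< , y< , ne ∘ Mod.≈⇒≡ N x< y<)))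
      (cong₂ _+_ (2*0 ((x <? N) ×-dec (y ≟ N)) (λ (_ , e) → ℕ.<⇒≢ y< e)) (2*0 ((x ≟ N) ×-dec (y <? N)) (λ (e , _) → ℕ.<⇒≢ x< e))))
      (ℕ.+-identityʳ _)
    go x y (yes x<) (no y≮) = trans (cong₂ _+_ (2*0 (separated? N N x y) (λ (_ , y< , _) → y≮ y<))
      (cong₂ _+_ (cong (2 *_) (𝟙-cong ((x <? N) ×-dec (y ≟ N)) (distinct? (suc N) x y)
          (λ { (_ , refl) → ℕ.m<n⇒m<1+n x< , ℕ.n<1+n N , ℕ.<⇒≢ x< }) (λ (_ , y< , _) → x< , top y≮ y<)))
        (2*0 ((x ≟ N) ×-dec (y <? N)) (λ (_ , y<) → y≮ y<)))) (ℕ.+-identityʳ _)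
    go x y (no x≮) (yes y<) = cong₂ _+_ (2*0 (separated? N N x y) (λ (x< , _) → x≮ x<))
      (cong₂ _+_ (2*0 ((x <? N) ×-dec (y ≟ N)) (λ (x< , _) → x≮ x<)) (cong (2 *_) (𝟙-cong ((x ≟ N) ×-dec (y <? N)) (distinct? (suc N) x y)
          (λ { (refl , _) → ℕ.n<1+n N , ℕ.m<n⇒m<1+n y< , ≢-sym (ℕ.<⇒≢ y<) }) (λ (x< , _) → top x≮ x< , y<))))
    go x y (no x≮) (no y≮) = trans (cong₂ _+_ (2*0 (separated? N N x y) (λ (x< , _) → x≮ x<))
      (cong₂ _+_ (2*0 ((x <? N) ×-dec (y ≟ N)) (λ (x< , _) → x≮ x<)) (2*0 ((x ≟ N) ×-dec (y <? N)) (λ (_ , y<) → y≮ y<))))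
      (sym (2*0 (distinct? (suc N) x y) (λ (x< , y< , ne) → ne (trans (top x≮ x<) (sym (top y≮ y<))))))

-- Designs given by an explicit list of blocks

quot-rem : ∀ {y} x v .{{_ : NonZero v}} → y < v → (y + x * v) % v ≡ y × (y + x * v) / v ≡ x
quot-rem {y} x v y< = r , sym (ℕ.*-cancelʳ-≡ x _ v (ℕ.+-cancelˡ-≡ y _ _ (begin
  y + x * v ≡⟨ m≡m%n+[m/n]*n (y + x * v) v ⟩
  (y + x * v) % v + (y + x * v) / v * v ≡⟨ cong (_+ (y + x * v) / v * v) r ⟩
  y + (y + x * v) / v * v ∎)))
  where
  open ≡-Reasoning
  r : (y + x * v) % v ≡ y
  r = trans ([m+kn]%n≡m%n y x v) (m<n⇒m%n≡m y<)

module Explicit (k v : ℕ) .{{_ : NonZero k}} .{{_ : NonZero v}} where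

  pairCode : ℕ × ℕ → ℕ
  pairCode (x , y) = y + x * v

  -- A triple is read as a three-digit number in base `v`. Triples are listed in every order, so
  -- blocks with three common points share a code however their entries are arranged.
  tripleCodes : List ℕ × List ℕ → List ℕ
  tripleCodes p = map (λ (x , y , z) → z + (y + x * v) * v) (triples v (proj₁ p))

  pairCodes : List ℕ × List ℕ → List ℕ
  pairCodes p = map pairCode (pairs (proj₁ p))

  Valid : List (List ℕ × List ℕ) → Set
  Valid ps =
    All (λ p → length (proj₁ p) ≡ 5 × All (_< v) (proj₁ p) × SwapAdj (proj₁ p) (proj₂ p)) ps ×
    T (unique (concatMap tripleCodes ps)) ×
    T (occursBelow (v * v) (λ κ → degree k v (κ / v) (κ % v)) (concatMap pairCodes ps))

  valid? : ∀ ps → Dec (Valid ps)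
  valid? ps =
    All.all? (λ p → (length (proj₁ p) ≟ 5) ×-dec All.all? (_<? v) (proj₁ p) ×-dec swapAdj? (proj₁ p) (proj₂ p)) ps
    ×-dec T? (unique (concatMap tripleCodes ps))
    ×-dec T? (occursBelow (v * v) (λ κ → degree k v (κ / v) (κ % v)) (concatMap pairCodes ps))

  few : ∀ {p q} → All (_< v) (proj₁ p) → (∀ {κ} → κ ∈ tripleCodes p → κ ∉ tripleCodes q) → Few (proj₁ p) (proj₁ q)
  few p< disjoint x y z xp xq yp yq zp zq with x ≟ y | x ≟ z | y ≟ z
  ... | yes e | _ | _ = inj₁ e
  ... | _ | yes e | _ = inj₂ (inj₁ e)
  ... | _ | _ | yes e = inj₂ (inj₂ e)
  ... | no xy | no xz | no yz = contradiction (∈-map⁺ _ (∈-triples xq yq zq distinct)) (disjoint (∈-map⁺ _ (∈-triples xp yp zp distinct)))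
    where
    distinct : DistinctTriple v (x , y , z)
    distinct = xy , xz , yz , All.lookup p< xp , All.lookup p< yp

  all-few : ∀ ps → All (λ p → All (_< v) (proj₁ p)) ps → AllPairs _≢_ (concatMap tripleCodes ps) → AllPairs (Few on proj₁) ps
  all-few [] _ _ = []
  all-few (p ∷ ps) (p< ∷ ps<) u with _ , u′ , disjoint ← unique-++⁻ (tripleCodes p) u =
    All.tabulate (λ {q} q∈ → few {p} {q} p< λ κ∈ κ∈′ → disjoint κ∈ (∈-concatMap⁺ tripleCodes (Any.map (λ { refl → κ∈′ }) q∈)))
    ∷ all-few ps ps< u′

  explicit-GDD : ∀ qs → does (valid? (qs ++ map swap qs)) ≡ true → GDD k v
  explicit-GDD qs ok = ps , record
    { length5 = All.map proj₁ (proj₁ valid)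
    ; count = λ x y → total x y ((x <? v) ×-dec (y <? v))
    ; simple = all-few ps bounded (unique-sound (proj₁ (proj₂ valid)))
    ; partners = subst₂ _↭_
        (sym (trans (map-++ proj₂ qs (map swap qs)) (cong (map proj₂ qs ++_) (sym (map-∘ qs)))))
        (sym (trans (map-++ proj₁ qs (map swap qs)) (cong (map proj₁ qs ++_) (sym (map-∘ qs)))))
        (↭ₚ.++-comm (map proj₂ qs) (map proj₁ qs))
    ; trades = All.map (SwapAdj⇒Trade ∘ proj₂ ∘ proj₂) (proj₁ valid) }
    where
    ps = qs ++ map swap qs
    valid : Valid ps
    valid = fromDoes (valid? ps) ok
    bounded : All (λ p → All (_< v) (proj₁ p)) ps
    bounded = All.map (proj₁ ∘ proj₂) (proj₁ valid)
    bounded-pair : ∀ {p a b} → p ∈ ps → (a , b) ∈ pairs (proj₁ p) → a < v × b < v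
    bounded-pair p∈ ab∈ = Product.map (All.lookup (All.lookup bounded p∈)) (All.lookup (All.lookup bounded p∈)) (∈-pairs⁻ ab∈)
    pairCode-injective : ∀ {a b x y} → b < v → y < v → pairCode (a , b) ≡ pairCode (x , y) → a ≡ x × b ≡ y
    pairCode-injective {a} {b} {x} {y} b< y< e =
      trans (sym (proj₂ (quot-rem a v b<))) (trans (cong (_/ v) e) (proj₂ (quot-rem x v y<))) ,
      trans (sym (proj₁ (quot-rem a v b<))) (trans (cong (_% v) e) (proj₁ (quot-rem x v y<)))
    total : ∀ x y → Dec (x < v × y < v) → ∑ ps (λ p → hits (pairs (proj₁ p)) x y) ≡ degree k v x y
    total x y (no out) = trans (∑-zero {is = ps} λ {p} p∈ → ∑-zero {is = pairs (proj₁ p)} λ { {a , b} ab∈ →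
        𝟙-no (a ≟ x ×-dec b ≟ y) (λ { (refl , refl) → out (bounded-pair p∈ ab∈) }) })
      (sym (cong (2 *_) (𝟙-no (separated? k v x y) (λ (x< , y< , _) → out (x< , y<)))))
    total x y (yes (x< , y<)) = begin
      ∑ ps (λ p → hits (pairs (proj₁ p)) x y)
        ≡⟨ ∑-cong {is = ps} (λ {p} p∈ → trans (∑-cong {is = pairs (proj₁ p)} (λ { {a , b} ab∈ →
            𝟙-cong (a ≟ x ×-dec b ≟ y) (pairCode (a , b) ≟ pairCode (x , y)) (λ { (refl , refl) → refl })
              (pairCode-injective (proj₂ (bounded-pair p∈ ab∈)) y<) })) (sym (∑-map pairCode (pairs (proj₁ p))))) ⟩
      ∑ ps (λ p → ∑ (pairCodes p) (λ κ → 𝟙 (κ ≟ pairCode (x , y))))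
        ≡⟨ ∑-concatMap pairCodes ps ⟨
      ∑ (concatMap pairCodes ps) (λ κ → 𝟙 (κ ≟ pairCode (x , y)))
        ≡⟨ occursBelow-sound {v * v} {λ κ → degree k v (κ / v) (κ % v)} {concatMap pairCodes ps} (proj₂ (proj₂ valid)) code< ⟩
      degree k v (pairCode (x , y) / v) (pairCode (x , y) % v)
        ≡⟨ cong₂ (degree k v) (proj₂ (quot-rem x v y<)) (proj₁ (quot-rem x v y<)) ⟩
      degree k v x y ∎
      where
      open ≡-Reasoning
      code< : pairCode (x , y) < v * v
      code< = ℕ.<-≤-trans (ℕ.+-monoˡ-< (x * v) y<) (ℕ.*-monoˡ-≤ v x<)

-- The parabolas x ↦ a x² + b x + c over 𝔽₅ with a ≠ 0.  Two of them meet in at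
-- most two points.  Those with a = 3 , 4 are traversed backwards.
parabola : ℕ → ℕ → ℕ → List ℕ
parabola a b c = map (λ x → 5 * ((a * x * x + b * x + c) % 5) + x) (upTo 5)

-- The two equations differ by 2 x² + 3 x = 2 x (x - 1) modulo 5, so the parabolas agree at x = 0
-- and x = 1. These two points are neighbours in both blocks, and the reversal puts them in opposite
-- order: a trade. Two points with different x lie on one parabola for each a, which gives two
-- blocks in each direction.
parabolas : List (List ℕ × List ℕ)
parabolas = concatMap (λ a → concatMap (λ b → map (λ c →
  parabola a b c , reverse (parabola (2 + a) (3 + b) c)) (upTo 5)) (upTo 5)) (1 ∷ 2 ∷ [])

GDD-5 : GDD 5 25
GDD-5 = Explicit.explicit-GDD 5 25 parabolas refl

-- Transversal designs and Wilson's fundamental construction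

nth : List ℕ → ℕ → ℕ
nth [] _ = 0
nth (x ∷ xs) zero = x
nth (x ∷ xs) (suc j) = nth xs j

nth-∈ : ∀ xs {j} → j < length xs → nth xs j ∈ xs
nth-∈ (x ∷ xs) {zero} _ = here refl
nth-∈ (x ∷ xs) {suc j} (s≤s j<) = there (nth-∈ xs j<)

∈-nth : ∀ {xs x} → x ∈ xs → ∃ λ j → j < length xs × nth xs j ≡ x
∈-nth (here refl) = 0 , z<s , refl
∈-nth (there x∈) with j , j< , e ← ∈-nth x∈ = suc j , s≤s j< , e

nth-injective : ∀ {xs} → AllPairs _≢_ xs → ∀ {i j} → i < length xs → j < length xs → nth xs i ≡ nth xs j → i ≡ j
nth-injective {x ∷ xs} (x∉ ∷ u) {zero} {zero} _ _ _ = refl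
nth-injective {x ∷ xs} (x∉ ∷ u) {zero} {suc j} _ (s≤s j<) e = contradiction e (All.lookup x∉ (nth-∈ xs j<))
nth-injective {x ∷ xs} (x∉ ∷ u) {suc i} {zero} (s≤s i<) _ e = contradiction (sym e) (All.lookup x∉ (nth-∈ xs i<))
nth-injective {x ∷ xs} (x∉ ∷ u) {suc i} {suc j} (s≤s i<) (s≤s j<) e = cong suc (nth-injective u i< j< e)

-- Transversal designs with K groups of size m: the row r has the point r g in the group g.
record TD (K m : ℕ) : Set where
  field
    rows  : List (ℕ → ℕ)
    range : ∀ {r g} → r ∈ rows → g < K → r g < m
    once  : ∀ {g h e e′} → g < K → h < K → g ≢ h → e < m → e′ < m →
      ∑ rows (λ r → 𝟙 ((r g ≟ e) ×-dec (r h ≟ e′))) ≡ 1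

  -- Two rows agreeing in two groups would both be counted by `once`, whose value is 1.
  apart : AllPairs (λ r r′ → ∀ {g h} → g < K → h < K → g ≢ h → r g ≡ r′ g → r h ≢ r′ h) rows
  apart = go rows id (λ g< h< ne e< e′< → ℕ.≤-reflexive (once g< h< ne e< e′<))
    where
    go : ∀ rs → (∀ {r} → r ∈ rs → r ∈ rows) →
      (∀ {g h e e′} → g < K → h < K → g ≢ h → e < m → e′ < m → ∑ rs (λ r → 𝟙 ((r g ≟ e) ×-dec (r h ≟ e′))) ≤ 1) →
      AllPairs (λ r r′ → ∀ {g h} → g < K → h < K → g ≢ h → r g ≡ r′ g → r h ≢ r′ h) rs
    go [] _ _ = []
    go (r ∷ rs) ⊆ atMost = All.tabulate (λ {r′} r′∈ {g} {h} g< h< ne eg eh → contradiction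
        (ℕ.≤-trans (ℕ.+-mono-≤
          (ℕ.≤-reflexive (sym (𝟙-yes (r g ≟ r g ×-dec r h ≟ r h) (refl , refl))))
          (ℕ.≤-trans (ℕ.≤-reflexive (sym (𝟙-yes (r′ g ≟ r g ×-dec r′ h ≟ r h) (sym eg , sym eh))))
            (∑-≥ (λ r′ → 𝟙 ((r′ g ≟ r g) ×-dec (r′ h ≟ r h))) r′∈)))
          (atMost g< h< ne (range (⊆ (here refl)) g<) (range (⊆ (here refl)) h<))) λ { (s≤s ()) })
      ∷ go rs (⊆ ∘ there) (λ g< h< ne e< e′< → ℕ.≤-trans (ℕ.m≤n+m _ _) (atMost g< h< ne e< e′<))

open TD public

_≟²_ : DecidableEquality (ℕ × ℕ)
_≟²_ = ×-≡-dec _≟_ _≟_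

module C² = Count _≟²_

-- Wilson's fundamental construction with weight 5.  The group g of the
-- transversal design is truncated to t g points; the label K is used for the
-- ε points at infinity.
module Inflate {L m : ℕ} (td : TD (5 + L) m) (t : ℕ → ℕ)
  (t-full : ∀ {g} → g < 5 → t g ≡ m) (t≤m : ∀ {g} → g < 5 + L → t g ≤ m)
  (ingredient : ∀ k .{{_ : NonZero k}} → 5 ≤ k → k ≤ 5 + L → GDD k (5 * k))
  (ε : ℕ) (ε≤1 : ε ≤ 1) (filling : ∀ g → g < 5 + L → DD (5 * t g + ε)) where

  K : ℕ
  K = 5 + L

  -- The point `(g , z)` is the copy `z % 5` of the point `z / 5` of the group `g`.
  Hit : (ℕ → ℕ) → ℕ × ℕ → Set
  Hit r (g , z) = g < K × r g < t g × z / 5 ≡ r g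

  hit? : ∀ r X → Dec (Hit r X)
  hit? r (g , z) = (g <? K) ×-dec (r g <? t g) ×-dec (z / 5 ≟ r g)

  rowPair? : ∀ r X Y → Dec (Hit r X × Hit r Y × proj₁ X ≢ proj₁ Y)
  rowPair? r X Y = hit? r X ×-dec hit? r Y ×-dec ¬? (proj₁ X ≟ proj₁ Y)

  rowDegree : (ℕ → ℕ) → ℕ × ℕ → ℕ × ℕ → ℕ
  rowDegree r X Y = 2 * 𝟙 (rowPair? r X Y)

  row-design : ∀ r G k .{{_ : NonZero k}} → length G ≡ k → AllPairs _≢_ G →
    (∀ {g} → g ∈ G → g < K × r g < t g) → (∀ {g} → g < K → r g < t g → g ∈ G) →
    GDD k (5 * k) → ∃ (C².Design (rowDegree r))
  row-design r G k refl u ∈G⁻ ∈G⁺ (ps , D) = _ , Design-map _≟_ _≟²_ φ (_< 5 * k) inj image? D S∈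
    (λ {x} {y} x< y< → cong (2 *_) (𝟙-cong (rowPair? r (φ x) (φ y))
      (separated? k (5 * k) x y)
      (λ (_ , _ , ne) → x< , y< , ne ∘ cong (nth G)) (λ (_ , _ , ne) → φ-hit x< , φ-hit y< , ne ∘ nth-injective u (m%n<n x k) (m%n<n y k))))
    (λ {X} Y ∉X → cong (2 *_) (𝟙-no (rowPair? r X Y) (λ (hX , _) → missed hX ∉X)))
    (λ X {Y} ∉Y → cong (2 *_) (𝟙-no (rowPair? r X Y) (λ (_ , hY , _) → missed hY ∉Y)))
    where
    group : ℕ → ℕ
    group a = nth G (a % k)
    -- A residue class modulo `k`, that is, a group of the ingredient, becomes the five copies of
    -- the row's point in one group of the transversal design; `a / k` numbers the copies.
    φ : ℕ → ℕ × ℕ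
    φ a = group a , a / k + r (group a) * 5
    a/k<5 : ∀ {a} → a < 5 * k → a / k < 5
    a/k<5 {a} a< = m<n*o⇒m/o<n {a} {5} {k} a<
    φ-hit : ∀ {a} → a < 5 * k → Hit r (φ a)
    φ-hit {a} a< with g< , r< ← ∈G⁻ (nth-∈ G (m%n<n a k)) = g< , r< , proj₂ (quot-rem (r (group a)) 5 (a/k<5 a<))
    inj : ∀ {x y} → x < 5 * k → y < 5 * k → φ x ≡ φ y → x ≡ y
    inj {x} {y} x< y< e = trans (m≡m%n+[m/n]*n x k) (trans (cong₂ (λ i q → i + q * k) same-residue same-quotient) (sym (m≡m%n+[m/n]*n y k)))
      where
      same-residue : x % k ≡ y % k
      same-residue = nth-injective u (m%n<n x k) (m%n<n y k) (cong proj₁ e)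
      same-quotient : x / k ≡ y / k
      same-quotient = trans (sym (proj₁ (quot-rem (r (group x)) 5 (a/k<5 x<)))) (trans (cong (λ X → proj₂ X % 5) e)
        (proj₁ (quot-rem (r (group y)) 5 (a/k<5 y<))))
    preimage : ∀ {X} → Hit r X → ∃ λ a → a < 5 * k × φ a ≡ X
    preimage {g , z} (g< , r< , e) with j , j< , refl ← ∈-nth (∈G⁺ g< r<) with rem , quo ← quot-rem (z % 5) k j< =
      j + (z % 5) * k , ℕ.<-≤-trans (ℕ.+-monoˡ-< ((z % 5) * k) j<) (ℕ.*-monoˡ-≤ k (m%n<n z 5)) ,
      cong₂ _,_ (cong (nth G) rem) (trans (cong₂ (λ q i → q + r (nth G i) * 5) quo rem)
        (trans (cong (λ q → z % 5 + q * 5) (sym e)) (sym (m≡m%n+[m/n]*n z 5))))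
    missed : ∀ {X} → Hit r X → ¬ (∀ {a} → a < 5 * k → φ a ≢ X)
    missed hX ∉X with a , a< , e ← preimage hX = ∉X a< e
    image? : ∀ X → (∃ λ a → a < 5 * k × φ a ≡ X) ⊎ (∀ {a} → a < 5 * k → φ a ≢ X)
    image? X with hit? r X
    ... | yes hX = inj₁ (preimage hX)
    ... | no ¬hX = inj₂ (λ { a< refl → ¬hX (φ-hit a<) })
    S∈ : ∀ {p x} → p ∈ ps → x ∈ proj₁ p → x < 5 * k
    S∈ {x = x} p∈ x∈ with support D p∈ x∈
    ... | y , inj₁ le = proj₁ (2𝟙-pos (separated? k (5 * k) x y) le)
    ... | y , inj₂ le = proj₁ (proj₂ (2𝟙-pos (separated? k (5 * k) y x) le))

  groupsOf : (ℕ → ℕ) → List ℕ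
  groupsOf r = filter (λ g → r g <? t g) (upTo K)

  -- The first five groups are not truncated, so every row keeps its points there.
  groupsOf≥5 : ∀ {r} → r ∈ rows td → 5 ≤ length (groupsOf r)
  groupsOf≥5 {r} r∈ = accept (full 0 (s≤s z≤n)) (accept (full 1 (s≤s (s≤s z≤n))) (accept (full 2 (s≤s (s≤s (s≤s z≤n))))
    (accept (full 3 (s≤s (s≤s (s≤s (s≤s z≤n))))) (accept (full 4 (s≤s (s≤s (s≤s (s≤s (s≤s z≤n)))))) z≤n))))
    where
    full : ∀ g → g < 5 → r g < t g
    full g g< = subst (r g <_) (sym (t-full g<)) (range td r∈ (ℕ.≤-trans g< (ℕ.m≤m+n 5 L)))
    accept : ∀ {g gs n} → r g < t g → n ≤ length (filter (λ g → r g <? t g) gs) → suc n ≤ length (filter (λ g → r g <? t g) (g ∷ gs))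
    accept p le = subst (λ gs → _ ≤ length gs) (sym (filter-accept (λ g → r g <? t g) p)) (s≤s le)

  rowDesign : ∀ r → 5 ≤ length (groupsOf r) → ∃ (C².Design (rowDegree r))
  rowDesign r 5≤ = row-design r (groupsOf r) (length (groupsOf r)) {{nz}} refl (AllPairsₚ.filter⁺ (λ g → r g <? t g) (upTo-unique K))
    (λ g∈ → Product.map₁ ∈-upTo⁻ (∈-filter⁻ (λ g → r g <? t g) g∈)) (λ g< r< → ∈-filter⁺ (λ g → r g <? t g) (∈-upTo⁺ g<) r<)
    (ingredient (length (groupsOf r)) {{nz}} 5≤ (subst (length (groupsOf r) ≤_) (length-upTo K) (length-filter (λ g → r g <? t g) (upTo K))))
    where
    nz : NonZero (length (groupsOf r))
    nz = >-nonZero (ℕ.<-≤-trans z<s 5≤)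

  -- Concatenation needs the blocks as a function of the row alone, without a proof that the row
  -- belongs to the transversal design; the empty list serves as default value.
  rowBlocks : (ℕ → ℕ) → List (List (ℕ × ℕ) × List (ℕ × ℕ))
  rowBlocks r with 5 ≤? length (groupsOf r)
  ... | yes 5≤ = proj₁ (rowDesign r 5≤)
  ... | no _ = []

  rowBlocks-design : ∀ {r} → r ∈ rows td → C².Design (rowDegree r) (rowBlocks r)
  rowBlocks-design {r} r∈ with 5 ≤? length (groupsOf r)
  ... | yes 5≤ = proj₂ (rowDesign r 5≤)
  ... | no 5≰ = contradiction (groupsOf≥5 r∈) 5≰

  -- The filling of a group also uses the point at infinity, if there is one; this point is common
  -- to all fillings.
  InGroup : ℕ → ℕ × ℕ → Set
  InGroup g (h , z) = (h ≡ g × z < 5 * t g) ⊎ (h ≡ K × z < ε)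

  inGroup? : ∀ g X → Dec (InGroup g X)
  inGroup? g (h , z) = ((h ≟ g) ×-dec (z <? 5 * t g)) ⊎-dec ((h ≟ K) ×-dec (z <? ε))

  groupPair? : ∀ g X Y → Dec (InGroup g X × InGroup g Y × X ≢ Y)
  groupPair? g X Y = inGroup? g X ×-dec inGroup? g Y ×-dec ¬? (X ≟² Y)

  groupDegree : ℕ → ℕ × ℕ → ℕ × ℕ → ℕ
  groupDegree g X Y = 2 * 𝟙 (groupPair? g X Y)

  groupDesign : ∀ g → DD (5 * t g + ε) → g < K → ∃ (C².Design (groupDegree g))
  groupDesign g (ps , D) g< = _ , Design-map _≟_ _≟²_ φ (_< s + ε) inj image? D S∈
    (λ {x} {y} x< y< → cong (2 *_) (𝟙-cong (groupPair? g (φ x) (φ y)) (distinct? (s + ε) x y)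
      (λ (_ , _ , ne) → x< , y< , ne ∘ cong φ) (λ (_ , _ , ne) → φ-in x< , φ-in y< , ne ∘ inj x< y<)))
    (λ {X} Y ∉X → cong (2 *_) (𝟙-no (groupPair? g X Y) (λ (iX , _) → missed iX ∉X)))
    (λ X {Y} ∉Y → cong (2 *_) (𝟙-no (groupPair? g X Y) (λ (_ , iY , _) → missed iY ∉Y)))
    where
    s = 5 * t g
    place : ∀ x → Dec (x < s) → ℕ × ℕ
    place x (yes _) = g , x
    place x (no _) = K , x ∸ s
    φ : ℕ → ℕ × ℕ
    φ x = place x (x <? s)
    φ-in : ∀ {x} → x < s + ε → InGroup g (φ x)
    φ-in {x} x< with x <? s
    ... | yes x<s = inj₁ (refl , x<s)
    ... | no x≮s = inj₂ (refl , ℕ.+-cancelˡ-< s _ _ (subst (_< s + ε) (sym (ℕ.m+[n∸m]≡n (ℕ.≮⇒≥ x≮s))) x<))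
    inj : ∀ {x y} → x < s + ε → y < s + ε → φ x ≡ φ y → x ≡ y
    inj {x} {y} _ _ e with x <? s | y <? s
    ... | yes _ | yes _ = cong proj₂ e
    ... | no x≮ | no y≮ = ℕ.∸-cancelʳ-≡ (ℕ.≮⇒≥ x≮) (ℕ.≮⇒≥ y≮) (cong proj₂ e)
    ... | yes _ | no _ = contradiction (cong proj₁ e) (ℕ.<⇒≢ g<)
    ... | no _ | yes _ = contradiction (sym (cong proj₁ e)) (ℕ.<⇒≢ g<)
    preimage : ∀ {X} → InGroup g X → ∃ λ x → x < s + ε × φ x ≡ X
    preimage {h , z} (inj₁ (refl , z<)) = z , ℕ.<-≤-trans z< (ℕ.m≤m+n s ε) , placed (z <? s)
      where
      placed : (d : Dec (z < s)) → place z d ≡ (g , z)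
      placed (yes _) = refl
      placed (no z≮) = contradiction z< z≮
    preimage {h , z} (inj₂ (refl , z<)) = s + z , ℕ.+-monoʳ-< s z< , placed (s + z <? s)
      where
      placed : (d : Dec (s + z < s)) → place (s + z) d ≡ (K , z)
      placed (yes lt) = contradiction lt (ℕ.≤⇒≯ (ℕ.m≤m+n s z))
      placed (no _) = cong (K ,_) (ℕ.m+n∸m≡n s z)
    missed : ∀ {X} → InGroup g X → ¬ (∀ {x} → x < s + ε → φ x ≢ X)
    missed iX ∉X with x , x< , e ← preimage iX = ∉X x< e
    image? : ∀ X → (∃ λ x → x < s + ε × φ x ≡ X) ⊎ (∀ {x} → x < s + ε → φ x ≢ X)
    image? X with inGroup? g X
    ... | yes iX = inj₁ (preimage iX)
    ... | no ¬iX = inj₂ (λ { {x} x< e → ¬iX (subst (InGroup g) e (φ-in x<)) })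
    S∈ : ∀ {p x} → p ∈ ps → x ∈ proj₁ p → x < s + ε
    S∈ {x = x} p∈ x∈ with support D p∈ x∈
    ... | y , inj₁ le = proj₁ (2𝟙-pos (distinct? (s + ε) x y) le)
    ... | y , inj₂ le = proj₁ (proj₂ (2𝟙-pos (distinct? (s + ε) y x) le))

  groupBlocks : ℕ → List (List (ℕ × ℕ) × List (ℕ × ℕ))
  groupBlocks g with g <? K
  ... | yes g< = proj₁ (groupDesign g (filling g g<) g<)
  ... | no _ = []

  groupBlocks-design : ∀ {g} → g < K → C².Design (groupDegree g) (groupBlocks g)
  groupBlocks-design {g} g< with g <? K
  ... | yes g<′ = proj₂ (groupDesign g (filling g g<′) g<′)
  ... | no g≮ = contradiction g< g≮

  row-hit : ∀ {r p X} → r ∈ rows td → p ∈ rowBlocks r → X ∈ proj₁ p → Hit r X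
  row-hit {r} {X = X} r∈ p∈ X∈ with C².support (rowBlocks-design r∈) p∈ X∈
  ... | Y , inj₁ le = proj₁ (2𝟙-pos (rowPair? r X Y) le)
  ... | Y , inj₂ le = proj₁ (proj₂ (2𝟙-pos (rowPair? r Y X) le))

  row-groups : ∀ {r p X Y} → r ∈ rows td → p ∈ rowBlocks r → X ∈ proj₁ p → Y ∈ proj₁ p → X ≢ Y → proj₁ X ≢ proj₁ Y
  row-groups {r} {X = X} {Y} r∈ p∈ X∈ Y∈ ne with C².together (rowBlocks-design r∈) p∈ X∈ Y∈ ne
  ... | inj₁ le = proj₂ (proj₂ (2𝟙-pos (rowPair? r X Y) le))
  ... | inj₂ le = ≢-sym (proj₂ (proj₂ (2𝟙-pos (rowPair? r Y X) le)))

  group-in : ∀ {g p X} → g < K → p ∈ groupBlocks g → X ∈ proj₁ p → InGroup g X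
  group-in {g} {X = X} g< p∈ X∈ with C².support (groupBlocks-design g<) p∈ X∈
  ... | Y , inj₁ le = proj₁ (2𝟙-pos (groupPair? g X Y) le)
  ... | Y , inj₂ le = proj₁ (proj₂ (2𝟙-pos (groupPair? g Y X) le))

  Single : List (ℕ × ℕ) → List (ℕ × ℕ) → Set
  Single b c = ∀ {X Y} → X ∈ b → X ∈ c → Y ∈ b → Y ∈ c → X ≡ Y

  Single⇒Few : ∀ {b c} → Single b c → Few b c
  Single⇒Few single X Y Z Xb Xc Yb Yc _ _ = inj₁ (single Xb Xc Yb Yc)

  -- Two common points of blocks from different rows would lie in different groups, and the rows
  -- would agree in both. So such blocks share at most one point.
  rows-cross : AllPairs (λ r r′ → ∀ {p q} → p ∈ rowBlocks r → q ∈ rowBlocks r′ → Few (proj₁ p) (proj₁ q)) (rows td)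
  rows-cross = go (rows td) id (apart td)
    where
    go : ∀ rs → (∀ {r} → r ∈ rs → r ∈ rows td) →
      AllPairs (λ r r′ → ∀ {g h} → g < K → h < K → g ≢ h → r g ≡ r′ g → r h ≢ r′ h) rs →
      AllPairs (λ r r′ → ∀ {p q} → p ∈ rowBlocks r → q ∈ rowBlocks r′ → Few (proj₁ p) (proj₁ q)) rs
    go [] _ [] = []
    go (r ∷ rs) ⊆ (a ∷ as) = All.tabulate (λ {r′} r′∈ p∈ q∈ → Single⇒Few (single r′∈ p∈ q∈)) ∷ go rs (⊆ ∘ there) as
      where
      single : ∀ {r′ p q} → r′ ∈ rs → p ∈ rowBlocks r → q ∈ rowBlocks r′ → Single (proj₁ p) (proj₁ q)
      single {r′} r′∈ p∈ q∈ {X} {Y} Xp Xq Yp Yq with X ≟² Y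
      ... | yes e = e
      ... | no ne with g< , _ , eX ← row-hit (⊆ (here refl)) p∈ Xp with h< , _ , eY ← row-hit (⊆ (here refl)) p∈ Yp
        with _ , _ , eX′ ← row-hit (⊆ (there r′∈)) q∈ Xq with _ , _ , eY′ ← row-hit (⊆ (there r′∈)) q∈ Yq =
        contradiction (trans (sym eY) eY′) (All.lookup a r′∈ g< h< (row-groups (⊆ (here refl)) p∈ Xp Yp ne) (trans (sym eX) eX′))

  -- Different fillings have only the point at infinity in common, and there is at most one because
  -- `ε ≤ 1`.
  groups-cross : AllPairs (λ g h → ∀ {p q} → p ∈ groupBlocks g → q ∈ groupBlocks h → Few (proj₁ p) (proj₁ q)) (upTo K)
  groups-cross = AllPairsₚ.applyUpTo⁺₁ id K λ {g} {h} g<h h< {p} {q} p∈ q∈ → Single⇒Few {proj₁ p} {proj₁ q} λ {X} {Y} Xp Xq Yp Yq →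
    trans (at-∞ g<h h< (group-in (ℕ.<-trans g<h h<) p∈ Xp) (group-in h< q∈ Xq))
      (sym (at-∞ g<h h< (group-in (ℕ.<-trans g<h h<) p∈ Yp) (group-in h< q∈ Yq)))
    where
    at-∞ : ∀ {g h X} → g < h → h < K → InGroup g X → InGroup h X → X ≡ (K , 0)
    at-∞ g<h _ (inj₁ (refl , _)) (inj₁ (refl , _)) = contradiction refl (ℕ.<⇒≢ g<h)
    at-∞ g<h h< (inj₁ (refl , _)) (inj₂ (e , _)) = contradiction e (ℕ.<⇒≢ (ℕ.<-trans g<h h<))
    at-∞ {X = h , z} _ _ (inj₂ (refl , z<)) _ with s≤s z≤n ← ℕ.≤-trans z< ε≤1 = refl

  -- A block from a row has at most one point in each group and never contains ∞, while a block of a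
  -- filling stays within one group and ∞.
  rows-groups-cross : ∀ {p q} → p ∈ concatMap rowBlocks (rows td) → q ∈ concatMap groupBlocks (upTo K) → Few (proj₁ p) (proj₁ q)
  rows-groups-cross {p} {q} p∈ q∈ with r , r∈ , p∈r ← find (∈-concatMap⁻ rowBlocks {xs = rows td} p∈) with g , g∈ , q∈g ← find (∈-concatMap⁻ groupBlocks {xs = upTo K} q∈) =
    Single⇒Few {proj₁ p} {proj₁ q} single
    where
    in-group : ∀ {X} → X ∈ proj₁ p → X ∈ proj₁ q → proj₁ X ≡ g
    in-group Xp Xq with row-hit r∈ p∈r Xp | group-in (∈-upTo⁻ g∈) q∈g Xq
    ... | _ | inj₁ (e , _) = e
    ... | h< , _ | inj₂ (e , _) = contradiction e (ℕ.<⇒≢ h<)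
    single : Single (proj₁ p) (proj₁ q)
    single {X} {Y} Xp Xq Yp Yq with X ≟² Y
    ... | yes e = e
    ... | no ne = contradiction (trans (in-group Xp Xq) (sym (in-group Yp Yq))) (row-groups r∈ p∈r Xp Yp ne)

  Point : ℕ × ℕ → Set
  Point (g , z) = (g < K × z < 5 * t g) ⊎ (g ≡ K × z < ε)

  point? : ∀ X → Dec (Point X)
  point? (g , z) = ((g <? K) ×-dec (z <? 5 * t g)) ⊎-dec ((g ≟ K) ×-dec (z <? ε))

  Hit⇒Point : ∀ {r X} → Hit r X → Point X
  Hit⇒Point {r} {g , z} (g< , r< , e) = inj₁ (g< , subst₂ _<_ (sym (m≡m%n+[m/n]*n z 5)) (ℕ.*-comm (t g) 5)
    (ℕ.<-≤-trans (ℕ.+-monoˡ-< (z / 5 * 5) (m%n<n z 5)) (ℕ.*-monoˡ-≤ 5 (subst (_< t g) (sym e) r<))))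

  InGroup⇒Point : ∀ {g X} → g < K → InGroup g X → Point X
  InGroup⇒Point g< (inj₁ (refl , z<)) = inj₁ (g< , z<)
  InGroup⇒Point g< (inj₂ p) = inj₂ p

  pointPair? : ∀ X Y → Dec (Point X × Point Y × X ≢ Y)
  pointPair? X Y = point? X ×-dec point? Y ×-dec ¬? (X ≟² Y)

  fullDegree : ℕ × ℕ → ℕ × ℕ → ℕ
  fullDegree X Y = 2 * 𝟙 (pointPair? X Y)

  private
    rowSum groupSum : ℕ × ℕ → ℕ × ℕ → ℕ
    rowSum X Y = ∑ (rows td) (λ r → rowDegree r X Y)
    groupSum X Y = ∑ (upTo K) (λ g → groupDegree g X Y)

    rowSum-0 : ∀ {X Y} → (∀ {r} → r ∈ rows td → ¬ (Hit r X × Hit r Y × proj₁ X ≢ proj₁ Y)) → rowSum X Y ≡ 0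
    rowSum-0 {X} {Y} none = ∑-zero {is = rows td} λ {r} r∈ → cong (2 *_) (𝟙-no (rowPair? r X Y) (none r∈))

    groupSum-0 : ∀ {X Y} → (∀ {g} → g < K → ¬ (InGroup g X × InGroup g Y × X ≢ Y)) → groupSum X Y ≡ 0
    groupSum-0 {X} {Y} none = ∑-zero {is = upTo K} λ {g} g∈ → cong (2 *_) (𝟙-no (groupPair? g X Y) (none (∈-upTo⁻ g∈)))

    groupSum-2 : ∀ {X Y g} → g < K → InGroup g X → InGroup g Y → X ≢ Y → (∀ {h} → h < K → InGroup h X → InGroup h Y → h ≡ g) → groupSum X Y ≡ 2
    groupSum-2 {X} {Y} {g} g< iX iY ne only = trans
      (∑-upTo (λ g → groupDegree g X Y) g< (λ h h< h≢g → cong (2 *_) (𝟙-no (groupPair? h X Y) (λ (hX , hY , _) → h≢g (only h< hX hY)))))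
      (cong (2 *_) (𝟙-yes (groupPair? g X Y) (iX , iY , ne)))

    quotient< : ∀ {g z} → z < 5 * t g → z / 5 < t g
    quotient< {g} {z} z< = m<n*o⇒m/o<n {z} {t g} {5} (subst (z <_) (ℕ.*-comm 5 (t g)) z<)

    -- Points of different groups are covered through the one row that contains both; points of the
    -- same group, or a point and ∞, through the filling of that group. Two distinct points at
    -- infinity are ruled out by `ε ≤ 1`.
    inside : ∀ {X Y} → Point X → Point Y → X ≢ Y → rowSum X Y + groupSum X Y ≡ 2
    inside {g , z} {h , w} (inj₁ (g< , z<)) (inj₁ (h< , w<)) ne = go (g ≟ h)
      where
      go : Dec (g ≡ h) → rowSum (g , z) (h , w) + groupSum (g , z) (h , w) ≡ 2
      go (yes refl) = cong₂ _+_ (rowSum-0 {g , z} {g , w} (λ _ (_ , _ , g≢g) → g≢g refl))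
        (groupSum-2 g< (inj₁ (refl , z<)) (inj₁ (refl , w<)) ne (λ { _ (inj₁ (e , _)) _ → sym e ; _ (inj₂ (e , _)) _ → contradiction e (ℕ.<⇒≢ g<) }))
      go (no g≢h) = cong₂ _+_ (trans (∑-*ˡ 2 (rows td) (λ r → 𝟙 (rowPair? r (g , z) (h , w))))
          (cong (2 *_) (trans (∑-cong {is = rows td} (λ {r} _ → 𝟙-cong (rowPair? r (g , z) (h , w)) (r g ≟ z / 5 ×-dec r h ≟ w / 5)
            (λ ((_ , _ , e) , (_ , _ , f) , _) → sym e , sym f)
            (λ (e , f) → (g< , subst (_< t g) (sym e) (quotient< z<) , sym e) , (h< , subst (_< t h) (sym f) (quotient< w<) , sym f) , g≢h)))
          (once td g< h< g≢h (ℕ.<-≤-trans (quotient< z<) (t≤m g<)) (ℕ.<-≤-trans (quotient< w<) (t≤m h<))))))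
        (groupSum-0 {g , z} {h , w} λ { _ (inj₁ (refl , _) , inj₁ (e , _) , _) → g≢h (sym e)
                      ; _ (inj₂ (e , _) , _ , _) → ℕ.<⇒≢ g< e
                      ; _ (_ , inj₂ (e , _) , _) → ℕ.<⇒≢ h< e })
    inside {g , z} {h , w} (inj₁ (g< , z<)) (inj₂ (refl , w<)) ne =
      cong₂ _+_ (rowSum-0 {g , z} {h , w} (λ _ (_ , (K<K , _) , _) → ℕ.<-irrefl refl K<K))
        (groupSum-2 g< (inj₁ (refl , z<)) (inj₂ (refl , w<)) ne (λ { _ (inj₁ (e , _)) _ → sym e ; _ (inj₂ (e , _)) _ → contradiction e (ℕ.<⇒≢ g<) }))
    inside {g , z} {h , w} (inj₂ (refl , z<)) (inj₁ (h< , w<)) ne =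
      cong₂ _+_ (rowSum-0 {g , z} {h , w} (λ _ ((K<K , _) , _) → ℕ.<-irrefl refl K<K))
        (groupSum-2 h< (inj₂ (refl , z<)) (inj₁ (refl , w<)) ne (λ { _ _ (inj₁ (e , _)) → sym e ; _ _ (inj₂ (e , _)) → contradiction e (ℕ.<⇒≢ h<) }))
    inside {g , z} {h , w} (inj₂ (refl , z<)) (inj₂ (refl , w<)) ne
      with s≤s z≤n ← ℕ.≤-trans z< ε≤1 with s≤s z≤n ← ℕ.≤-trans w< ε≤1 = contradiction refl ne

    sums : ∀ X Y → rowSum X Y + groupSum X Y ≡ fullDegree X Y
    sums X Y = go (pointPair? X Y)
      where
      go : (d : Dec (Point X × Point Y × X ≢ Y)) → rowSum X Y + groupSum X Y ≡ 2 * 𝟙 d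
      go (yes (pX , pY , ne)) = inside pX pY ne
      go (no none) = cong₂ _+_
        (rowSum-0 {X} {Y} (λ {r} _ (hX , hY , ne) → none (Hit⇒Point {r} hX , Hit⇒Point {r} hY , ne ∘ cong proj₁)))
        (groupSum-0 {X} {Y} (λ g< (iX , iY , ne) → none (InGroup⇒Point g< iX , InGroup⇒Point g< iY , ne)))

  fullDesign : ∃ (C².Design fullDegree)
  fullDesign = _ , C².Design-cong sums (C².Design-++
    (C².Design-concat rowBlocks-design rows-cross)
    (C².Design-concat (groupBlocks-design ∘ ∈-upTo⁻) groups-cross) rows-groups-cross)

  offset : ℕ → ℕ
  offset zero = 0
  offset (suc g) = offset g + 5 * t g

  offset-mono : ∀ {g h} → g ≤ h → offset g ≤ offset h
  offset-mono {g} {zero} z≤n = z≤n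
  offset-mono {g} {suc h} g≤ with ℕ.m≤n⇒m<n∨m≡n g≤
  ... | inj₁ (s≤s g≤h) = ℕ.≤-trans (offset-mono g≤h) (ℕ.m≤m+n _ _)
  ... | inj₂ refl = ℕ.≤-refl

  -- The truncated groups occupy consecutive intervals. The label `K` of the point at infinity
  -- places it right after all of them, at `offset K`.
  encode : ℕ × ℕ → ℕ
  encode (g , z) = offset g + z

  encode< : ∀ {g z h} → z < 5 * t g → g < h → encode (g , z) < offset h
  encode< {g} z< g<h = ℕ.<-≤-trans (ℕ.+-monoʳ-< (offset g) z<) (offset-mono g<h)

  before : ∀ {g z h w} → Point (g , z) → Point (h , w) → g < h → encode (g , z) < offset h
  before (inj₁ (_ , z<)) _ g<h = encode< z< g<h
  before (inj₂ (refl , _)) (inj₁ (h< , _)) g<h = contradiction h< (ℕ.<-asym g<h)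
  before (inj₂ (refl , _)) (inj₂ (refl , _)) g<h = contradiction g<h (ℕ.<-irrefl refl)

  encode-injective : ∀ {X Y} → Point X → Point Y → encode X ≡ encode Y → X ≡ Y
  encode-injective {g , z} {h , w} pX pY e with ℕ.<-cmp g h
  ... | tri≈ _ refl _ = cong (g ,_) (ℕ.+-cancelˡ-≡ (offset g) _ _ e)
  ... | tri< g<h _ _ = contradiction e (ℕ.<⇒≢ (ℕ.<-≤-trans (before pX pY g<h) (ℕ.m≤m+n _ w)))
  ... | tri> _ _ h<g = contradiction (sym e) (ℕ.<⇒≢ (ℕ.<-≤-trans (before pY pX h<g) (ℕ.m≤m+n _ z)))

  encode-total : ∀ {X} → Point X → encode X < offset K + ε
  encode-total (inj₁ (g< , z<)) = ℕ.<-≤-trans (encode< z< g<) (ℕ.m≤m+n _ ε)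
  encode-total (inj₂ (refl , z<)) = ℕ.+-monoʳ-< (offset K) z<

  decode : ∀ {x} → x < offset K + ε → ∃ λ X → Point X × encode X ≡ x
  decode {x} x< with x <? offset K
  ... | no x≮ = (K , x ∸ offset K) , inj₂ (refl , ℕ.+-cancelˡ-< (offset K) _ _ (subst (_< offset K + ε) (sym e) x<)) , e
    where
    e : offset K + (x ∸ offset K) ≡ x
    e = ℕ.m+[n∸m]≡n (ℕ.≮⇒≥ x≮)
  ... | yes x<K = go K ℕ.≤-refl x<K
    where
    go : ∀ k → k ≤ K → x < offset k → ∃ λ X → Point X × encode X ≡ x
    go (suc g) g< x<g with x <? offset g
    ... | yes x<′ = go g (ℕ.<⇒≤ g<) x<′
    ... | no x≮ = (g , x ∸ offset g) , inj₁ (g< , ℕ.+-cancelˡ-< (offset g) _ _ (subst (_< offset g + 5 * t g) (sym e) x<g)) , e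
      where
      e : offset g + (x ∸ offset g) ≡ x
      e = ℕ.m+[n∸m]≡n (ℕ.≮⇒≥ x≮)

  inflate : DD (offset K + ε)
  inflate = go fullDesign
    where
    v = offset K + ε
    missed : ∀ {x} → x < v → ¬ (∀ {X} → Point X → encode X ≢ x)
    missed x< ∉x with X , pX , e ← decode x< = ∉x pX e
    image? : ∀ x → (∃ λ X → Point X × encode X ≡ x) ⊎ (∀ {X} → Point X → encode X ≢ x)
    image? x with x <? v
    ... | yes x< = inj₁ (decode x<)
    ... | no x≮ = inj₂ (λ { pX refl → x≮ (encode-total pX) })
    go : ∃ (C².Design fullDegree) → DD v
    go (ps , D) = _ , Design-map _≟²_ _≟_ encode Point encode-injective image? D S∈
      (λ {X} {Y} pX pY → cong (2 *_) (𝟙-cong (distinct? v (encode X) (encode Y)) (pointPair? X Y)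
        (λ (_ , _ , ne) → pX , pY , ne ∘ cong encode) (λ (_ , _ , ne) → encode-total pX , encode-total pY , ne ∘ encode-injective pX pY)))
      (λ {x} y ∉x → cong (2 *_) (𝟙-no (distinct? v x y) (λ (x< , _) → missed x< ∉x)))
      (λ x {y} ∉y → cong (2 *_) (𝟙-no (distinct? v x y) (λ (_ , y< , _) → missed y< ∉y)))
      where
      S∈ : ∀ {p X} → p ∈ ps → X ∈ proj₁ p → Point X
      S∈ {X = X} p∈ X∈ with C².support D p∈ X∈
      ... | Y , inj₁ le = proj₁ (2𝟙-pos (pointPair? X Y) le)
      ... | Y , inj₂ le = proj₁ (proj₂ (2𝟙-pos (pointPair? Y X) le))

-- The small designs

blk : ℕ → ℕ → ℕ → ℕ → ℕ → List ℕ
blk a b c d e = a ∷ b ∷ c ∷ d ∷ e ∷ []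

-- The base blocks b ~ c form a trade.  A single block b listed as (δ , b) forms a
-- trade with its translate by δ.  All of them were found by computer search.
infix 6 _~_
_~_ : List ℕ → List ℕ → List ℕ × List ℕ
b ~ c = b , c

-- The translate by 15, half the modulus, turns the adjacent `0 15` of the self-linked block into
-- `15 0`.
GDD-6 : GDD 6 30
GDD-6 = cyclic-GDD 30 6 (divides 5 refl) ((15 , blk 0 15 22 2 23) ∷ []) (
  blk 5 8 27 25 6 ~ blk 0 8 5 21 4 ∷ blk 5 0 14 10 7 ~ blk 19 14 0 4 3 ∷ []) refl

GDD-7 : GDD 7 35
GDD-7 = cyclic-GDD 35 7 (divides 5 refl) [] (
  blk 6 0 23 25 3 ~ blk 0 6 17 1 16 ∷ blk 0 3 30 1 5 ~ blk 26 15 3 0 11 ∷ blk 4 17 9 0 33 ~ blk 17 4 8 26 16 ∷ []) refl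

DD-15 : DD 15
DD-15 = GDD⇒DD (Explicit.explicit-GDD 15 15 (
  blk 13 9 11 1 10 ~ blk 1 11 6 14 2 ∷ blk 6 8 1 0 13 ~ blk 12 14 1 8 7 ∷ blk 5 4 8 1 9 ~ blk 8 4 12 2 6 ∷
  blk 4 13 6 5 11 ~ blk 10 14 6 13 12 ∷ blk 3 12 5 4 10 ~ blk 9 14 5 12 11 ∷ blk 7 10 12 2 11 ~ blk 2 12 0 14 3 ∷
  blk 10 13 8 5 7 ~ blk 5 8 3 14 6 ∷ blk 5 7 0 6 12 ~ blk 11 14 0 7 13 ∷ blk 11 0 8 5 2 ~ blk 1 0 11 4 12 ∷
  blk 2 11 4 3 9 ~ blk 8 14 4 11 10 ∷ blk 9 12 7 4 13 ~ blk 4 7 2 14 5 ∷ blk 1 10 3 2 8 ~ blk 7 14 3 10 9 ∷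
  blk 10 6 7 4 1 ~ blk 0 6 10 3 11 ∷ blk 0 9 2 1 7 ~ blk 13 14 2 9 8 ∷ blk 11 7 9 6 8 ~ blk 6 9 4 14 0 ∷
  blk 8 11 13 3 12 ~ blk 3 13 1 14 4 ∷ blk 12 1 9 6 3 ~ blk 2 1 12 5 13 ∷ blk 9 5 13 3 0 ~ blk 6 5 9 2 10 ∷
  blk 3 2 13 6 7 ~ blk 13 2 10 0 4 ∷ blk 0 10 5 14 1 ~ blk 12 8 10 0 9 ∷ blk 7 3 11 1 5 ~ blk 4 3 7 0 8 ∷ []) refl)

DD-16 : DD 16
DD-16 = GDD⇒DD (Explicit.explicit-GDD 16 16 (
  blk 1 3 0 11 6 ~ blk 15 6 11 5 9 ∷ blk 2 0 3 8 5 ~ blk 0 2 1 10 7 ∷ blk 3 1 2 9 4 ~ blk 13 4 9 7 11 ∷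
  blk 13 15 12 7 10 ~ blk 6 4 7 12 1 ∷ blk 15 13 14 5 8 ~ blk 12 14 13 6 11 ∷ blk 14 12 15 4 9 ~ blk 5 7 4 15 2 ∷
  blk 11 9 10 1 12 ~ blk 8 10 9 2 15 ∷ blk 1 8 5 11 7 ~ blk 8 1 12 2 14 ∷ blk 3 10 7 9 5 ~ blk 10 3 14 0 12 ∷
  blk 4 6 5 14 3 ~ blk 7 5 6 13 0 ∷ blk 10 8 11 0 13 ~ blk 4 13 0 14 2 ∷ blk 9 11 8 3 14 ~ blk 7 14 3 13 1 ∷
  blk 6 15 2 12 0 ~ blk 11 2 15 1 13 ∷ blk 2 11 6 8 4 ~ blk 15 0 1 4 8 ∷ blk 14 7 10 4 8 ~ blk 3 12 13 8 4 ∷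
  blk 0 15 14 11 7 ~ blk 5 10 11 14 2 ∷ blk 12 3 2 7 11 ~ blk 9 6 7 2 14 ∷ blk 10 5 4 1 13 ~ blk 6 9 8 13 1 ∷
  blk 7 8 9 12 0 ~ blk 8 7 6 3 15 ∷ blk 11 4 5 0 12 ~ blk 4 11 10 15 3 ∷ blk 5 12 1 15 3 ~ blk 9 0 13 3 15 ∷
  blk 14 1 0 5 9 ~ blk 2 13 12 9 5 ∷ blk 13 2 3 6 10 ~ blk 1 14 15 10 6 ∷ blk 0 9 4 10 6 ~ blk 12 5 8 6 10 ∷ []) refl)

DD-20 : DD 20
DD-20 = cyclic-DD∞ 19 [] (
  blk 0 4 7 15 1 ~ blk 3 15 7 5 6 ∷ blk 7 0 5 14 13 ~ blk 5 0 19 15 2 ∷ []) refl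

DD-21 : DD 21
DD-21 = cyclic-DD 21 [] (
  blk 5 16 12 15 0 ~ blk 0 15 6 4 7 ∷ blk 8 0 19 2 16 ~ blk 7 12 9 0 8 ∷ []) refl

-- A design developed over ℤ/(5 n - 1) and ∞, or over ℤ/(5 n + 1), has n base blocks, so for odd n
-- at least one is left unpaired and must trade with a translate of itself. Here ∞ = 24 stands
-- between 5 and 8, and the translate by 5 - 8 = 21 modulo 24 has `24 5` where the block has `5 24`.
DD-25 : DD 25
DD-25 = cyclic-DD∞ 24 ((21 , blk 0 5 24 8 23) ∷ []) (
  blk 3 4 13 0 17 ~ blk 11 8 22 17 0 ∷ blk 18 4 6 2 9 ~ blk 12 5 0 6 4 ∷ []) refl

DD-26 : DD 26
DD-26 = cyclic-DD 26 ((13 , blk 0 21 24 12 25) ∷ []) (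
  blk 0 9 5 15 11 ~ blk 5 9 2 17 16 ∷ blk 0 17 9 7 1 ~ blk 9 17 11 14 4 ∷ []) refl

DD-30 : DD 30
DD-30 = cyclic-DD∞ 29 [] (
  blk 19 8 3 23 6 ~ blk 5 1 0 6 23 ∷ blk 0 8 7 21 23 ~ blk 17 26 7 8 5 ∷ blk 24 6 9 16 28 ~ blk 4 0 29 9 6 ∷ []) refl

DD-31 : DD 31
DD-31 = cyclic-DD 31 [] (
  blk 8 26 6 7 28 ~ blk 29 0 16 26 8 ∷ blk 2 0 7 24 6 ~ blk 3 26 22 7 0 ∷ blk 20 16 23 0 6 ~ blk 6 0 25 26 9 ∷ []) refl

DD-35 : DD 35
DD-35 = cyclic-DD∞ 34 ((17 , blk 0 17 9 25 13) ∷ []) (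
  blk 7 2 5 20 0 ~ blk 20 5 34 30 17 ∷ blk 3 29 14 0 23 ~ blk 29 3 5 7 6 ∷ blk 0 7 1 22 6 ~ blk 11 27 17 7 0 ∷ []) refl

DD-36 : DD 36
DD-36 = cyclic-DD 36 ((18 , blk 0 27 35 12 30) ∷ []) (
  blk 17 11 1 3 21 ~ blk 2 25 0 1 11 ∷ blk 9 2 0 15 4 ~ blk 22 2 9 23 28 ∷ blk 7 24 16 4 21 ~ blk 0 24 7 3 32 ∷ []) refl

DD-40 : DD 40
DD-40 = cyclic-DD∞ 39 [] (
  blk 31 3 16 4 21 ~ blk 19 3 31 0 6 ∷ blk 4 8 9 0 7 ~ blk 33 16 0 9 2 ∷ blk 36 8 23 4 25 ~ blk 23 8 2 18 0 ∷
  blk 0 30 10 29 4 ~ blk 7 34 39 4 29 ∷ []) refl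

DD-41 : DD 41
DD-41 = cyclic-DD 41 [] (
  blk 0 4 3 32 2 ~ blk 30 36 4 0 9 ∷ blk 28 17 9 7 25 ~ blk 22 0 25 7 8 ∷ blk 5 40 29 22 9 ~ blk 9 22 3 0 34 ∷
  blk 9 1 27 15 22 ~ blk 25 0 27 1 37 ∷ []) refl

DD-45 : DD 45
DD-45 = cyclic-DD∞ 44 ((13 , blk 0 8 44 39 25) ∷ []) (
  blk 4 0 34 35 19 ~ blk 8 31 7 19 35 ∷ blk 31 0 29 9 35 ~ blk 29 0 8 6 18 ∷ blk 30 35 27 7 0 ~ blk 5 10 4 0 7 ∷
  blk 38 4 26 7 40 ~ blk 6 7 26 33 0 ∷ []) refl

DD-46 : DD 46
DD-46 = cyclic-DD 46 ((23 , blk 0 8 6 29 40) ∷ []) (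
  blk 38 25 1 0 2 ~ blk 9 1 25 6 31 ∷ blk 40 23 9 36 8 ~ blk 8 36 0 25 20 ∷ blk 0 16 36 7 4 ~ blk 41 14 4 7 8 ∷
  blk 14 40 5 33 29 ~ blk 0 7 2 33 5 ∷ []) refl

DD-50 : DD 50
DD-50 = cyclic-DD∞ 49 [] (
  blk 0 12 23 2 9 ~ blk 24 9 2 17 29 ∷ blk 0 16 3 5 19 ~ blk 40 32 12 16 0 ∷ blk 17 41 2 0 28 ~ blk 41 17 35 7 6 ∷
  blk 36 9 5 4 0 ~ blk 24 30 7 4 5 ∷ blk 45 9 39 0 31 ~ blk 2 8 49 39 9 ∷ []) refl

DD-51 : DD 51
DD-51 = cyclic-DD 51 [] (
  blk 7 16 3 0 39 ~ blk 9 37 3 16 8 ∷ blk 3 15 8 49 34 ~ blk 0 15 3 33 4 ∷ blk 37 2 26 35 9 ~ blk 0 6 26 2 3 ∷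
  blk 36 31 9 22 0 ~ blk 42 41 1 22 9 ∷ blk 41 0 17 25 11 ~ blk 0 41 43 6 4 ∷ []) refl

DD-55 : DD 55
DD-55 = cyclic-DD∞ 54 ((27 , blk 0 6 10 8 35) ∷ []) (
  blk 22 37 11 2 7 ~ blk 1 7 2 47 0 ∷ blk 12 28 0 37 15 ~ blk 0 28 54 4 22 ∷ blk 19 7 46 40 51 ~ blk 5 7 19 0 43 ∷
  blk 29 1 4 11 42 ~ blk 37 38 4 1 0 ∷ blk 0 33 9 23 46 ~ blk 43 1 23 9 20 ∷ []) refl

DD-56 : DD 56
DD-56 = cyclic-DD 56 ((28 , blk 0 23 6 14 42) ∷ []) (
  blk 0 32 17 44 45 ~ blk 32 0 19 9 25 ∷ blk 44 38 8 13 34 ~ blk 1 8 38 0 23 ∷ blk 0 12 22 4 17 ~ blk 17 4 38 49 46 ∷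
  blk 34 28 2 5 12 ~ blk 5 2 0 40 49 ∷ blk 40 42 0 4 15 ~ blk 21 1 2 4 0 ∷ []) refl

DD-60 : DD 60
DD-60 = cyclic-DD∞ 59 [] (
  blk 22 30 41 0 6 ~ blk 38 6 0 31 14 ∷ blk 14 57 9 43 0 ~ blk 9 57 2 7 51 ∷ blk 29 0 30 3 9 ~ blk 50 3 30 40 19 ∷
  blk 46 5 51 4 6 ~ blk 38 0 4 51 26 ∷ blk 2 28 9 5 0 ~ blk 28 2 15 43 25 ∷ blk 42 3 27 0 23 ~ blk 1 8 59 23 0 ∷ []) refl

DD-61 : DD 61
DD-61 = cyclic-DD 61 [] (
  blk 19 9 8 16 55 ~ blk 0 3 42 9 19 ∷ blk 8 0 28 52 45 ~ blk 35 28 0 1 50 ∷ blk 0 41 20 23 2 ~ blk 51 39 4 20 41 ∷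
  blk 35 50 3 30 7 ~ blk 56 52 3 50 0 ∷ blk 1 26 11 45 32 ~ blk 0 32 45 57 7 ∷ blk 57 9 44 1 0 ~ blk 32 6 30 0 1 ∷ []) refl

DD-65 : DD 65
DD-65 = cyclic-DD∞ 64 ((12 , blk 0 27 64 15 6) ∷ []) (
  blk 17 29 0 55 4 ~ blk 62 6 0 29 9 ∷ blk 21 7 0 44 40 ~ blk 22 11 44 0 5 ∷ blk 35 53 5 45 43 ~ blk 0 28 59 45 5 ∷
  blk 3 0 32 22 4 ~ blk 25 18 0 3 24 ∷ blk 2 32 16 17 28 ~ blk 48 32 2 19 0 ∷ blk 23 37 44 36 0 ~ blk 0 36 2 9 61 ∷ []) refl

DD-66 : DD 66
DD-66 = cyclic-DD 66 ((33 , blk 0 7 12 1 34) ∷ []) (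
  blk 1 0 51 8 62 ~ blk 15 8 51 18 52 ∷ blk 50 31 0 5 47 ~ blk 16 3 25 0 31 ∷ blk 47 57 36 0 49 ~ blk 10 1 18 0 36 ∷
  blk 4 29 52 0 58 ~ blk 39 0 52 24 42 ∷ blk 9 29 40 23 2 ~ blk 64 36 2 23 0 ∷
  blk 51 26 0 24 4 ~ blk 14 46 9 0 26 ∷ []) refl

DD-70 : DD 70
DD-70 = cyclic-DD∞ 69 [] (
  blk 0 38 42 28 9 ~ blk 38 0 6 18 33 ∷ blk 3 19 62 55 27 ~ blk 0 19 3 25 7 ∷ blk 8 57 34 0 2 ~ blk 30 56 57 8 55 ∷
  blk 17 0 28 30 22 ~ blk 4 62 3 0 17 ∷ blk 39 24 9 0 40 ~ blk 7 64 24 39 3 ∷ blk 14 0 5 48 23 ~ blk 7 18 28 5 0 ∷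
  blk 34 0 3 53 23 ~ blk 40 27 69 3 0 ∷ []) refl

DD-71 : DD 71
DD-71 = cyclic-DD 71 [] (
  blk 41 54 0 7 52 ~ blk 59 37 34 7 0 ∷ blk 2 23 0 24 6 ~ blk 56 0 23 58 3 ∷ blk 4 65 32 0 23 ~ blk 23 0 70 14 9 ∷
  blk 25 66 0 45 4 ~ blk 46 45 0 7 8 ∷ blk 0 56 2 28 12 ~ blk 12 28 41 6 59 ∷ blk 3 8 63 0 59 ~ blk 20 8 3 60 47 ∷
  blk 39 10 31 0 3 ~ blk 6 0 31 20 42 ∷ []) refl

DD-75 : DD 75
DD-75 = cyclic-DD∞ 74 ((32 , blk 0 55 74 23 64) ∷ []) (
  blk 50 8 38 0 1 ~ blk 0 38 45 57 11 ∷ blk 0 8 4 22 46 ~ blk 62 1 22 4 6 ∷ blk 31 26 0 51 4 ~ blk 11 0 26 43 3 ∷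
  blk 9 16 61 6 0 ~ blk 41 49 8 6 61 ∷ blk 6 0 60 35 17 ~ blk 0 6 69 5 54 ∷ blk 65 64 0 6 50 ~ blk 50 6 2 41 4 ∷
  blk 3 30 17 0 53 ~ blk 13 53 0 46 1 ∷ []) refl

DD-76 : DD 76
DD-76 = cyclic-DD 76 ((73 , blk 0 71 60 74 3) ∷ []) (
  blk 18 19 0 53 63 ~ blk 28 69 53 0 4 ∷ blk 19 15 4 51 1 ~ blk 61 29 4 15 0 ∷ blk 55 4 6 28 49 ~ blk 52 0 28 6 40 ∷
  blk 1 47 7 0 38 ~ blk 58 48 21 38 0 ∷ blk 45 20 0 8 37 ~ blk 0 20 33 12 7 ∷ blk 0 2 18 23 1 ~ blk 57 7 1 23 16 ∷
  blk 36 3 45 1 49 ~ blk 26 3 36 17 0 ∷ []) refl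

DD-80 : DD 80
DD-80 = cyclic-DD∞ 79 [] (
  blk 60 0 6 9 45 ~ blk 59 0 60 77 46 ∷ blk 34 63 5 2 45 ~ blk 7 0 4 5 63 ∷ blk 38 0 67 13 23 ~ blk 0 38 57 2 65 ∷
  blk 6 56 39 55 0 ~ blk 0 55 31 34 66 ∷ blk 5 19 0 49 56 ~ blk 49 0 75 71 9 ∷ blk 31 0 73 53 45 ~ blk 0 31 79 67 4 ∷
  blk 18 9 0 46 8 ~ blk 26 41 53 46 0 ∷ blk 22 11 17 0 32 ~ blk 32 0 44 34 7 ∷ []) refl

DD-81 : DD 81
DD-81 = cyclic-DD 81 [] (
  blk 30 23 65 0 6 ~ blk 6 0 73 62 59 ∷ blk 40 22 61 5 0 ~ blk 0 5 55 11 31 ∷ blk 52 0 54 79 8 ~ blk 5 49 66 8 79 ∷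
  blk 1 54 52 5 20 ~ blk 0 70 54 1 61 ∷ blk 51 72 38 0 3 ~ blk 55 3 0 17 69 ∷ blk 23 5 47 4 0 ~ blk 73 1 5 23 28 ∷
  blk 32 33 71 65 0 ~ blk 15 0 65 55 2 ∷ blk 1 9 20 16 61 ~ blk 9 1 57 0 45 ∷ []) refl

DD-85 : DD 85
DD-85 = cyclic-DD∞ 84 ((45 , blk 0 29 84 68 3) ∷ []) (
  blk 53 8 0 78 29 ~ blk 52 40 30 0 8 ∷ blk 0 58 22 41 2 ~ blk 34 48 58 0 64 ∷ blk 0 33 74 14 37 ~ blk 14 74 5 1 71 ∷
  blk 5 0 57 8 6 ~ blk 71 0 5 56 12 ∷ blk 0 32 75 9 7 ~ blk 70 57 40 7 9 ∷ blk 21 6 59 55 52 ~ blk 42 62 6 21 0 ∷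
  blk 72 34 5 0 47 ~ blk 16 0 5 61 4 ∷ blk 0 55 20 9 1 ~ blk 9 20 2 19 46 ∷ []) refl

DD-86 : DD 86
DD-86 = cyclic-DD 86 ((43 , blk 0 67 24 72 64) ∷ []) (
  blk 3 2 28 0 15 ~ blk 55 8 2 3 69 ∷ blk 61 2 7 82 62 ~ blk 0 20 82 7 24 ∷ blk 0 42 8 65 53 ~ blk 23 77 42 0 26 ∷
  blk 2 52 31 48 70 ~ blk 24 34 52 2 0 ∷ blk 0 41 63 32 2 ~ blk 42 2 32 5 25 ∷ blk 0 16 4 53 61 ~ blk 53 4 18 3 10 ∷
  blk 36 63 76 6 21 ~ blk 17 0 6 76 48 ∷ blk 65 14 9 0 47 ~ blk 76 0 9 50 2 ∷ []) refl

DD-90 : DD 90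
DD-90 = cyclic-DD∞ 89 [] (
  blk 0 5 45 55 42 ~ blk 33 34 45 5 21 ∷ blk 35 5 62 0 79 ~ blk 73 36 0 62 64 ∷ blk 64 4 7 0 19 ~ blk 48 0 7 6 71 ∷
  blk 44 1 68 54 3 ~ blk 68 1 47 75 0 ∷ blk 83 5 23 45 64 ~ blk 56 23 5 0 77 ∷ blk 0 8 87 1 81 ~ blk 46 8 0 4 17 ∷
  blk 5 2 35 39 71 ~ blk 26 71 39 69 0 ∷ blk 0 58 52 31 36 ~ blk 58 0 39 25 8 ∷
  blk 0 63 78 9 23 ~ blk 63 0 89 69 35 ∷ []) refl

DD-91 : DD 91
DD-91 = cyclic-DD 91 [] (
  blk 5 1 8 16 35 ~ blk 53 1 5 17 0 ∷ blk 20 5 68 37 2 ~ blk 2 37 30 0 22 ∷ blk 29 87 26 5 6 ~ blk 38 60 5 26 0 ∷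
  blk 71 14 77 4 0 ~ blk 54 62 0 4 3 ∷ blk 6 76 0 50 23 ~ blk 50 0 14 75 66 ∷ blk 38 27 9 0 66 ~ blk 87 40 73 9 27 ∷
  blk 23 49 29 0 7 ~ blk 56 19 24 7 0 ∷ blk 54 6 0 52 78 ~ blk 76 4 14 6 54 ∷ blk 40 0 49 5 51 ~ blk 83 15 4 51 5 ∷ []) refl

DD-95 : DD 95
DD-95 = cyclic-DD∞ 94 ((47 , blk 0 42 89 37 12) ∷ []) (
  blk 4 17 0 60 67 ~ blk 41 88 53 17 4 ∷ blk 0 16 1 60 85 ~ blk 25 46 60 1 38 ∷ blk 0 74 79 9 2 ~ blk 1 92 74 0 31 ∷
  blk 36 6 0 39 67 ~ blk 9 49 39 0 28 ∷ blk 60 78 0 32 6 ~ blk 90 58 94 0 78 ∷ blk 79 0 26 3 8 ~ blk 26 0 36 4 92 ∷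
  blk 14 1 0 55 7 ~ blk 30 7 55 82 41 ∷ blk 4 0 65 54 86 ~ blk 8 46 85 54 65 ∷
  blk 0 38 9 52 53 ~ blk 12 9 38 36 87 ∷ []) refl

DD-96 : DD 96
DD-96 = cyclic-DD 96 ((48 , blk 0 25 79 62 14) ∷ []) (
  blk 80 2 3 64 0 ~ blk 0 64 66 35 39 ∷ blk 49 0 90 6 5 ~ blk 35 6 90 15 83 ∷ blk 74 0 27 3 33 ~ blk 69 7 54 33 3 ∷
  blk 29 2 63 85 7 ~ blk 18 54 0 2 29 ∷ blk 5 86 3 77 0 ~ blk 50 43 86 5 4 ∷ blk 0 21 59 49 7 ~ blk 44 4 32 21 0 ∷
  blk 13 8 59 0 53 ~ blk 28 67 36 0 59 ∷ blk 9 0 82 10 86 ~ blk 73 93 0 9 35 ∷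
  blk 83 33 0 7 50 ~ blk 72 18 88 0 33 ∷ []) refl

DD-100 : DD 100
DD-100 = cyclic-DD∞ 99 [] (
  blk 71 6 94 90 5 ~ blk 54 0 48 5 90 ∷ blk 0 71 39 61 74 ~ blk 8 74 61 83 7 ∷ blk 79 7 0 38 26 ~ blk 60 12 0 7 76 ∷
  blk 82 26 85 7 4 ~ blk 45 55 7 85 0 ∷ blk 2 19 91 78 57 ~ blk 41 39 19 2 0 ∷ blk 38 33 75 9 1 ~ blk 73 79 9 75 0 ∷
  blk 0 25 56 7 11 ~ blk 90 38 99 7 56 ∷ blk 36 88 0 63 37 ~ blk 0 88 4 32 6 ∷ blk 42 86 91 71 0 ~ blk 30 87 3 0 71 ∷
  blk 55 8 49 89 20 ~ blk 0 8 55 9 91 ∷ []) refl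

DD-101 : DD 101
DD-101 = cyclic-DD 101 [] (
  blk 0 48 9 93 98 ~ blk 31 88 9 48 38 ∷ blk 2 60 88 0 81 ~ blk 1 57 0 88 64 ∷
  blk 0 27 60 40 12 ~ blk 28 40 60 7 83 ∷ blk 0 26 3 44 62 ~ blk 26 0 19 82 83 ∷
  blk 16 6 0 42 46 ~ blk 34 93 29 0 6 ∷ blk 5 26 0 15 1 ~ blk 16 82 26 5 76 ∷ blk 36 4 58 0 74 ~ blk 49 72 74 0 83 ∷
  blk 82 86 0 34 32 ~ blk 3 9 77 34 0 ∷ blk 0 3 33 20 72 ~ blk 84 44 72 20 86 ∷
  blk 86 20 91 55 1 ~ blk 17 1 55 9 0 ∷ []) refl

DD-105 : DD 105
DD-105 = cyclic-DD∞ 104 ((86 , blk 0 59 77 18 84) ∷ []) (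
  blk 1 82 31 78 12 ~ blk 0 82 1 52 15 ∷ blk 3 73 97 57 0 ~ blk 73 3 81 39 6 ∷ blk 72 9 1 60 0 ~ blk 15 94 55 9 72 ∷
  blk 0 1 22 13 21 ~ blk 8 99 22 1 84 ∷ blk 0 4 73 53 13 ~ blk 14 82 4 0 46 ∷ blk 5 54 0 2 40 ~ blk 40 2 44 56 28 ∷
  blk 48 31 16 5 91 ~ blk 81 0 104 5 16 ∷ blk 0 67 6 56 9 ~ blk 85 6 67 87 54 ∷ blk 7 76 2 0 17 ~ blk 46 65 94 17 0 ∷
  blk 0 80 55 31 36 ~ blk 8 6 80 0 41 ∷ []) refl

DD-106 : DD 106
DD-106 = cyclic-DD 106 ((53 , blk 0 29 79 26 67) ∷ []) (
  blk 3 5 74 9 38 ~ blk 5 3 0 82 98 ∷ blk 54 76 21 6 7 ~ blk 6 21 0 45 94 ∷ blk 3 26 18 58 90 ~ blk 0 46 65 26 3 ∷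
  blk 32 52 0 80 28 ~ blk 6 0 52 43 66 ∷ blk 0 91 75 3 84 ~ blk 84 3 20 16 59 ∷
  blk 45 1 96 0 97 ~ blk 73 1 45 57 56 ∷ blk 32 89 79 0 4 ~ blk 89 32 51 3 14 ∷ blk 30 0 93 8 48 ~ blk 7 21 93 0 57 ∷
  blk 84 61 2 0 8 ~ blk 92 19 99 2 61 ∷ blk 5 0 10 12 76 ~ blk 19 46 81 0 5 ∷ []) refl

DD-110 : DD 110
DD-110 = cyclic-DD∞ 109 [] (
  blk 0 5 45 56 22 ~ blk 66 56 45 94 27 ∷ blk 0 32 48 55 73 ~ blk 1 32 0 84 61 ∷
  blk 7 64 0 53 103 ~ blk 52 2 64 7 60 ∷ blk 16 0 50 37 78 ~ blk 7 2 37 50 81 ∷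
  blk 0 21 19 3 68 ~ blk 65 48 22 68 3 ∷ blk 14 54 77 0 24 ~ blk 24 0 109 84 57 ∷
  blk 59 11 26 4 37 ~ blk 99 0 4 26 6 ∷ blk 0 9 68 1 72 ~ blk 80 41 1 68 37 ∷ blk 39 73 2 97 15 ~ blk 8 0 43 15 97 ∷
  blk 1 15 40 21 0 ~ blk 3 21 40 11 12 ∷ blk 44 38 35 2 0 ~ blk 5 17 34 0 2 ∷ []) refl

DD-111 : DD 111
DD-111 = cyclic-DD 111 [] (
  blk 28 41 5 82 51 ~ blk 11 0 50 51 82 ∷ blk 65 97 67 29 1 ~ blk 17 1 29 54 0 ∷
  blk 15 6 0 74 71 ~ blk 32 45 12 0 6 ∷ blk 104 8 20 30 96 ~ blk 2 0 93 20 8 ∷ blk 9 71 0 44 5 ~ blk 35 71 9 82 87 ∷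
  blk 31 94 0 92 7 ~ blk 76 83 32 92 0 ∷ blk 69 0 9 55 52 ~ blk 55 9 42 59 1 ∷ blk 42 1 37 91 0 ~ blk 8 1 42 31 35 ∷
  blk 5 53 34 0 101 ~ blk 53 5 86 64 43 ∷ blk 25 0 55 86 39 ~ blk 55 0 8 97 84 ∷
  blk 7 21 3 65 90 ~ blk 0 3 21 22 24 ∷ []) refl

DD-115 : DD 115
DD-115 = cyclic-DD∞ 114 ((29 , blk 0 103 114 74 33) ∷ []) (
  blk 0 93 52 80 14 ~ blk 3 93 0 45 10 ∷ blk 2 32 71 54 15 ~ blk 0 59 32 2 31 ∷ blk 46 26 88 12 0 ~ blk 8 0 12 63 5 ∷
  blk 51 26 95 67 7 ~ blk 103 0 83 7 67 ∷ blk 63 104 10 9 27 ~ blk 27 9 4 86 0 ∷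
  blk 12 0 48 15 27 ~ blk 48 0 5 50 6 ∷ blk 0 16 8 30 55 ~ blk 21 34 30 8 83 ∷ blk 0 56 46 6 83 ~ blk 16 33 9 56 0 ∷
  blk 43 14 68 0 79 ~ blk 90 11 5 0 68 ∷ blk 96 64 15 49 58 ~ blk 0 64 96 3 1 ∷
  blk 15 25 65 0 23 ~ blk 94 23 0 84 4 ∷ []) refl

DD-116 : DD 116
DD-116 = cyclic-DD 116 ((58 , blk 0 41 26 84 53) ∷ []) (
  blk 50 21 22 6 5 ~ blk 112 101 5 6 0 ∷ blk 0 94 24 53 30 ~ blk 55 71 37 94 0 ∷ blk 90 0 25 8 4 ~ blk 8 25 27 7 89 ∷
  blk 0 68 46 80 20 ~ blk 20 80 96 1 34 ∷ blk 6 38 0 89 17 ~ blk 0 38 92 48 19 ∷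
  blk 50 25 53 39 0 ~ blk 93 81 0 39 88 ∷ blk 47 45 92 83 0 ~ blk 58 61 0 83 9 ∷
  blk 30 3 87 80 0 ~ blk 87 3 47 52 11 ∷ blk 75 19 32 37 6 ~ blk 9 0 74 6 37 ∷ blk 0 2 52 67 108 ~ blk 57 14 10 2 0 ∷
  blk 30 57 0 7 70 ~ blk 105 81 20 7 0 ∷ []) refl

DD-120 : DD 120
DD-120 = cyclic-DD∞ 119 [] (
  blk 13 28 0 51 93 ~ blk 5 72 0 28 36 ∷ blk 8 33 4 86 93 ~ blk 30 0 119 4 33 ∷
  blk 20 61 0 39 53 ~ blk 39 0 34 63 6 ∷ blk 3 102 21 79 0 ~ blk 45 94 52 0 79 ∷
  blk 22 6 77 65 0 ~ blk 6 22 74 11 61 ∷ blk 0 4 74 68 109 ~ blk 110 92 4 0 52 ∷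
  blk 31 81 6 28 19 ~ blk 0 60 37 6 81 ∷ blk 0 37 94 5 77 ~ blk 37 0 103 2 1 ∷
  blk 58 61 12 44 26 ~ blk 2 50 0 12 61 ∷ blk 0 24 43 69 36 ~ blk 24 0 9 35 56 ∷
  blk 66 56 32 1 47 ~ blk 74 47 1 0 63 ∷ blk 29 21 0 2 22 ~ blk 91 111 43 2 0 ∷ []) refl

DD-121 : DD 121
DD-121 = cyclic-DD 121 [] (
  blk 20 107 0 50 4 ~ blk 4 50 30 18 53 ∷ blk 11 27 4 96 0 ~ blk 85 0 96 26 63 ∷
  blk 50 84 79 0 48 ~ blk 94 6 0 79 71 ∷ blk 10 68 14 88 0 ~ blk 78 5 0 88 1 ∷
  blk 44 63 51 0 73 ~ blk 27 38 0 51 59 ∷ blk 97 67 60 80 3 ~ blk 0 93 72 3 80 ∷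
  blk 0 110 38 6 61 ~ blk 6 38 66 88 53 ∷ blk 3 0 45 105 5 ~ blk 87 86 5 105 58 ∷
  blk 14 15 0 96 90 ~ blk 60 0 15 99 69 ∷ blk 0 5 68 12 2 ~ blk 21 87 12 68 99 ∷
  blk 55 80 2 0 54 ~ blk 26 9 18 54 0 ∷ blk 6 86 44 68 103 ~ blk 0 30 70 86 6 ∷ []) refl

DD-125 : DD 125
DD-125 = cyclic-DD∞ 124 ((62 , blk 0 92 118 56 85) ∷ []) (
  blk 4 54 0 19 56 ~ blk 1 19 0 7 20 ∷ blk 57 3 47 97 5 ~ blk 16 19 0 5 97 ∷ blk 41 66 0 84 15 ~ blk 39 0 66 61 3 ∷
  blk 6 0 96 36 44 ~ blk 0 6 52 39 43 ∷ blk 0 109 34 9 74 ~ blk 99 26 11 9 34 ∷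
  blk 28 96 49 7 0 ~ blk 62 92 119 7 49 ∷ blk 21 69 78 0 47 ~ blk 18 10 0 78 7 ∷
  blk 38 61 4 24 0 ~ blk 50 88 79 61 38 ∷ blk 79 8 0 32 49 ~ blk 28 69 124 8 79 ∷
  blk 1 49 70 0 11 ~ blk 49 1 5 65 96 ∷ blk 2 69 82 3 104 ~ blk 51 3 82 65 0 ∷
  blk 0 5 100 84 98 ~ blk 5 0 17 33 104 ∷ []) refl

DD-126 : DD 126
DD-126 = cyclic-DD 126 ((63 , blk 0 42 93 79 16) ∷ []) (
  blk 18 90 42 0 49 ~ blk 24 23 70 0 42 ∷ blk 1 45 68 90 0 ~ blk 68 45 28 98 49 ∷
  blk 110 66 9 0 80 ~ blk 61 34 0 9 56 ∷ blk 7 55 5 24 17 ~ blk 55 7 95 0 12 ∷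
  blk 56 67 62 9 30 ~ blk 97 124 0 30 9 ∷ blk 18 91 10 78 93 ~ blk 6 2 93 78 0 ∷
  blk 4 36 56 70 42 ~ blk 56 36 0 25 91 ∷ blk 87 42 69 0 97 ~ blk 49 8 0 69 82 ∷
  blk 20 8 59 43 37 ~ blk 0 44 5 59 8 ∷ blk 86 46 64 0 54 ~ blk 0 64 34 101 1 ∷ blk 13 4 0 1 110 ~ blk 69 0 4 7 50 ∷
  blk 14 27 3 119 55 ~ blk 3 27 68 0 53 ∷ []) refl

DD-130 : DD 130
DD-130 = cyclic-DD∞ 129 [] (
  blk 32 16 5 62 50 ~ blk 48 119 0 5 16 ∷ blk 66 29 6 76 21 ~ blk 34 76 6 0 3 ∷
  blk 8 75 20 0 115 ~ blk 51 81 55 75 8 ∷ blk 74 93 13 0 51 ~ blk 93 74 30 47 6 ∷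
  blk 7 119 84 3 36 ~ blk 36 3 0 47 68 ∷ blk 5 62 121 0 96 ~ blk 21 1 62 5 94 ∷ blk 84 9 7 67 106 ~ blk 65 7 9 0 87 ∷
  blk 39 57 0 80 52 ~ blk 15 104 129 80 0 ∷ blk 18 0 7 35 44 ~ blk 51 7 0 91 90 ∷
  blk 79 3 26 27 5 ~ blk 21 0 3 79 69 ∷ blk 37 0 99 33 64 ~ blk 29 0 37 27 43 ∷
  blk 54 66 0 25 75 ~ blk 84 37 75 25 6 ∷ blk 0 115 31 5 6 ~ blk 1 115 0 29 36 ∷ []) refl

DD-131 : DD 131
DD-131 = cyclic-DD 131 [] (
  blk 21 18 30 55 6 ~ blk 8 0 55 30 76 ∷ blk 95 96 0 16 28 ~ blk 0 96 70 18 4 ∷ blk 0 43 8 9 108 ~ blk 1 82 7 43 0 ∷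
  blk 69 4 27 41 124 ~ blk 27 4 21 0 34 ∷ blk 91 86 0 76 5 ~ blk 123 99 0 86 58 ∷
  blk 0 73 2 24 93 ~ blk 122 93 24 16 12 ∷ blk 89 95 42 73 28 ~ blk 7 0 69 42 95 ∷
  blk 1 27 99 40 81 ~ blk 0 38 99 27 29 ∷ blk 64 0 18 75 74 ~ blk 20 44 72 18 0 ∷
  blk 0 27 46 44 5 ~ blk 65 13 46 27 114 ∷ blk 0 3 32 80 51 ~ blk 93 3 0 84 47 ∷
  blk 38 21 5 8 28 ~ blk 5 21 0 15 78 ∷ blk 60 40 0 4 71 ~ blk 25 0 40 114 83 ∷ []) refl

DD-135 : DD 135
DD-135 = cyclic-DD∞ 134 ((67 , blk 0 57 89 76 9) ∷ []) (
  blk 56 33 45 1 68 ~ blk 98 0 134 45 33 ∷ blk 3 0 39 46 33 ~ blk 0 3 97 111 80 ∷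
  blk 8 29 7 0 131 ~ blk 44 76 113 29 8 ∷ blk 1 0 7 96 3 ~ blk 54 69 3 96 20 ∷
  blk 53 82 0 10 106 ~ blk 96 33 97 0 82 ∷ blk 82 8 0 48 78 ~ blk 78 48 58 17 18 ∷
  blk 6 22 27 83 17 ~ blk 64 84 0 22 6 ∷ blk 12 58 56 76 7 ~ blk 25 76 56 0 84 ∷
  blk 33 44 9 48 0 ~ blk 31 4 86 9 44 ∷ blk 61 2 25 49 43 ~ blk 68 0 99 49 25 ∷
  blk 0 25 120 8 51 ~ blk 100 21 25 0 63 ∷ blk 55 0 9 28 26 ~ blk 99 28 9 81 115 ∷
  blk 16 7 87 0 61 ~ blk 61 0 74 88 2 ∷ []) refl

DD-136 : DD 136
DD-136 = cyclic-DD 136 ((68 , blk 0 22 90 29 134) ∷ []) (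
  blk 12 40 67 4 22 ~ blk 4 67 0 87 30 ∷ blk 90 41 1 7 0 ~ blk 23 41 90 121 78 ∷
  blk 48 6 86 110 80 ~ blk 0 86 6 125 3 ∷ blk 87 58 37 10 0 ~ blk 7 0 10 105 40 ∷
  blk 67 16 0 39 7 ~ blk 108 39 0 64 62 ∷ blk 0 84 8 72 50 ~ blk 72 8 85 9 25 ∷
  blk 0 36 15 40 31 ~ blk 35 40 15 29 67 ∷ blk 65 51 85 77 0 ~ blk 80 14 23 0 77 ∷
  blk 2 128 4 95 13 ~ blk 13 95 42 47 0 ∷ blk 0 61 35 46 103 ~ blk 78 26 123 61 0 ∷
  blk 44 20 0 4 65 ~ blk 103 4 0 48 19 ∷ blk 79 1 0 66 51 ~ blk 19 36 55 0 1 ∷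
  blk 46 93 27 68 70 ~ blk 27 93 35 5 0 ∷ []) refl

DD-140 : DD 140
DD-140 = cyclic-DD∞ 139 [] (
  blk 99 25 5 0 43 ~ blk 96 15 45 43 0 ∷ blk 3 8 9 0 41 ~ blk 123 82 8 3 59 ∷
  blk 59 78 86 0 49 ~ blk 78 59 21 28 10 ∷ blk 54 3 24 7 115 ~ blk 7 24 25 40 0 ∷
  blk 0 57 70 85 81 ~ blk 31 60 39 85 70 ∷ blk 67 97 89 0 35 ~ blk 35 0 47 3 106 ∷
  blk 67 6 73 0 54 ~ blk 129 0 73 2 36 ∷ blk 20 55 75 3 82 ~ blk 97 0 75 55 51 ∷
  blk 1 79 110 0 53 ~ blk 98 16 27 53 0 ∷ blk 14 12 0 76 3 ~ blk 62 76 0 99 34 ∷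
  blk 0 110 40 76 98 ~ blk 76 40 17 96 7 ∷ blk 41 3 50 28 67 ~ blk 50 3 16 0 2 ∷
  blk 94 39 0 48 4 ~ blk 69 43 139 4 48 ∷ blk 28 87 0 21 44 ~ blk 55 6 0 87 69 ∷ []) refl

DD-141 : DD 141
DD-141 = cyclic-DD 141 [] (
  blk 52 6 48 33 1 ~ blk 117 49 1 33 0 ∷ blk 57 0 98 55 38 ~ blk 52 98 0 75 16 ∷
  blk 0 85 8 19 77 ~ blk 81 6 19 8 39 ∷ blk 76 0 29 49 39 ~ blk 112 87 49 29 8 ∷ blk 53 113 8 0 9 ~ blk 30 7 0 8 34 ∷
  blk 71 1 46 90 13 ~ blk 13 90 99 3 0 ∷ blk 5 54 39 19 106 ~ blk 0 63 36 39 54 ∷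
  blk 0 17 93 15 87 ~ blk 46 11 17 0 72 ∷ blk 22 91 0 70 129 ~ blk 85 18 59 0 91 ∷
  blk 0 74 99 60 71 ~ blk 74 0 96 35 78 ∷ blk 50 0 57 62 90 ~ blk 13 57 0 29 23 ∷
  blk 36 0 31 53 66 ~ blk 26 91 31 0 2 ∷ blk 0 30 109 21 14 ~ blk 61 85 12 30 0 ∷
  blk 97 41 44 4 3 ~ blk 4 44 65 0 51 ∷ []) refl

DD-145 : DD 145
DD-145 = cyclic-DD∞ 144 ((100 , blk 0 62 144 106 42) ∷ []) (
  blk 30 0 16 7 43 ~ blk 76 31 16 0 35 ∷ blk 0 77 45 52 2 ~ blk 2 52 28 22 123 ∷
  blk 9 31 105 69 0 ~ blk 83 31 9 128 94 ∷ blk 69 0 51 34 89 ~ blk 51 0 99 41 55 ∷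
  blk 29 123 119 90 3 ~ blk 65 3 90 0 9 ∷ blk 13 3 24 57 45 ~ blk 116 3 13 94 0 ∷
  blk 63 39 28 42 23 ~ blk 13 42 28 0 8 ∷ blk 79 8 110 33 73 ~ blk 8 79 7 91 0 ∷
  blk 8 134 0 23 66 ~ blk 134 8 16 25 98 ∷ blk 85 39 0 18 1 ~ blk 0 39 103 76 6 ∷
  blk 0 5 97 32 69 ~ blk 2 120 80 69 32 ∷ blk 0 89 88 30 1 ~ blk 79 1 30 92 35 ∷
  blk 2 4 72 0 53 ~ blk 100 68 4 2 85 ∷ blk 12 0 36 59 52 ~ blk 95 98 0 12 117 ∷ []) refl

DD-146 : DD 146
DD-146 = cyclic-DD 146 ((73 , blk 0 73 46 58 2) ∷ []) (
  blk 0 48 71 28 85 ~ blk 82 38 63 28 71 ∷ blk 16 99 92 51 5 ~ blk 5 51 55 137 0 ∷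
  blk 126 71 54 46 6 ~ blk 54 71 90 0 22 ∷ blk 9 62 24 94 0 ~ blk 29 0 94 68 84 ∷
  blk 26 90 32 1 64 ~ blk 1 32 0 128 72 ∷ blk 15 128 44 16 3 ~ blk 52 102 3 16 0 ∷
  blk 119 0 3 33 2 ~ blk 50 78 38 0 119 ∷ blk 8 34 0 101 59 ~ blk 0 34 53 88 95 ∷
  blk 21 0 45 43 99 ~ blk 5 45 0 23 41 ∷ blk 3 77 54 115 18 ~ blk 0 77 3 8 13 ∷ blk 0 6 86 70 79 ~ blk 21 6 0 17 4 ∷
  blk 22 87 59 98 69 ~ blk 43 122 98 59 0 ∷ blk 0 1 100 63 21 ~ blk 21 63 70 90 33 ∷
  blk 9 23 3 0 116 ~ blk 111 23 9 89 54 ∷ []) refl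

DD-150 : DD 150
DD-150 = cyclic-DD∞ 149 [] (
  blk 32 1 46 121 112 ~ blk 46 1 77 56 0 ∷ blk 47 63 43 132 19 ~ blk 3 26 43 63 0 ∷
  blk 51 0 4 46 120 ~ blk 17 32 61 0 51 ∷ blk 0 39 23 1 48 ~ blk 136 65 108 39 0 ∷
  blk 0 134 62 3 84 ~ blk 134 0 46 12 99 ∷ blk 49 0 6 34 7 ~ blk 97 117 6 0 63 ∷
  blk 51 75 0 86 67 ~ blk 47 84 0 75 68 ∷ blk 91 8 47 87 6 ~ blk 6 87 131 76 0 ∷
  blk 99 79 21 42 0 ~ blk 95 0 42 56 2 ∷ blk 0 7 131 55 65 ~ blk 12 65 55 90 63 ∷
  blk 102 0 97 30 79 ~ blk 1 30 97 62 7 ∷ blk 48 0 8 11 93 ~ blk 85 8 0 135 12 ∷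
  blk 3 116 30 0 138 ~ blk 61 49 13 0 30 ∷ blk 66 59 92 0 97 ~ blk 0 92 149 91 2 ∷
  blk 0 36 49 19 24 ~ blk 81 49 36 3 90 ∷ []) refl

DD-151 : DD 151
DD-151 = cyclic-DD 151 [] (
  blk 32 34 0 75 135 ~ blk 21 17 3 34 32 ∷ blk 39 125 2 96 1 ~ blk 0 47 6 1 96 ∷
  blk 91 0 45 74 3 ~ blk 48 102 93 3 74 ∷ blk 0 91 23 32 76 ~ blk 23 91 8 73 10 ∷
  blk 73 51 110 98 12 ~ blk 0 51 73 4 38 ∷ blk 20 66 3 41 55 ~ blk 87 3 66 0 107 ∷
  blk 0 5 94 115 12 ~ blk 12 115 61 93 60 ∷ blk 43 33 3 23 0 ~ blk 77 33 43 104 69 ∷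
  blk 29 2 3 42 36 ~ blk 0 106 36 42 11 ∷ blk 5 127 9 0 67 ~ blk 37 67 0 59 55 ∷
  blk 36 9 25 102 64 ~ blk 0 25 9 109 89 ∷ blk 0 92 19 43 73 ~ blk 83 95 1 43 19 ∷
  blk 68 0 37 99 14 ~ blk 4 148 20 14 99 ∷ blk 60 2 7 79 10 ~ blk 39 79 7 0 137 ∷
  blk 116 86 35 11 9 ~ blk 0 78 35 86 50 ∷ []) refl

DD-155 : DD 155
DD-155 = cyclic-DD∞ 154 ((77 , blk 0 108 142 81 4) ∷ []) (
  blk 0 46 53 98 138 ~ blk 66 53 46 42 6 ∷ blk 45 20 2 78 130 ~ blk 51 0 2 20 67 ∷
  blk 43 82 6 66 143 ~ blk 65 82 43 88 0 ∷ blk 3 4 75 66 0 ~ blk 44 36 4 3 100 ∷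
  blk 148 6 15 0 135 ~ blk 135 0 7 89 5 ∷ blk 80 13 2 133 12 ~ blk 0 116 2 13 57 ∷
  blk 53 36 111 26 0 ~ blk 91 77 36 53 3 ∷ blk 56 0 95 3 50 ~ blk 18 0 56 54 91 ∷
  blk 80 61 0 126 112 ~ blk 7 99 29 126 0 ∷ blk 0 86 90 36 15 ~ blk 37 72 5 86 0 ∷
  blk 0 15 63 106 84 ~ blk 79 3 15 0 109 ∷ blk 0 83 48 25 28 ~ blk 93 83 0 107 41 ∷
  blk 21 145 9 29 0 ~ blk 81 123 0 29 1 ∷ blk 8 132 3 37 45 ~ blk 105 132 8 0 19 ∷
  blk 128 44 0 54 5 ~ blk 31 95 154 0 44 ∷ []) refl

DD-156 : DD 156
DD-156 = cyclic-DD 156 ((78 , blk 0 21 99 53 17) ∷ []) (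
  blk 1 0 26 42 94 ~ blk 93 108 7 0 1 ∷ blk 45 5 28 0 126 ~ blk 113 42 0 28 52 ∷
  blk 42 44 13 0 63 ~ blk 24 110 124 0 13 ∷ blk 1 0 83 54 4 ~ blk 120 77 4 54 105 ∷
  blk 0 61 137 96 74 ~ blk 62 29 6 96 137 ∷ blk 5 1 63 30 102 ~ blk 100 0 1 5 135 ∷
  blk 0 86 73 84 89 ~ blk 91 42 84 73 39 ∷ blk 32 62 54 76 0 ~ blk 54 62 1 122 46 ∷
  blk 0 92 139 20 27 ~ blk 94 69 92 0 66 ∷ blk 3 36 9 145 108 ~ blk 127 90 0 9 36 ∷
  blk 36 91 20 38 0 ~ blk 138 106 38 20 8 ∷ blk 0 39 76 82 30 ~ blk 6 39 0 18 54 ∷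
  blk 125 9 0 78 20 ~ blk 0 9 146 96 69 ∷ blk 49 83 18 6 95 ~ blk 83 49 68 44 0 ∷
  blk 58 7 17 125 66 ~ blk 0 92 116 17 7 ∷ []) refl

DD-160 : DD 160
DD-160 = cyclic-DD∞ 159 [] (
  blk 53 0 79 76 140 ~ blk 6 79 0 71 59 ∷ blk 0 46 4 35 24 ~ blk 4 46 41 66 98 ∷
  blk 2 0 147 7 3 ~ blk 0 2 83 50 127 ∷ blk 0 128 73 33 69 ~ blk 3 24 70 69 33 ∷
  blk 9 143 145 0 93 ~ blk 36 93 0 50 12 ∷ blk 74 39 0 23 8 ~ blk 1 0 39 109 131 ∷
  blk 0 71 98 88 18 ~ blk 24 98 71 129 99 ∷ blk 68 8 0 63 97 ~ blk 1 8 68 92 77 ∷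
  blk 34 2 97 72 144 ~ blk 2 34 0 131 12 ∷ blk 54 7 97 146 0 ~ blk 0 146 41 27 83 ∷
  blk 0 21 80 11 132 ~ blk 6 78 94 21 0 ∷ blk 0 28 96 113 61 ~ blk 60 14 113 96 5 ∷
  blk 0 26 101 60 44 ~ blk 85 29 26 0 141 ∷ blk 0 51 6 55 11 ~ blk 120 47 159 55 6 ∷
  blk 37 43 0 30 78 ~ blk 21 24 0 43 141 ∷ blk 45 19 122 0 58 ~ blk 33 58 0 87 10 ∷ []) refl

DD-161 : DD 161
DD-161 = cyclic-DD 161 [] (
  blk 36 104 2 0 132 ~ blk 0 2 137 71 42 ∷ blk 94 127 78 0 89 ~ blk 44 37 16 89 0 ∷
  blk 153 99 36 40 84 ~ blk 0 36 99 54 3 ∷ blk 55 5 75 3 71 ~ blk 71 3 0 149 25 ∷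
  blk 36 6 30 33 53 ~ blk 0 139 10 53 33 ∷ blk 0 51 125 64 72 ~ blk 51 0 13 56 108 ∷
  blk 90 19 29 9 79 ~ blk 135 0 79 9 86 ∷ blk 46 0 63 5 91 ~ blk 32 8 83 0 46 ∷
  blk 25 31 87 27 13 ~ blk 69 1 13 27 0 ∷ blk 67 28 19 0 34 ~ blk 80 58 3 28 67 ∷
  blk 8 44 27 0 39 ~ blk 23 0 27 77 85 ∷ blk 6 35 142 0 82 ~ blk 129 64 17 82 0 ∷
  blk 64 131 41 0 1 ~ blk 26 42 0 41 102 ∷ blk 17 133 57 78 46 ~ blk 92 67 78 57 0 ∷
  blk 50 131 0 7 88 ~ blk 115 81 7 0 42 ∷ blk 23 144 82 24 5 ~ blk 0 130 24 82 73 ∷ []) refl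

DD-165 : DD 165
DD-165 = cyclic-DD∞ 164 ((139 , blk 0 100 164 125 93) ∷ []) (
  blk 0 64 31 5 134 ~ blk 31 64 51 70 100 ∷ blk 0 72 125 5 154 ~ blk 72 0 41 131 47 ∷
  blk 32 0 84 65 67 ~ blk 50 151 0 32 28 ∷ blk 0 64 2 59 86 ~ blk 47 128 122 59 2 ∷
  blk 81 102 0 58 4 ~ blk 22 110 58 0 118 ∷ blk 2 93 0 145 18 ~ blk 96 67 0 93 10 ∷
  blk 0 91 63 77 1 ~ blk 91 0 83 40 148 ∷ blk 145 0 70 61 43 ~ blk 82 130 70 0 42 ∷
  blk 79 121 0 31 78 ~ blk 61 9 3 78 31 ∷ blk 0 140 95 85 98 ~ blk 48 36 140 0 99 ∷
  blk 56 111 0 7 3 ~ blk 85 44 7 0 94 ∷ blk 44 54 55 28 20 ~ blk 146 55 54 5 0 ∷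
  blk 0 20 66 133 46 ~ blk 66 20 32 81 70 ∷ blk 93 64 79 5 104 ~ blk 64 93 0 27 51 ∷
  blk 94 58 126 79 41 ~ blk 23 2 0 126 58 ∷ blk 0 16 7 55 30 ~ blk 27 7 16 24 61 ∷ []) refl

DD-166 : DD 166
DD-166 = cyclic-DD 166 ((106 , blk 0 43 103 60 67) ∷ []) (
  blk 122 28 67 56 0 ~ blk 41 103 0 56 154 ∷ blk 47 1 116 78 68 ~ blk 46 78 116 14 0 ∷
  blk 113 8 77 0 95 ~ blk 35 8 113 73 126 ∷ blk 1 75 53 125 124 ~ blk 0 31 75 1 24 ∷
  blk 8 161 92 109 6 ~ blk 0 6 109 127 54 ∷ blk 59 91 0 58 68 ~ blk 120 39 58 0 33 ∷
  blk 70 86 0 112 46 ~ blk 31 5 115 0 86 ∷ blk 45 109 0 14 1 ~ blk 153 125 76 14 0 ∷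
  blk 0 12 7 9 94 ~ blk 44 7 12 42 26 ∷ blk 0 4 8 10 149 ~ blk 30 96 21 4 0 ∷
  blk 85 0 106 56 90 ~ blk 90 56 12 37 2 ∷ blk 33 0 22 62 99 ~ blk 54 99 62 91 127 ∷
  blk 141 23 0 68 34 ~ blk 0 23 3 43 39 ∷ blk 0 92 146 86 27 ~ blk 27 86 74 39 135 ∷
  blk 28 144 61 19 4 ~ blk 83 19 61 0 76 ∷ blk 41 71 93 3 0 ~ blk 0 3 97 82 117 ∷ []) refl

DD-170 : DD 170
DD-170 = cyclic-DD∞ 169 [] (
  blk 98 0 145 78 69 ~ blk 108 0 98 39 44 ∷ blk 31 0 86 5 82 ~ blk 135 6 5 86 25 ∷
  blk 0 7 48 155 51 ~ blk 57 90 13 7 0 ∷ blk 65 0 85 55 18 ~ blk 97 55 85 120 40 ∷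
  blk 74 31 0 33 9 ~ blk 0 31 99 151 66 ∷ blk 87 100 47 0 60 ~ blk 17 98 71 60 0 ∷
  blk 2 36 0 85 143 ~ blk 141 36 2 102 29 ∷ blk 1 158 79 90 115 ~ blk 37 158 1 0 46 ∷
  blk 148 0 96 4 158 ~ blk 96 0 21 37 45 ∷ blk 0 67 4 46 42 ~ blk 48 76 163 4 67 ∷
  blk 0 95 34 97 31 ~ blk 23 95 0 49 29 ∷ blk 8 155 58 0 40 ~ blk 0 58 169 134 12 ∷
  blk 2 16 0 155 3 ~ blk 0 16 43 38 117 ∷ blk 0 109 53 15 68 ~ blk 48 19 109 0 135 ∷
  blk 8 0 56 88 37 ~ blk 63 0 8 91 127 ∷ blk 1 24 100 42 94 ~ blk 0 24 1 7 137 ∷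
  blk 8 5 99 149 64 ~ blk 99 5 0 67 22 ∷ []) refl

DD-171 : DD 171
DD-171 = cyclic-DD 171 [] (
  blk 0 99 37 54 98 ~ blk 94 91 34 98 54 ∷ blk 4 27 139 0 47 ~ blk 38 0 139 72 85 ∷
  blk 67 0 53 89 16 ~ blk 79 68 53 0 63 ∷ blk 28 55 0 66 6 ~ blk 102 6 66 52 97 ∷
  blk 0 94 28 96 5 ~ blk 68 22 28 94 147 ∷ blk 30 140 97 0 12 ~ blk 12 0 126 83 152 ∷
  blk 2 112 46 48 64 ~ blk 64 48 0 56 97 ∷ blk 47 9 0 71 51 ~ blk 2 52 71 0 13 ∷
  blk 34 86 147 1 24 ~ blk 90 0 1 147 130 ∷ blk 0 120 42 45 70 ~ blk 5 42 120 29 61 ∷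
  blk 79 3 164 93 58 ~ blk 25 3 79 55 0 ∷ blk 2 53 0 41 70 ~ blk 60 32 135 70 41 ∷
  blk 111 13 18 0 77 ~ blk 56 70 47 77 0 ∷ blk 6 69 0 87 90 ~ blk 80 69 6 39 145 ∷
  blk 21 76 4 0 88 ~ blk 121 88 0 39 8 ∷ blk 0 35 34 108 93 ~ blk 137 6 93 108 54 ∷
  blk 27 7 0 36 1 ~ blk 43 9 1 36 58 ∷ []) refl

DD-175 : DD 175
DD-175 = cyclic-DD∞ 174 ((97 , blk 0 86 174 163 89) ∷ []) (
  blk 36 110 63 0 62 ~ blk 92 62 0 48 121 ∷ blk 58 48 9 37 104 ~ blk 153 78 0 37 9 ∷
  blk 7 0 63 3 46 ~ blk 98 3 63 85 51 ∷ blk 7 2 8 104 43 ~ blk 2 7 143 0 121 ∷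
  blk 0 88 8 130 153 ~ blk 19 56 134 88 0 ∷ blk 16 77 124 2 20 ~ blk 69 114 0 20 2 ∷
  blk 66 35 116 8 51 ~ blk 167 108 51 8 0 ∷ blk 142 72 47 10 78 ~ blk 0 44 72 142 2 ∷
  blk 125 20 75 4 97 ~ blk 85 0 102 75 20 ∷ blk 32 6 20 0 84 ~ blk 164 35 84 0 75 ∷
  blk 9 117 161 0 38 ~ blk 58 6 38 0 129 ∷ blk 63 38 166 93 2 ~ blk 93 166 3 0 90 ∷
  blk 7 61 32 24 158 ~ blk 0 61 7 5 21 ∷ blk 64 34 83 0 33 ~ blk 136 33 0 9 120 ∷
  blk 6 163 25 1 40 ~ blk 68 0 1 25 101 ∷ blk 0 4 133 27 159 ~ blk 86 121 98 4 0 ∷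
  blk 81 13 0 63 148 ~ blk 115 133 0 13 24 ∷ []) refl

DD-176 : DD 176
DD-176 = cyclic-DD 176 ((88 , blk 0 42 117 29 31) ∷ []) (
  blk 3 69 90 0 33 ~ blk 152 85 117 33 0 ∷ blk 23 0 59 162 18 ~ blk 92 0 23 146 48 ∷
  blk 9 17 134 0 15 ~ blk 145 124 15 0 82 ∷ blk 0 99 62 77 73 ~ blk 38 81 41 99 0 ∷
  blk 47 1 61 98 0 ~ blk 128 20 1 47 149 ∷ blk 0 125 45 23 5 ~ blk 119 111 39 23 45 ∷
  blk 95 99 80 27 56 ~ blk 7 45 56 27 0 ∷ blk 0 72 1 56 84 ~ blk 7 1 72 14 123 ∷
  blk 143 95 4 0 30 ~ blk 101 52 4 95 62 ∷ blk 101 0 35 70 12 ~ blk 56 0 101 156 81 ∷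
  blk 35 1 74 42 11 ~ blk 71 1 35 10 0 ∷ blk 7 26 79 0 76 ~ blk 0 79 171 71 98 ∷
  blk 29 90 91 46 129 ~ blk 129 46 0 74 17 ∷ blk 65 68 54 70 0 ~ blk 34 54 68 4 148 ∷
  blk 9 136 0 13 98 ~ blk 34 13 0 22 82 ∷ blk 28 52 0 93 68 ~ blk 62 0 52 50 116 ∷
  blk 43 132 90 0 26 ~ blk 82 27 0 90 126 ∷ []) refl

DD-180 : DD 180
DD-180 = cyclic-DD∞ 179 [] (
  blk 106 46 150 1 51 ~ blk 19 0 51 1 134 ∷ blk 62 40 1 0 36 ~ blk 0 1 24 71 43 ∷
  blk 86 8 3 35 0 ~ blk 8 86 175 27 61 ∷ blk 52 0 88 16 26 ~ blk 167 46 0 52 9 ∷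
  blk 1 0 67 49 46 ~ blk 46 49 13 108 77 ∷ blk 106 0 2 82 57 ~ blk 4 74 2 0 20 ∷
  blk 0 159 170 91 38 ~ blk 1 76 87 38 91 ∷ blk 154 0 77 149 84 ~ blk 9 23 17 77 0 ∷
  blk 31 88 0 128 112 ~ blk 20 71 10 0 88 ∷ blk 79 6 0 82 41 ~ blk 66 6 79 156 164 ∷
  blk 56 0 45 168 22 ~ blk 52 8 179 0 56 ∷ blk 0 92 50 113 79 ~ blk 69 82 29 92 0 ∷
  blk 139 58 14 76 0 ~ blk 124 133 92 0 76 ∷ blk 87 60 116 2 30 ~ blk 120 0 142 30 2 ∷
  blk 41 6 146 122 75 ~ blk 0 74 146 6 166 ∷ blk 84 0 99 14 52 ~ blk 59 138 0 84 96 ∷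
  blk 75 0 136 124 60 ~ blk 22 153 7 136 0 ∷ blk 98 140 167 71 5 ~ blk 78 0 85 5 71 ∷ []) refl

DD-181 : DD 181
DD-181 = cyclic-DD 181 [] (
  blk 0 31 139 25 6 ~ blk 31 0 76 47 41 ∷ blk 39 77 141 0 91 ~ blk 3 1 115 91 0 ∷
  blk 2 45 149 105 0 ~ blk 45 2 124 26 6 ∷ blk 93 78 7 27 163 ~ blk 0 7 78 176 55 ∷
  blk 55 0 42 12 25 ~ blk 11 13 93 0 55 ∷ blk 99 37 67 10 180 ~ blk 0 78 37 99 165 ∷
  blk 90 0 85 38 57 ~ blk 86 38 85 78 22 ∷ blk 57 120 66 80 0 ~ blk 0 80 70 164 5 ∷
  blk 24 36 73 0 41 ~ blk 72 0 73 99 123 ∷ blk 10 145 0 3 18 ~ blk 87 3 0 126 155 ∷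
  blk 4 0 134 75 125 ~ blk 62 75 134 90 42 ∷ blk 49 50 0 81 101 ~ blk 28 63 81 0 140 ∷
  blk 0 21 79 95 3 ~ blk 125 148 88 21 0 ∷ blk 0 75 22 67 167 ~ blk 139 117 22 75 1 ∷
  blk 88 4 0 65 73 ~ blk 54 65 0 82 111 ∷ blk 70 154 9 0 119 ~ blk 179 31 0 9 105 ∷
  blk 27 61 9 15 71 ~ blk 174 61 27 0 96 ∷ blk 79 0 98 4 30 ~ blk 30 4 113 171 76 ∷ []) refl

DD-185 : DD 185
DD-185 = cyclic-DD∞ 184 ((92 , blk 0 92 49 17 142) ∷ []) (
  blk 4 98 170 68 0 ~ blk 169 46 152 98 4 ∷ blk 68 7 78 109 79 ~ blk 7 68 13 53 0 ∷
  blk 8 0 153 81 55 ~ blk 7 55 81 165 157 ∷ blk 0 2 137 4 7 ~ blk 130 2 0 12 28 ∷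
  blk 48 1 0 43 59 ~ blk 158 84 59 43 79 ∷ blk 41 134 17 0 124 ~ blk 0 17 21 149 79 ∷
  blk 0 20 146 118 1 ~ blk 161 83 20 0 77 ∷ blk 49 70 94 9 22 ~ blk 22 9 181 0 97 ∷
  blk 108 0 7 87 25 ~ blk 120 25 87 129 11 ∷ blk 119 0 80 53 30 ~ blk 43 36 80 0 74 ∷
  blk 90 46 27 61 52 ~ blk 12 0 138 27 46 ∷ blk 1 64 99 132 0 ~ blk 0 132 164 29 88 ∷
  blk 34 131 0 94 71 ~ blk 150 71 94 6 83 ∷ blk 3 136 171 0 90 ~ blk 80 52 7 136 3 ∷
  blk 114 29 146 0 57 ~ blk 71 2 162 57 0 ∷ blk 145 50 0 64 29 ~ blk 64 0 69 24 33 ∷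
  blk 93 137 18 0 78 ~ blk 0 18 114 45 8 ∷ blk 62 0 30 8 181 ~ blk 81 151 184 8 30 ∷ []) refl

DD-186 : DD 186
DD-186 = cyclic-DD 186 ((93 , blk 0 143 65 109 16) ∷ []) (
  blk 0 52 12 8 139 ~ blk 12 52 161 57 85 ∷ blk 73 86 7 108 154 ~ blk 108 7 0 87 150 ∷
  blk 79 27 99 7 54 ~ blk 18 0 7 99 185 ∷ blk 30 51 0 76 3 ~ blk 69 1 51 30 53 ∷
  blk 33 6 25 0 74 ~ blk 88 17 50 74 0 ∷ blk 117 65 70 9 7 ~ blk 70 65 183 85 0 ∷
  blk 168 3 65 17 0 ~ blk 89 32 111 0 17 ∷ blk 42 175 60 0 111 ~ blk 102 0 60 48 32 ∷
  blk 24 148 143 0 10 ~ blk 119 97 6 10 0 ∷ blk 37 0 62 90 98 ~ blk 62 0 72 88 146 ∷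
  blk 0 54 1 66 103 ~ blk 54 0 160 51 31 ∷ blk 31 67 122 63 0 ~ blk 132 46 104 0 63 ∷
  blk 100 175 0 55 29 ~ blk 84 90 46 55 0 ∷ blk 75 160 79 1 0 ~ blk 143 0 1 177 61 ∷
  blk 9 33 0 2 39 ~ blk 33 9 78 137 18 ∷ blk 106 0 93 71 42 ~ blk 36 92 23 0 106 ∷
  blk 66 89 0 96 130 ~ blk 96 0 47 15 13 ∷ blk 107 12 50 0 31 ~ blk 0 50 175 89 145 ∷ []) refl

-- Transversal designs and the recursion

-- Two lines of different slopes among 0 , … , 5 meet once, because the
-- differences 1 , … , 5 divide 60 and hence are units modulo m.
module Lines (m : ℕ) .{{_ : NonZero m}} (s : ℕ) (unit : (m * s) % 60 ≡ 1) where
  open Mod m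

  -- The equation `m * s = 1 + w * 60`, read modulo `m`, says that -w is an inverse of 60. For
  -- `q * d = 60` the number `w * q` is then the negative of an inverse of `d`; the negative is used
  -- to stay within ℕ.
  negative-inverse : ∀ {d} → 1 ≤ d → d ≤ 5 → ∃ λ k → k * d + 1 ≈ 0
  negative-inverse {d} 1≤d d≤5 = go d 1≤d d≤5
    where
    w = m * s / 60
    w*60+1≈0 : ∀ {x} → x ≡ 1 + w * 60 → x ≈ 0
    w*60+1≈0 refl = trans (cong (_% m) (trans (cong (_+ w * 60) (sym unit)) (trans (sym (m≡m%n+[m/n]*n (m * s) 60)) (ℕ.*-comm m s)))) (+kN 0 s)
    inverse : ∀ q d → q * d ≡ 60 → ∃ λ k → k * d + 1 ≈ 0
    inverse q d e = w * q , w*60+1≈0 (trans (ℕ.+-comm _ 1) (cong suc (trans (ℕ.*-assoc w q d) (cong (w *_) e))))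
    go : ∀ d → 1 ≤ d → d ≤ 5 → ∃ λ k → k * d + 1 ≈ 0
    go 1 _ _ = inverse 60 1 refl
    go 2 _ _ = inverse 30 2 refl
    go 3 _ _ = inverse 20 3 refl
    go 4 _ _ = inverse 15 4 refl
    go 5 _ _ = inverse 12 5 refl
    go (suc (suc (suc (suc (suc (suc d)))))) _ (s≤s (s≤s (s≤s (s≤s (s≤s ())))))

  lineAt : ℕ → ℕ → (g : ℕ) → Dec (g < 6) → ℕ
  lineAt x y g (yes _) = (x + g * y) % m
  lineAt x y g (no _) = y

  line : ℕ → ℕ → ℕ → ℕ
  line x y g = lineAt x y g (g <? 6)

  line-slope : ∀ {x y g} → g < 6 → line x y g ≡ (x + g * y) % m
  line-slope {g = g} g< with g <? 6
  ... | yes _ = refl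
  ... | no g≮ = contradiction g< g≮

  line-vertical : ∀ {x y g} → ¬ g < 6 → line x y g ≡ y
  line-vertical {g = g} g≮ with g <? 6
  ... | yes g< = contradiction g< g≮
  ... | no _ = refl

  UniqueLine : ℕ → ℕ → ℕ → ℕ → Set
  UniqueLine g h e e′ = ∃₂ λ x₀ y₀ → x₀ < m × y₀ < m × line x₀ y₀ g ≡ e × line x₀ y₀ h ≡ e′ ×
    (∀ {x y} → x < m → y < m → line x y g ≡ e → line x y h ≡ e′ → x ≡ x₀ × y ≡ y₀)

  determined : ∀ {x x₀ y g e} → x < m → x₀ < m → x + g * y ≈ e → x₀ + g * y ≈ e → x ≡ x₀
  determined {x} {x₀} {y} {g} x< x₀< p q = ≈⇒≡ x< x₀< (≈-cancelʳ (g * y) (trans p (sym q)))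

  intercept : ∀ {e} c → e < m → (e + (m ∸ c % m)) % m + c ≈ e
  intercept {e} c e< = trans (≈-+ {(e + (m ∸ c % m)) % m} {e + (m ∸ c % m)} {c} {c % m} (%-≈ _) (sym (%-≈ c)))
    (trans (cong (_% m) (ℕ.+-comm (e + (m ∸ c % m)) (c % m))) (neg e (ℕ.<⇒≤ (m%n<n c m))))

  slope-value : ∀ {x y g e} → g < 6 → line x y g ≡ e → x + g * y ≈ e
  slope-value {x} {y} {g} g< refl = sym (trans (cong (_% m) (line-slope {x} {y} g<)) (%-≈ (x + g * y)))

  slope-value⁻ : ∀ {x y g e} → g < 6 → e < m → x + g * y ≈ e → line x y g ≡ e
  slope-value⁻ {x} {y} g< e< p = trans (line-slope {x} {y} g<) (trans p (m<n⇒m%n≡m e<))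

  -- Subtracting the two line equations leaves `d * y + c ≈ 0`, where `c` stands for e - e′. As
  -- `k * d` is -1 modulo `m`, multiplication by `k` gives y = k c, and x follows from either
  -- equation.
  two-slopes : ∀ {g d e e′} → g < 6 → g + d < 6 → 1 ≤ d → d ≤ 5 → e < m → e′ < m → UniqueLine g (g + d) e e′
  two-slopes {g} {d} {e} {e′} g< h< 1≤d d≤5 e< e′< with k , kd+1≈0 ← negative-inverse 1≤d d≤5 =
    x₀ , y₀ , m%n<n _ m , m%n<n _ m , slope-value⁻ {x₀} {y₀} g< e< on-g , slope-value⁻ {x₀} {y₀} h< e′< on-h , only
    where
    c y₀ x₀ : ℕ
    c = e + (m ∸ e′)
    y₀ = (k * c) % m
    x₀ = (e + (m ∸ (g * y₀) % m)) % m
    on-g : x₀ + g * y₀ ≈ e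
    on-g = intercept (g * y₀) e<
    e′+≈0 : e′ + (m ∸ e′) ≈ 0
    e′+≈0 = neg 0 (ℕ.<⇒≤ e′<)
    split : ∀ {x y} → x + (g + d) * y ≡ (x + g * y) + d * y
    split {x} {y} = lemma x y g d
      where
      lemma : ∀ x y g d → x + (g + d) * y ≡ (x + g * y) + d * y
      lemma = solve-∀
    on-h : x₀ + (g + d) * y₀ ≈ e′
    on-h = ≈-cancelʳ (m ∸ e′) (begin
      (x₀ + (g + d) * y₀ + (m ∸ e′)) % m ≡⟨ cong (λ z → (z + (m ∸ e′)) % m) (split {x₀} {y₀}) ⟩
      (x₀ + g * y₀ + d * y₀ + (m ∸ e′)) % m ≡⟨ ≈-+ {x₀ + g * y₀ + d * y₀} {e + d * (k * c)} {m ∸ e′} (≈-+ {x₀ + g * y₀} {e} on-g (≈-* d (%-≈ (k * c)))) refl ⟩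
      (e + d * (k * c) + (m ∸ e′)) % m ≡⟨ cong (_% m) (lemma e d k (m ∸ e′)) ⟩
      ((e + (m ∸ e′)) * (k * d + 1)) % m ≡⟨ ≈-* c kd+1≈0 ⟩
      (c * 0) % m ≡⟨ cong (_% m) (ℕ.*-zeroʳ c) ⟩
      0 % m ≡⟨ e′+≈0 ⟨
      (e′ + (m ∸ e′)) % m ∎)
      where
      open ≡-Reasoning
      lemma : ∀ e d k f → e + d * (k * (e + f)) + f ≡ (e + f) * (k * d + 1)
      lemma = solve-∀
    only : ∀ {x y} → x < m → y < m → line x y g ≡ e → line x y (g + d) ≡ e′ → x ≡ x₀ × y ≡ y₀
    only {x} {y} x< y< p q = determined {g = g} x< (m%n<n _ m) (trans (cong (λ y → (x + g * y) % m) (sym y≡y₀)) p′) on-g , y≡y₀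
      where
      open ≡-Reasoning
      p′ : x + g * y ≈ e
      p′ = slope-value {x} {y} g< p
      q′ : x + (g + d) * y ≈ e′
      q′ = slope-value {x} {y} h< q
      dy+c≈0 : d * y + c ≈ 0
      dy+c≈0 = begin
        (d * y + (e + (m ∸ e′))) % m ≡⟨ cong (_% m) (lemma (d * y) e (m ∸ e′)) ⟩
        (e + (d * y + (m ∸ e′))) % m ≡⟨ ≈-+ {e} {x + g * y} (sym p′) refl ⟩
        (x + g * y + (d * y + (m ∸ e′))) % m ≡⟨ cong (_% m) (trans (sym (ℕ.+-assoc (x + g * y) (d * y) _)) (cong (_+ (m ∸ e′)) (sym (split {x} {y})))) ⟩
        (x + (g + d) * y + (m ∸ e′)) % m ≡⟨ ≈-+ {x + (g + d) * y} {e′} q′ refl ⟩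
        (e′ + (m ∸ e′)) % m ≡⟨ e′+≈0 ⟩
        0 % m ∎
        where
        lemma : ∀ a e f → a + (e + f) ≡ e + (a + f)
        lemma = solve-∀
      y≡y₀ : y ≡ y₀
      y≡y₀ = ≈⇒≡ y< (m%n<n _ m) (begin
        y % m ≡⟨ cong (_% m) (lemma₀ y k) ⟩
        (y + k * 0) % m ≡⟨ ≈-+ {y} {y} refl (≈-* k dy+c≈0) ⟨
        (y + k * (d * y + c)) % m ≡⟨ cong (_% m) (lemma₁ y k d c) ⟩
        (k * c + y * (k * d + 1)) % m ≡⟨ ≈-+ {k * c} {k * c} refl (≈-* y kd+1≈0) ⟩
        (k * c + y * 0) % m ≡⟨ cong (_% m) (lemma₀′ (k * c) y) ⟩
        (k * c) % m ≡⟨ %-≈ (k * c) ⟨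
        (k * c) % m % m ∎)
        where
        lemma₀ : ∀ y k → y ≡ y + k * 0
        lemma₀ = solve-∀
        lemma₀′ : ∀ a y → a + y * 0 ≡ a
        lemma₀′ = solve-∀
        lemma₁ : ∀ y k d c → y + k * (d * y + c) ≡ k * c + y * (k * d + 1)
        lemma₁ = solve-∀

  slope-vertical : ∀ {g h e e′} → g < 6 → ¬ h < 6 → e < m → e′ < m → UniqueLine g h e e′
  slope-vertical {g} {h} {e} {e′} g< h≮ e< e′< = x₀ , e′ , m%n<n _ m , e′< , slope-value⁻ {x₀} {e′} g< e< on-g , line-vertical {x₀} {e′} h≮ ,
    λ {x} {y} x< y< p q → only x< (trans (sym (line-vertical {x} {y} h≮)) q) p
    where
    x₀ : ℕ
    x₀ = (e + (m ∸ (g * e′) % m)) % m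
    on-g : x₀ + g * e′ ≈ e
    on-g = intercept (g * e′) e<
    only : ∀ {x y} → x < m → y ≡ e′ → line x y g ≡ e → x ≡ x₀ × y ≡ e′
    only {x} {y} x< refl p = determined {g = g} x< (m%n<n _ m) (slope-value {x} {y} g< p) on-g , refl

  lines : List (ℕ → ℕ)
  lines = concatMap (λ y → map (λ x → line x y) (upTo m)) (upTo m)

  count-lines : ∀ {g h e e′} → UniqueLine g h e e′ → ∑ lines (λ r → 𝟙 ((r g ≟ e) ×-dec (r h ≟ e′))) ≡ 1
  count-lines {g} {h} {e} {e′} (x₀ , y₀ , x₀< , y₀< , p , q , only) = begin
    ∑ lines (λ r → 𝟙 ((r g ≟ e) ×-dec (r h ≟ e′))) ≡⟨ ∑-concatMap (λ y → map (λ x → line x y) (upTo m)) (upTo m) ⟩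
    ∑ (upTo m) (λ y → ∑ (map (λ x → line x y) (upTo m)) (λ r → 𝟙 ((r g ≟ e) ×-dec (r h ≟ e′))))
      ≡⟨ ∑-cong {is = upTo m} (λ {y} _ → ∑-map (λ x → line x y) (upTo m)) ⟩
    ∑ (upTo m) (λ y → ∑ (upTo m) (F y))
      ≡⟨ ∑-upTo (λ y → ∑ (upTo m) (F y)) y₀< (λ y y< y≢ → ∑-zero {is = upTo m} (λ {x} x∈ → 𝟙-no (line x y g ≟ e ×-dec line x y h ≟ e′)
          (λ (p , q) → y≢ (proj₂ (only (∈-upTo⁻ x∈) y< p q))))) ⟩
    ∑ (upTo m) (F y₀) ≡⟨ ∑-upTo (F y₀) x₀< (λ x x< x≢ → 𝟙-no (line x y₀ g ≟ e ×-dec line x y₀ h ≟ e′) (λ (p , q) → x≢ (proj₁ (only x< y₀< p q)))) ⟩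
    F y₀ x₀ ≡⟨ 𝟙-yes (line x₀ y₀ g ≟ e ×-dec line x₀ y₀ h ≟ e′) (p , q) ⟩
    1 ∎
    where
    open ≡-Reasoning
    F : ℕ → ℕ → ℕ
    F y x = 𝟙 ((line x y g ≟ e) ×-dec (line x y h ≟ e′))

  unique-line : ∀ {g h e e′} → g < h → h < 7 → e < m → e′ < m → UniqueLine g h e e′
  unique-line {g} {h} {e} {e′} g<h h<7 e< e′< = go (h <? 6)
    where
    go : Dec (h < 6) → UniqueLine g h e e′
    go (no h≮) = slope-vertical (ℕ.<-≤-trans g<h (ℕ.≤-pred h<7)) h≮ e< e′<
    go (yes h<) = subst (λ h → UniqueLine g h e e′) (ℕ.m+[n∸m]≡n (ℕ.<⇒≤ g<h))
      (two-slopes (ℕ.<-trans g<h h<) (subst (_< 6) (sym (ℕ.m+[n∸m]≡n (ℕ.<⇒≤ g<h))) h<)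
        (ℕ.m<n⇒0<n∸m g<h) (ℕ.≤-trans (ℕ.m∸n≤m h g) (ℕ.≤-pred h<)) e< e′<)

  lines-TD : TD 7 m
  lines-TD = record { rows = lines ; range = λ r∈ _ → range′ r∈ ; once = once′ }
    where
    range′ : ∀ {r g} → r ∈ lines → r g < m
    range′ {g = g} r∈ with y , y∈ , r∈y ← find (∈-concatMap⁻ (λ y → map (λ x → line x y) (upTo m)) {xs = upTo m} r∈)
      with x , x∈ , refl ← ∈-map⁻ (λ x → line x y) r∈y with g <? 6
    ... | yes _ = m%n<n (x + g * y) m
    ... | no _ = ∈-upTo⁻ y∈
    once′ : ∀ {g h e e′} → g < 7 → h < 7 → g ≢ h → e < m → e′ < m → ∑ lines (λ r → 𝟙 ((r g ≟ e) ×-dec (r h ≟ e′))) ≡ 1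
    once′ {g} {h} {e} {e′} g< h< g≢h e< e′< with ℕ.<-cmp g h
    ... | tri< g<h _ _ = count-lines (unique-line g<h h< e< e′<)
    ... | tri≈ _ g≡h _ = contradiction g≡h g≢h
    ... | tri> _ _ h<g = trans (∑-cong {is = lines} (λ {r} _ → 𝟙-cong (r g ≟ e ×-dec r h ≟ e′) (r h ≟ e′ ×-dec r g ≟ e) swap swap))
          (count-lines (unique-line h<g g< e′< e<))

module _ {K m : ℕ} .{{_ : NonZero m}} (rs : List (ℕ → ℕ)) where

  IsTD : Set
  IsTD = All (λ r → All (λ g → r g < m) (upTo K)) rs ×
    All (λ g → All (λ h → g ≡ h ⊎ T (occursBelow (m * m) (λ _ → 1) (map (λ r → r h + r g * m) rs))) (upTo K)) (upTo K)

  isTD? : Dec IsTD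
  isTD? = All.all? (λ r → All.all? (λ g → r g <? m) (upTo K)) rs ×-dec
    All.all? (λ g → All.all? (λ h → (g ≟ h) ⊎-dec T? (occursBelow (m * m) (λ _ → 1) (map (λ r → r h + r g * m) rs))) (upTo K)) (upTo K)

  checked-TD : does isTD? ≡ true → TD K m
  checked-TD ok = record { rows = rs ; range = range′ ; once = once′ }
    where
    isTD : IsTD
    isTD = fromDoes isTD? ok
    range′ : ∀ {r g} → r ∈ rs → g < K → r g < m
    range′ r∈ g< = All.lookup (All.lookup (proj₁ isTD) r∈) (∈-upTo⁺ g<)
    once′ : ∀ {g h e e′} → g < K → h < K → g ≢ h → e < m → e′ < m → ∑ rs (λ r → 𝟙 ((r g ≟ e) ×-dec (r h ≟ e′))) ≡ 1
    once′ {g} {h} {e} {e′} g< h< g≢h e< e′< with All.lookup (All.lookup (proj₂ isTD) (∈-upTo⁺ g<)) (∈-upTo⁺ h<)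
    ... | inj₁ g≡h = contradiction g≡h g≢h
    ... | inj₂ t = trans (∑-cong {is = rs} (λ {r} r∈ → 𝟙-cong (r g ≟ e ×-dec r h ≟ e′) (r h + r g * m ≟ e′ + e * m)
            (λ (p , q) → cong₂ (λ a b → b + a * m) p q)
            (λ p → trans (sym (proj₂ (quot-rem (r g) m (range′ r∈ h<)))) (trans (cong (_/ m) p) (proj₂ (quot-rem e m e′<))) ,
                   trans (sym (proj₁ (quot-rem (r g) m (range′ r∈ h<)))) (trans (cong (_% m) p) (proj₁ (quot-rem e m e′<))))))
          (trans (sym (∑-map (λ r → r h + r g * m) rs))
            (occursBelow-sound {m * m} {λ _ → 1} {map (λ r → r h + r g * m) rs} t
              (ℕ.<-≤-trans (ℕ.+-monoˡ-< (e * m) e′<) (ℕ.*-monoˡ-≤ m e<))))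

-- 𝔽₉ = 𝔽₃(i), with a + b i represented by a + 3 b.
line₉ : ℕ → ℕ → ℕ → ℕ
line₉ x y 6 = y
line₉ x y g = (x + g * y + 2 * (g / 3) * (y / 3)) % 3 + 3 * ((x / 3 + g * (y / 3) + (g / 3) * y) % 3)

TD-7-9 : TD 7 9
TD-7-9 = checked-TD (concatMap (λ y → map (λ x → line₉ x y) (upTo 9)) (upTo 9)) refl

-- Filling in groups and the choice of the parameters m, a, b

Fills : ℕ → Set
Fills n = ∀ ε → ε ≤ 1 → DD (5 * n + ε)

DD-pair⇒Fills : ∀ {n} → DD (5 * n) × DD (5 * n + 1) → Fills n
DD-pair⇒Fills {n} (D , E) zero _ = subst DD (sym (ℕ.+-identityʳ (5 * n))) D
DD-pair⇒Fills (D , E) (suc zero) _ = E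
DD-pair⇒Fills (D , E) (suc (suc _)) (s≤s ())

-- On at most one point there are no pairs, and the empty list is a design. It fills groups that are
-- truncated away completely.
Fills-0 : Fills 0
Fills-0 ε ε≤1 = [] , Design-cong (λ x y → sym (cong (2 *_) (𝟙-no (distinct? ε x y) λ (x< , y< , ne) → ne (trans (only x<) (sym (only y<)))))) Design-[]
  where
  only : ∀ {x} → x < ε → x ≡ 0
  only x< with s≤s z≤n ← ℕ.≤-trans x< ε≤1 = refl

direct : All (λ n → DD (5 * n) × DD (5 * n + 1)) (applyUpTo (3 +_) 35)
direct =
  (DD-15 , DD-16) ∷ (DD-20 , DD-21) ∷ (DD-25 , DD-26) ∷ (DD-30 , DD-31) ∷ (DD-35 , DD-36) ∷
  (DD-40 , DD-41) ∷ (DD-45 , DD-46) ∷ (DD-50 , DD-51) ∷ (DD-55 , DD-56) ∷ (DD-60 , DD-61) ∷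
  (DD-65 , DD-66) ∷ (DD-70 , DD-71) ∷ (DD-75 , DD-76) ∷ (DD-80 , DD-81) ∷ (DD-85 , DD-86) ∷
  (DD-90 , DD-91) ∷ (DD-95 , DD-96) ∷ (DD-100 , DD-101) ∷ (DD-105 , DD-106) ∷ (DD-110 , DD-111) ∷
  (DD-115 , DD-116) ∷ (DD-120 , DD-121) ∷ (DD-125 , DD-126) ∷ (DD-130 , DD-131) ∷ (DD-135 , DD-136) ∷
  (DD-140 , DD-141) ∷ (DD-145 , DD-146) ∷ (DD-150 , DD-151) ∷ (DD-155 , DD-156) ∷ (DD-160 , DD-161) ∷
  (DD-165 , DD-166) ∷ (DD-170 , DD-171) ∷ (DD-175 , DD-176) ∷ (DD-180 , DD-181) ∷ (DD-185 , DD-186) ∷ []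

-- The values 5, 6 and 7 are the numbers of groups in which a row can keep a point when two of seven
-- groups are truncated.
ingredient : ∀ k .{{_ : NonZero k}} → 5 ≤ k → k ≤ 7 → GDD k (5 * k)
ingredient k 5≤k k≤7 with ℕ.m≤n⇒m<n∨m≡n k≤7
... | inj₂ refl = GDD-7
... | inj₁ (s≤s k≤6) with ℕ.m≤n⇒m<n∨m≡n k≤6
... | inj₂ refl = GDD-6
... | inj₁ (s≤s k≤5) with refl ← ℕ.≤-antisym 5≤k k≤5 = GDD-5

sizes : ℕ → ℕ → ℕ → List ℕ
sizes m a b = m ∷ m ∷ m ∷ m ∷ m ∷ a ∷ b ∷ []

truncate : ∀ {m a b} → TD 7 m → a ≤ m → b ≤ m → Fills m → Fills a → Fills b → Fills (5 * m + a + b)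
truncate {m} {a} {b} td a≤m b≤m Fm Fa Fb ε ε≤1 = subst DD (cong (_+ ε) (total m a b))
  (Inflate.inflate td (nth (sizes m a b)) full (All.lookup bounds ∘ nth-∈ (sizes m a b)) ingredient ε ε≤1
    (λ g → All.lookup fillings ∘ nth-∈ (sizes m a b)))
  where
  -- The left side is the shape in which `offset 7` unfolds, including its initial 0.
  total : ∀ m a b → 0 + 5 * m + 5 * m + 5 * m + 5 * m + 5 * m + 5 * a + 5 * b ≡ 5 * (5 * m + a + b)
  total = solve-∀
  full : ∀ {g} → g < 5 → nth (sizes m a b) g ≡ m
  full {0} _ = refl
  full {1} _ = refl
  full {2} _ = refl
  full {3} _ = refl
  full {4} _ = refl
  full {suc (suc (suc (suc (suc g))))} (s≤s (s≤s (s≤s (s≤s (s≤s ())))))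
  bounds : All (_≤ m) (sizes m a b)
  bounds = ℕ.≤-refl ∷ ℕ.≤-refl ∷ ℕ.≤-refl ∷ ℕ.≤-refl ∷ ℕ.≤-refl ∷ a≤m ∷ b≤m ∷ []
  fillings : All (λ t → DD (5 * t + ε)) (sizes m a b)
  fillings = F ∷ F ∷ F ∷ F ∷ F ∷ Fa ε ε≤1 ∷ Fb ε ε≤1 ∷ []
    where F = Fm ε ε≤1

-- The sizes to which a group may be truncated: it vanishes, or it is large enough for the induction
-- hypothesis. Sizes 1 and 2 would call for designs on fewer than 15 points.
Admissible : ℕ → Set
Admissible a = a ≡ 0 ⊎ 3 ≤ a

-- One group is used up before the other. If this leaves a remainder of 1 or 2, the second group
-- gets 3 points and the first the other r - 3, which is at most `m` because r < m + 3.
split : ∀ {m r} → 7 ≤ m → 3 ≤ r → r ≤ m + m → ∃₂ λ a b → a + b ≡ r × (a ≤ m × Admissible a) × (b ≤ m × Admissible b)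
split {m} {r} 7≤m 3≤r r≤2m with r ≤? m
... | yes r≤m = r , 0 , ℕ.+-identityʳ r , (r≤m , inj₂ 3≤r) , (z≤n , inj₁ refl)
... | no r≰m with 3 ≤? r ∸ m
... | yes 3≤ = m , r ∸ m , ℕ.m+[n∸m]≡n (ℕ.≰⇒≥ r≰m) , (ℕ.≤-refl , inj₂ (ℕ.≤-trans (s≤s (s≤s (s≤s z≤n))) 7≤m)) ,
      (ℕ.m≤n+o⇒m∸n≤o r m r≤2m , inj₂ 3≤)
... | no 3≰ = r ∸ 3 , 3 , ℕ.m∸n+n≡m 3≤r ,
      (ℕ.m≤n+o⇒m∸n≤o r 3 r≤3+m , inj₂ (ℕ.∸-monoˡ-≤ 3 (ℕ.≤-trans (ℕ.n≤1+n 6) (ℕ.≤-trans 7≤m m≤r)))) ,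
      (ℕ.≤-trans (s≤s (s≤s (s≤s z≤n))) 7≤m , inj₂ ℕ.≤-refl)
      where
      m≤r : m ≤ r
      m≤r = ℕ.≰⇒≥ r≰m
      r≤3+m : r ≤ 3 + m
      r≤3+m = subst₂ _≤_ (ℕ.m+[n∸m]≡n m≤r) (ℕ.+-comm m 3) (ℕ.+-monoʳ-≤ m (ℕ.<⇒≤ (ℕ.≰⇒> 3≰)))

7m≡5m+2m : ∀ m → 7 * m ≡ 5 * m + (m + m)
7m≡5m+2m = solve-∀

-- The bounds on `n` say that `n ∸ 5 * m` lies between 3 and 2 m, which is the range covered by
-- `split`.
step : ∀ {m n} → TD 7 m → 7 ≤ m → 3 + 5 * m ≤ n → n ≤ 7 * m → (∀ {k} → k < n → 3 ≤ k → Fills k) → Fills n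
step {m} {n} td 7≤m low high fills
  with a , b , e , (a≤ , a-adm) , (b≤ , b-adm) ← split {m} {n ∸ 5 * m} 7≤m
    (ℕ.m+n≤o⇒m≤o∸n 3 low) (ℕ.m≤n+o⇒m∸n≤o n (5 * m) (subst (n ≤_) (7m≡5m+2m m) high)) =
  subst Fills (trans (ℕ.+-assoc (5 * m) a b) (trans (cong (5 * m +_) e) (ℕ.m+[n∸m]≡n (ℕ.≤-trans (ℕ.m≤n+m _ 3) low))))
    (truncate td a≤ b≤ (fills m<n 3≤m) (fill a≤ a-adm) (fill b≤ b-adm))
  where
  3≤m : 3 ≤ m
  3≤m = ℕ.≤-trans (s≤s (s≤s (s≤s z≤n))) 7≤m
  m<n : m < n
  m<n = ℕ.<-≤-trans (s≤s (ℕ.≤-trans (ℕ.m≤m+n m (4 * m)) (ℕ.m≤n+m (5 * m) 2))) low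
  fill : ∀ {a} → a ≤ m → Admissible a → Fills a
  fill _ (inj₁ refl) = Fills-0
  fill a≤m (inj₂ 3≤a) = fills (ℕ.≤-<-trans a≤m m<n) 3≤a

Suitable : ℕ → ℕ → Set
Suitable n m = 7 ≤ m × 3 + 5 * m ≤ n × n ≤ 7 * m

-- The numbers 43, 11, 37, 53 are inverses of 7, 11, 13, 17 modulo 60. The intervals from 5 m + 3 to
-- 7 m are 38 to 49, 48 to 63, 58 to 77, 68 to 91 and 88 to 119, without gaps. The value m = 9 is
-- not prime to 60, hence 𝔽₉, but it bridges 50 to 57.
small-TDs : All (TD 7) (7 ∷ 9 ∷ 11 ∷ 13 ∷ 17 ∷ [])
small-TDs = Lines.lines-TD 7 43 refl ∷ TD-7-9 ∷ Lines.lines-TD 11 11 refl ∷ Lines.lines-TD 13 37 refl ∷ Lines.lines-TD 17 53 refl ∷ []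

small-table? : Dec (All (λ i → Any (Suitable (38 + i)) (7 ∷ 9 ∷ 11 ∷ 13 ∷ 17 ∷ [])) (upTo 82))
small-table? = All.all? (λ i → Any.any? (λ m → (7 ≤? m) ×-dec (3 + 5 * m ≤? 38 + i) ×-dec (38 + i ≤? 7 * m)) (7 ∷ 9 ∷ 11 ∷ 13 ∷ 17 ∷ [])) (upTo 82)

choose-small : ∀ {n} → 38 ≤ n → n < 120 → ∃ λ m → TD 7 m × Suitable n m
choose-small {n} 38≤n n<120 = subst (λ n → ∃ λ m → TD 7 m × Suitable n m) 38+[n∸38]≡n
  (pick small-TDs (All.lookup (fromDoes small-table? refl) (∈-upTo⁺ (ℕ.+-cancelˡ-< 38 _ _ (subst (_< 120) (sym 38+[n∸38]≡n) n<120)))))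
  where
  38+[n∸38]≡n : 38 + (n ∸ 38) ≡ n
  38+[n∸38]≡n = ℕ.m+[n∸m]≡n 38≤n
  pick : ∀ {n ms} → All (TD 7) ms → Any (Suitable n) ms → ∃ λ m → TD 7 m × Suitable n m
  pick tds p with m , m∈ , suitable ← find p = m , All.lookup tds m∈ , suitable

module _ (M k : ℕ) .{{_ : NonZero M}} where

  UnitsNearby : Set
  UnitsNearby = All (λ r → Any (λ j → Any (λ s → ((r + j) * s) % M ≡ 1) (upTo M)) (upTo k)) (upTo M)

  unitsNearby? : Dec UnitsNearby
  unitsNearby? = All.all? (λ r → Any.any? (λ j → Any.any? (λ s → ((r + j) * s) % M ≟ 1) (upTo M)) (upTo k)) (upTo M)

  unit-nearby : UnitsNearby → ∀ q → ∃₂ λ j s → j < k × ((q + j) * s) % M ≡ 1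
  unit-nearby nearby q with j , j∈ , p ← find (All.lookup nearby (∈-upTo⁺ (m%n<n q M))) with s , _ , e ← find p =
    j , s , ∈-upTo⁻ j∈ , trans (cong (_% M) (ℕ.*-comm (q + j) s)) (trans
      (Mod.≈-* M s (Mod.≈-+ M {q} {q % M} {j} {j} (sym (Mod.%-≈ M q)) refl)) (trans (cong (_% M) (ℕ.*-comm s (q % M + j))) e))

-- Consecutive integers prime to 60 differ by at most 6, as do 1 and 7, so six consecutive integers
-- always contain one.
units-60 : UnitsNearby 60 6
units-60 = fromDoes (unitsNearby? 60 6) refl

-- The lower bound is tightest for `j = 5`, where it reads 5 q + 33 ≤ 7 q; this holds from q = 17
-- on. The upper bound needs only that 1 + q exceeds n / 7.
suitable-large : ∀ {n q j} → 17 ≤ q → q * 7 ≤ n → n ≤ 7 + q * 7 → j ≤ 5 → Suitable n (1 + q + j)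
suitable-large {n} {q} {j} 17≤q q*7≤n n≤7+q*7 j≤5 = ℕ.≤-trans (ℕ.m≤n+m 7 10) (ℕ.≤-trans 17≤q q≤1+q+j) , low , high
  where
  open ℕ.≤-Reasoning
  q≤1+q+j : q ≤ 1 + q + j
  q≤1+q+j = ℕ.≤-trans (ℕ.n≤1+n q) (ℕ.m≤m+n (1 + q) j)
  low : 3 + 5 * (1 + q + j) ≤ n
  low = begin
    3 + 5 * (1 + q + j) ≤⟨ ℕ.+-monoʳ-≤ 3 (ℕ.*-monoʳ-≤ 5 (ℕ.+-monoʳ-≤ (1 + q) j≤5)) ⟩
    3 + 5 * (1 + q + 5) ≡⟨ lemma₁ q ⟩
    5 * q + 33          ≤⟨ ℕ.+-monoʳ-≤ (5 * q) (ℕ.≤-trans (ℕ.n≤1+n 33) (ℕ.*-monoʳ-≤ 2 17≤q)) ⟩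
    5 * q + 2 * q       ≡⟨ lemma₂ q ⟩
    q * 7               ≤⟨ q*7≤n ⟩
    n                   ∎
    where
    lemma₁ : ∀ q → 3 + 5 * (1 + q + 5) ≡ 5 * q + 33
    lemma₁ = solve-∀
    lemma₂ : ∀ q → 5 * q + 2 * q ≡ q * 7
    lemma₂ = solve-∀
  high : n ≤ 7 * (1 + q + j)
  high = begin
    n                  ≤⟨ n≤7+q*7 ⟩
    7 + q * 7          ≡⟨ lemma q ⟩
    7 * (1 + q)        ≤⟨ ℕ.*-monoʳ-≤ 7 (ℕ.m≤m+n (1 + q) j) ⟩
    7 * (1 + q + j)    ∎
    where
    lemma : ∀ q → 7 + q * 7 ≡ 7 * (1 + q)
    lemma = solve-∀

-- The candidates for m are the six integers following the quotient `n / 7`. The threshold 120 is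
-- where the table of small cases ends, and it makes this quotient at least 17.
choose-large : ∀ {n} → 120 ≤ n → ∃ λ m → TD 7 m × Suitable n m
choose-large {n} 120≤n = build (unit-nearby 60 6 units-60 (1 + n / 7))
  where
  upper : n ≤ 7 + n / 7 * 7
  upper = ℕ.≤-trans (ℕ.≤-reflexive (m≡m%n+[m/n]*n n 7)) (ℕ.+-monoˡ-≤ (n / 7 * 7) (ℕ.<⇒≤ (m%n<n n 7)))
  build : (∃₂ λ j s → j < 6 × ((1 + n / 7 + j) * s) % 60 ≡ 1) → ∃ λ m → TD 7 m × Suitable n m
  build (j , s , s≤s j≤5 , unit) = 1 + n / 7 + j , Lines.lines-TD (1 + n / 7 + j) s unit ,
    suitable-large (/-monoˡ-≤ 7 120≤n) (m/n*n≤m n 7) upper j≤5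

direct-fills : ∀ {n} → 3 ≤ n → n < 38 → Fills n
direct-fills {n} 3≤n n<38 = DD-pair⇒Fills {n} (subst Pair 3+[n∸3]≡n (All.lookup {P = Pair} direct (∈-applyUpTo⁺ (3 +_) n∸3<35)))
  where
  Pair : ℕ → Set
  Pair n = DD (5 * n) × DD (5 * n + 1)
  3+[n∸3]≡n : 3 + (n ∸ 3) ≡ n
  3+[n∸3]≡n = ℕ.m+[n∸m]≡n 3≤n
  n∸3<35 : n ∸ 3 < 35
  n∸3<35 = ℕ.+-cancelˡ-< 3 (n ∸ 3) 35 (subst (_< 38) (sym 3+[n∸3]≡n) n<38)

all-fills : ∀ n → 3 ≤ n → Fills n
all-fills = <-rec (λ n → 3 ≤ n → Fills n) (λ n rec 3≤n → go n rec 3≤n (n <? 38) (n <? 120))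
  where
  extend : ∀ {n} → (∀ {k} → k < n → 3 ≤ k → Fills k) → (∃ λ m → TD 7 m × Suitable n m) → Fills n
  extend rec (m , td , 7≤m , low , high) = step td 7≤m low high rec
  go : ∀ n → (∀ {k} → k < n → 3 ≤ k → Fills k) → 3 ≤ n → Dec (n < 38) → Dec (n < 120) → Fills n
  go n rec 3≤n (yes n<38) _ = direct-fills 3≤n n<38
  go n rec 3≤n (no n≮38) (yes n<120) = extend rec (choose-small (ℕ.≮⇒≥ n≮38) n<120)
  go n rec 3≤n (no _) (no n≮120) = extend rec (choose-large (ℕ.≮⇒≥ n≮120))

mainTheorem1 : (v : ℕ) → 15 ≤ v → (v % 5 ≡ 0 ⊎ v % 5 ≡ 1) →
    Σ (List (Block v)) (λ B →
    IsDD v B × SuperSimple B × SmallestDefiningRatioAtLeastHalf v B)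
-- The quotient by 5 is the parameter n, and the remainder, 0 or 1, is the number of points at
-- infinity.
mainTheorem1 v 15≤v residue = DD⇒theorem (ℕ.≤-trans (s≤s z≤n) 15≤v) (subst DD v≡ (all-fills (v / 5) (/-monoˡ-≤ 5 15≤v) (v % 5) (v%5≤1 residue)))
  where
  v%5≤1 : v % 5 ≡ 0 ⊎ v % 5 ≡ 1 → v % 5 ≤ 1
  v%5≤1 (inj₁ e) = subst (_≤ 1) (sym e) z≤n
  v%5≤1 (inj₂ e) = ℕ.≤-reflexive e
  v≡ : 5 * (v / 5) + v % 5 ≡ v
  v≡ = trans (ℕ.+-comm _ (v % 5)) (trans (cong (v % 5 +_) (ℕ.*-comm 5 (v / 5))) (sym (m≡m%n+[m/n]*n v 5)))
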